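{- When $p=0$ and $q=\omega=e^{2\pi i/3}$, $$\tilde Z_n(\omega,\dots,\omega;1,\dots,1;\lambda) =\frac{\omega^{\binom{n+1}2}}{(1-\lambda\omega^{n+1})(1-\lambda\omega^{n+2})}\left(A_n(1+\omega^{n}\lambda^2 )+(-1)^{n} C_n\omega^{2n}\lambda\right),$$ where $A_n=\prod_{j=1}^n\frac{(3j-2)!}{(n+j-1)!}$ is the number of $n\times n$ alternating sign matrices and $C_n=\prod_{j=1}^n\frac{(3j-1)(3j-3)!}{(n+j-1)!}$.
   Context: Fix $\tau,\eta$ with $\operatorname{Im}(\tau)>0$, $\eta\notin\mathbb Z+\tau\mathbb Z$; $p=e^{2\pi i\tau}$, $q=e^{2\pi i\eta}$, $q^x=e^{2\pi i\eta x}$, $[x]=q^{ -x/2}\prod_{j\ge0}(1-p^jq^x)(1-p^{j+1}q^{ -x})$. A state is an $(n+1)\times(n+1)$ integer matrix with adjacent entries differing by $1$, first row and first column $0,1,\dots,n$, last row and last column $n,n-1,\dots,0$. Each block $\left(\begin{smallmatrix}a&b\\c&d\end{smallmatrix}\right)$ (adjacent $2\times2$ submatrix) at position $(i,j)$ has weight $R^{b-a,d-b}_{d-c,c-a}(\lambda+a,x_i-y_j)$, with $R^{++}_{++}=R^{ -- }_{ -- }=[u+1]/[1]$, $R^{+- }_{+- }(\lambda,u)=[u][\lambda+1]/([1][\lambda])$, $R^{ -+}_{ -+}(\lambda,u)=[u][\lambda-1]/([1][\lambda])$, $R^{ -+}_{+- }(\lambda,u)=[\lambda+u]/[\lambda]$,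 $R^{+- }_{ -+}(\lambda,u)=[\lambda-u]/[\lambda]$; $Z_n(x;y;\lambda)$ is the sum over states of products of block weights (8VSOS, domain wall boundary conditions). $\tilde Z_n$ is defined by $\tilde Z_n(q^{x_1},\dots,q^{x_n};q^{y_1},\dots,q^{y_n};q^\lambda)=q^{n(|x|+|y|)/2}Z_n(x;y;\lambda)$, $|x|=\sum x_i$, $|y|=\sum y_i$. -}

module Defs where

open import Level using (_⊔_) renaming (suc to lsuc)
open import Algebra.Bundles using (CommutativeRing)
open import Data.Nat as ℕ using (ℕ; zero; suc; _∸_)
open import Data.Nat using (_!)
open import Data.Integer as ℤ using (ℤ; +_; -[1+_]; ∣_∣)
open import Data.Fin using (Fin; zero; suc; inject₁; toℕ; fromℕ)
open import Data.Fin.Properties using (all?)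
open import Data.List using (List; []; _∷_; filter; map; concatMap; upTo)
open import Data.Vec using (Vec; lookup) renaming ([] to []ᵛ; _∷_ to _∷ᵛ_)
open import Data.Product using (_×_; _,_)
open import Relation.Nullary using (¬_; Dec)
open import Relation.Nullary.Decidable using (_×-dec_)
open import Relation.Binary.PropositionalEquality using (_≡_)

-- Fields (not in agda-stdlib): a commutative ring with 0 ≠ 1 and a
-- total inverse operation which is a genuine inverse on nonzero elements
-- (the value of 0⁻¹ is unspecified and never used below).

record Field c ℓ : Set (lsuc (c ⊔ ℓ)) where
  field
    commutativeRing : CommutativeRing c ℓ
  open CommutativeRing commutativeRing public
  field
    _⁻¹        : Carrier → Carrier
    ⁻¹-cong    : ∀ {x y} → x ≈ y → x ⁻¹ ≈ y ⁻¹
    ⁻¹-inverse : ∀ {x} → ¬ (x ≈ 0#) → x * x ⁻¹ ≈ 1#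
    0≉1        : ¬ (0# ≈ 1#)

-- States of the 8VSOS model with domain wall boundary conditions.
-- A state is an (n+1)×(n+1) integer matrix, rows/columns indexed by Fin (suc n)
-- (index k ↔ the k-th row/column counted from 0).

Mat : ℕ → Set
Mat n = Vec (Vec ℤ (suc n)) (suc n)

_⟨_,_⟩ : ∀ {n} → Mat n → Fin (suc n) → Fin (suc n) → ℤ
M ⟨ i , j ⟩ = lookup (lookup M i) j

IsState : (n : ℕ) → Mat n → Set
IsState n M =
  (∀ (i : Fin (suc n)) (j : Fin n) → ∣ M ⟨ i , inject₁ j ⟩ ℤ.- M ⟨ i , suc j ⟩ ∣ ≡ 1) ×
  (∀ (i : Fin n) (j : Fin (suc n)) → ∣ M ⟨ inject₁ i , j ⟩ ℤ.- M ⟨ suc i , j ⟩ ∣ ≡ 1) ×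
  (∀ (k : Fin (suc n)) → M ⟨ zero , k ⟩ ≡ + toℕ k) ×
  (∀ (k : Fin (suc n)) → M ⟨ k , zero ⟩ ≡ + toℕ k) ×
  (∀ (k : Fin (suc n)) → M ⟨ fromℕ n , k ⟩ ≡ + (n ∸ toℕ k)) ×
  (∀ (k : Fin (suc n)) → M ⟨ k , fromℕ n ⟩ ≡ + (n ∸ toℕ k))

isState? : (n : ℕ) → (M : Mat n) → Dec (IsState n M)
isState? n M =
  all? (λ i → all? (λ j → ∣ M ⟨ i , inject₁ j ⟩ ℤ.- M ⟨ i , suc j ⟩ ∣ ℕ.≟ 1)) ×-dec
  all? (λ i → all? (λ j → ∣ M ⟨ inject₁ i , j ⟩ ℤ.- M ⟨ suc i , j ⟩ ∣ ℕ.≟ 1)) ×-dec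
  all? (λ k → M ⟨ zero , k ⟩ ℤ.≟ + toℕ k) ×-dec
  all? (λ k → M ⟨ k , zero ⟩ ℤ.≟ + toℕ k) ×-dec
  all? (λ k → M ⟨ fromℕ n , k ⟩ ℤ.≟ + (n ∸ toℕ k)) ×-dec
  all? (λ k → M ⟨ k , fromℕ n ⟩ ℤ.≟ + (n ∸ toℕ k))

vecs : ∀ {a} {A : Set a} → List A → (k : ℕ) → List (Vec A k)
vecs xs zero    = []ᵛ ∷ []
vecs xs (suc k) = concatMap (λ x → map (x ∷ᵛ_) (vecs xs k)) xs

-- the integers -2n, …, 2n.  Every entry of a state lies in this range
-- (it is reached from the corner entry 0 by at most 2n steps of ±1).
box : ℕ → List ℤ
box n = map (λ k → + k ℤ.- + (2 ℕ.* n)) (upTo (suc (4 ℕ.* n)))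

states : (n : ℕ) → List (Mat n)
states n = filter (isState? n) (vecs (vecs (box n) (suc n)) (suc n))

-- The partition function at p = 0, over a field F.
--
-- Convention: every complex exponent z enters only through the
-- "half exponential" q^{z/2} = e^{πiηz}.  At p = 0,
--   [z] = q^{-z/2} (1 - q^z) = t⁻¹ (1 - t²)   where t = q^{z/2},
-- and q^{(z+w)/2} = q^{z/2} q^{w/2}, q^{-z/2} = (q^{z/2})⁻¹.

module FieldDefs {c ℓ} (F : Field c ℓ) where
  open Field F public using (Carrier; _≈_; _+_; _*_; -_; 0#; 1#; _⁻¹)

  infixl 7 _/_
  _/_ : Carrier → Carrier → Carrier
  x / y = x * y ⁻¹

  pow : Carrier → ℕ → Carrier
  pow x zero    = 1#
  pow x (suc k) = x * pow x k

  zpow : Carrier → ℤ → Carrier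
  zpow x (+ k)      = pow x k
  zpow x -[1+ k ]   = (pow x (suc k)) ⁻¹

  fromℕ′ : ℕ → Carrier
  fromℕ′ zero    = 0#
  fromℕ′ (suc m) = 1# + fromℕ′ m

  ∏ : (k : ℕ) → (Fin k → Carrier) → Carrier
  ∏ zero    f = 1#
  ∏ (suc k) f = f zero * ∏ k (λ i → f (suc i))

  sumL : List Carrier → Carrier
  sumL []       = 0#
  sumL (x ∷ xs) = x + sumL xs

  -- [z] at p = 0, as a function of t = q^{z/2}
  br : Carrier → Carrier
  br t = t ⁻¹ * (1# + - (t * t))

  -- R^{αβ}_{γδ}(λ', u) with  T = q^{λ'/2},  U = q^{u/2},  s = q^{1/2}
  -- (so q^{(λ'±1)/2} = T s^{±1}, q^{(λ'±u)/2} = T U^{±1}, q^{(u+1)/2} = U s).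
  -- Sign patterns other than the six listed do not occur in states.
  R : (α β γ δ : ℤ) → (T U s : Carrier) → Carrier
  R (+ 1)    (+ 1)    (+ 1)    (+ 1)    T U s = br (U * s) / br s
  R -[1+ 0 ] -[1+ 0 ] -[1+ 0 ] -[1+ 0 ] T U s = br (U * s) / br s
  R (+ 1)    -[1+ 0 ] (+ 1)    -[1+ 0 ] T U s = br U * br (T * s) / (br s * br T)
  R -[1+ 0 ] (+ 1)    -[1+ 0 ] (+ 1)    T U s = br U * br (T * s ⁻¹) / (br s * br T)
  R -[1+ 0 ] (+ 1)    (+ 1)    -[1+ 0 ] T U s = br (T * U) / br T
  R (+ 1)    -[1+ 0 ] -[1+ 0 ] (+ 1)    T U s = br (T * U ⁻¹) / br T
  R _        _        _        _        T U s = 0#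

  -- Weight of the block (a b / c d) at position (i,j):
  --   R^{b-a,d-b}_{d-c,c-a}(λ + a, x_i - y_j)
  -- with ξ i = q^{x_i/2}, υ j = q^{y_j/2}, T = q^{λ/2}, s = q^{1/2}.
  blockWeight : ∀ {n} → Mat n → (ξ υ : Fin n → Carrier) → (T s : Carrier)
              → Fin n → Fin n → Carrier
  blockWeight M ξ υ T s i j =
    let a = M ⟨ inject₁ i , inject₁ j ⟩
        b = M ⟨ inject₁ i , suc j ⟩
        cc = M ⟨ suc i , inject₁ j ⟩
        d = M ⟨ suc i , suc j ⟩
    in R (b ℤ.- a) (d ℤ.- b) (d ℤ.- cc) (cc ℤ.- a) (T * zpow s a) (ξ i * υ j ⁻¹) s

  stateWeight : ∀ {n} → Mat n → (ξ υ : Fin n → Carrier) → (T s : Carrier) → Carrier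
  stateWeight {n} M ξ υ T s = ∏ n (λ i → ∏ n (λ j → blockWeight M ξ υ T s i j))

  Z : (n : ℕ) → (ξ υ : Fin n → Carrier) → (T s : Carrier) → Carrier
  Z n ξ υ T s = sumL (map (λ M → stateWeight M ξ υ T s) (states n))

  -- Z̃_n = q^{n(|x|+|y|)/2} Z_n,  q^{n(|x|+|y|)/2} = ∏ᵢ (q^{xᵢ/2})ⁿ ∏ⱼ (q^{yⱼ/2})ⁿ
  Ztilde : (n : ℕ) → (ξ υ : Fin n → Carrier) → (T s : Carrier) → Carrier
  Ztilde n ξ υ T s =
    ∏ n (λ i → pow (ξ i) n) * ∏ n (λ j → pow (υ j) n) * Z n ξ υ T s

  Aₙ : ℕ → Carrier
  Aₙ n = ∏ n (λ j → let j′ = suc (toℕ j) in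
                   fromℕ′ ((3 ℕ.* j′ ∸ 2) !) / fromℕ′ ((n ℕ.+ j′ ∸ 1) !))

  Cₙ : ℕ → Carrier
  Cₙ n = ∏ n (λ j → let j′ = suc (toℕ j) in
                   fromℕ′ (3 ℕ.* j′ ∸ 1) * fromℕ′ ((3 ℕ.* j′ ∸ 3) !)
                     / fromℕ′ ((n ℕ.+ j′ ∸ 1) !))

{-# OPTIONS --safe #-}

-- Write x = ω z and multiply all weights by 1 − ω.  For q = ω the partition function, cleared of its
-- denominators and multiplied by the Vandermonde determinant of all 2n variables z and y, is
-- (Izergin–Korepin, Stroganov, Rosengren)
--
--   P (ωⁿ ∏z D₁ + (−1)ⁿ Λ D₂ + ω²ⁿ Λ² ∏y D₁),
--
-- where D₁ and D₂ are the alternants with exponents 0, 1, 3, 4, … and 0, 2, 3, 5, …, that is, the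
-- exponents in two residue classes modulo 3.  Both sides are polynomials of degree 3n − 1 in y₁ and
-- agree at 3n points: they vanish at the other variables; at y₁ = ω zᵢ the last row and at
-- y₁ = ω² z₁ the first row of the model freezes, which reduces the size by one, and the alternants
-- factor there accordingly, because their exponents avoid a residue class.  Symmetry in the z,
-- a consequence of the Yang–Baxter equation, brings zᵢ to the last row.
--
-- At the points 1, q, …, q²ⁿ⁻¹ all alternants are Vandermonde products.  Cancelling powers of q − 1
-- for q = 2, 3, … leaves an identity between polynomials in q, and at q = 1 the ratios of
-- Vandermonde products of the exponents are Aₙ and Cₙ up to a power of 3.

module Submission where

open import Defs
open import Algebra.Bundles using (AbelianGroup; CommutativeRing; RawRing)
import Algebra.Solver.Ring
import Algebra.Solver.Ring.AlmostCommutativeRing as ACR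
import Algebra.Solver.Ring.NaturalCoefficients.Default
open import Data.Bool using (if_then_else_)
open import Data.Fin using (Fin; zero; suc; inject₁; toℕ; fromℕ)
open import Data.Fin.Properties using (toℕ-fromℕ)
open import Data.Integer as ℤ using (ℤ; +_; -[1+_]; ∣_∣)
import Data.Integer.Properties as ℤₚ
open import Data.Integer.Solver using () renaming (module +-*-Solver to ℤS)
open import Data.List as List using (List; []; _∷_; _++_; concatMap; filter; length; map)
open import Data.List.Membership.Propositional using (_∈_)
open import Data.List.Membership.Propositional.Properties using (∈-++⁺ˡ; ∈-++⁺ʳ; ∈-map⁺; ∈-upTo⁺; ∈-∃++)
import Data.List.Properties as Listₚ
open import Data.List.Relation.Binary.Pointwise.Base using (Pointwise; []; _∷_)
open import Data.List.Relation.Binary.Subset.Propositional using (_⊆_)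
open import Data.List.Relation.Binary.Subset.Propositional.Properties using (++⁺ˡ)
open import Data.List.Relation.Unary.All as All using (All; []; _∷_)
import Data.List.Relation.Unary.All.Properties as Allₚ
open import Data.List.Relation.Unary.AllPairs as AllPairs using (AllPairs; []; _∷_)
import Data.List.Relation.Unary.AllPairs.Properties as AllPairsₚ
open import Data.List.Relation.Unary.Any using (here; there)
open import Data.List.Relation.Unary.Unique.Propositional using (Unique)
import Data.List.Relation.Unary.Unique.Propositional.Properties as Uniqueₚ
open import Data.Maybe using (just; nothing)
open import Data.Nat as ℕ using (ℕ; zero; suc; _∸_; _!; NonZero)
open import Data.Nat.Combinatorics using (_C_; nC1≡n; nCk+nC[k+1]≡[n+1]C[k+1])
import Data.Nat.Properties as ℕₚ
open import Data.Nat.Solver using () renaming (module +-*-Solver to ℕS)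
open import Data.Product using (Σ-syntax; ∃; _×_; _,_; proj₁; proj₂)
open import Data.Sum using (_⊎_; inj₁; inj₂; [_,_]′)
open import Data.Unit using (⊤; tt)
open import Data.Vec as Vec using (Vec; []; _∷_; allFin; lookup; replicate; toList)
open import Data.Vec.N-ary using (N-ary; Eq; Eqʰ; curryⁿ; _$ⁿ_; curryⁿ-cong; curryⁿ-cong⁻¹; Eqʰ-to-Eq)
import Data.Vec.Properties as Vecₚ
open import Data.Vec.Relation.Binary.Pointwise.Inductive as Pointwiseᵛₚ using ([]; _∷_) renaming (Pointwise to Pointwiseᵛ)
open import Function using (_∘_; flip)
open import Level using (Level; 0ℓ; _⊔_)
open import Relation.Binary.Definitions using (WeaklyDecidable)
open import Relation.Binary.PropositionalEquality as ≡ using (_≡_; _≢_)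
open import Relation.Nullary using (¬_; Dec; yes; no; does; contradiction)
open import Relation.Unary using (Pred; Decidable)

open import Algebra.Properties.Group (AbelianGroup.group ℤₚ.+-0-abelianGroup) using ()
  renaming (∙-cancelˡ to ℤ-cancelˡ; ∙-cancelʳ to ℤ-cancelʳ)

-- The half powers of q in [x] and the inverses of [λ] obstruct an argument by polynomials.
-- Multiplication by ξ υ removes the half powers. As q³ = 1, δ L = (1 - L)(1 - ωL)(1 - ω²L) is the
-- same at all heights, so a single symbol `d` replaces all inverses and the Yang-Baxter equation
-- becomes a polynomial identity.
--
-- The cube root of unity is used once more in the induction. The degree bound 3n - 1 leaves no
-- slack: each of the n rows contributes 1, the Vandermonde determinant 2n - 1.
--
-- When all points coincide, every alternant vanishes and the identity reads 0 = 0. A general field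
-- has no limits; hence the one-parameter family of points, on which all alternants share the
-- explicit factor (q - 1)^(2n choose 2), and the passage through infinitely many integers q to q =
-- 1.

module FieldLemmas {c ℓ} (F : Field c ℓ) where
  open FieldDefs F public
  open Field F public
    using (commutativeRing; ⁻¹-cong; ⁻¹-inverse; 0≉1; setoid; refl; sym; trans; reflexive;
           +-cong; +-congˡ; +-congʳ; *-cong; *-congˡ; *-congʳ; -‿cong;
           +-assoc; +-comm; +-identityˡ; +-identityʳ; -‿inverseˡ; -‿inverseʳ;
           *-assoc; *-comm; *-identityˡ; *-identityʳ; distribˡ; distribʳ; zeroˡ; zeroʳ; ring; semiring)
  open import Algebra.Properties.Ring ring public
    using (-‿distribˡ-*; -0#≈0#; -1*x≈-x)
  open import Relation.Binary.Reasoning.Setoid setoid public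

  infix 4 _≉_
  _≉_ : Carrier → Carrier → Set ℓ
  x ≉ y = ¬ (x ≈ y)

  PrimitiveCubeRoot : Carrier → Set ℓ
  PrimitiveCubeRoot ω = ω * ω + ω + 1# ≈ 0#

  CharacteristicZero : Set ℓ
  CharacteristicZero = ∀ (m : ℕ) → ¬ (fromℕ′ (suc m) ≈ 0#)

  x-y≈0⇒x≈y : ∀ {x y} → x + - y ≈ 0# → x ≈ y
  x-y≈0⇒x≈y {x} {y} h = begin
    x                 ≈⟨ sym (+-identityʳ x) ⟩
    x + 0#            ≈⟨ +-congˡ (sym (-‿inverseˡ y)) ⟩
    x + (- y + y)     ≈⟨ sym (+-assoc x (- y) y) ⟩
    (x + - y) + y     ≈⟨ +-congʳ h ⟩
    0# + y            ≈⟨ +-identityˡ y ⟩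
    y                 ∎

  x≈y⇒x-y≈0 : ∀ {x y} → x ≈ y → x + - y ≈ 0#
  x≈y⇒x-y≈0 {x} {y} h = trans (+-congʳ h) (-‿inverseʳ y)

  ⁻¹-inverseˡ : ∀ {x} → x ≉ 0# → x ⁻¹ * x ≈ 1#
  ⁻¹-inverseˡ h = trans (*-comm _ _) (⁻¹-inverse h)

  *-cancelˡ-nz : ∀ {a x y} → a ≉ 0# → a * x ≈ a * y → x ≈ y
  *-cancelˡ-nz {a} {x} {y} a≉0 h = begin
    x                 ≈⟨ sym (*-identityˡ x) ⟩
    1# * x            ≈⟨ *-congʳ (sym (⁻¹-inverseˡ a≉0)) ⟩
    a ⁻¹ * a * x      ≈⟨ *-assoc _ _ _ ⟩
    a ⁻¹ * (a * x)    ≈⟨ *-congˡ h ⟩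
    a ⁻¹ * (a * y)    ≈⟨ sym (*-assoc _ _ _) ⟩
    a ⁻¹ * a * y      ≈⟨ *-congʳ (⁻¹-inverseˡ a≉0) ⟩
    1# * y            ≈⟨ *-identityˡ y ⟩
    y                 ∎

  *-zero-cancelˡ : ∀ {a x} → a ≉ 0# → a * x ≈ 0# → x ≈ 0#
  *-zero-cancelˡ a≉0 h = *-cancelˡ-nz a≉0 (trans h (sym (zeroʳ _)))

  *-nz : ∀ {x y} → x ≉ 0# → y ≉ 0# → x * y ≉ 0#
  *-nz x≉0 y≉0 h = y≉0 (*-zero-cancelˡ x≉0 h)

  open import Algebra.Properties.Semiring.Mult semiring public
    using (×-homo-+; ×1-homo-*) renaming (_×_ to _·_)

  fromℕ′-·1 : ∀ m → fromℕ′ m ≡ m · 1#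
  fromℕ′-·1 zero    = ≡.refl
  fromℕ′-·1 (suc m) = ≡.cong (λ x → 1# + x) (fromℕ′-·1 m)

  fromℕ′-+ : ∀ m n → fromℕ′ (m ℕ.+ n) ≈ fromℕ′ m + fromℕ′ n
  fromℕ′-+ m n rewrite fromℕ′-·1 (m ℕ.+ n) | fromℕ′-·1 m | fromℕ′-·1 n = ×-homo-+ 1# m n

  fromℕ′-* : ∀ m n → fromℕ′ (m ℕ.* n) ≈ fromℕ′ m * fromℕ′ n
  fromℕ′-* m n rewrite fromℕ′-·1 (m ℕ.* n) | fromℕ′-·1 m | fromℕ′-·1 n = ×1-homo-* m n

  ∏ˡ : (Carrier → Carrier) → List Carrier → Carrier
  ∏ˡ g []       = 1#
  ∏ˡ g (x ∷ xs) = g x * ∏ˡ g xs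

  ∏ˡ-cong : ∀ {g h : Carrier → Carrier} xs → (∀ x → g x ≈ h x) → ∏ˡ g xs ≈ ∏ˡ h xs
  ∏ˡ-cong []       p = refl
  ∏ˡ-cong (x ∷ xs) p = *-cong (p x) (∏ˡ-cong xs p)

  ∏-cong : ∀ n {g h : Fin n → Carrier} → (∀ i → g i ≈ h i) → ∏ n g ≈ ∏ n h
  ∏-cong zero    p = refl
  ∏-cong (suc n) p = *-cong (p zero) (∏-cong n λ i → p (suc i))

-- The integers of ℚ(ω) as triples a + b ω + c ω² of natural numbers, on which subtraction is
-- not needed: −1 = ω + ω².
Eisenstein : Set
Eisenstein = ℕ × ℕ × ℕ

-- A ring solver with coefficients in the Eisenstein integers.

module EisensteinSolver {c ℓ} (F : Field c ℓ) (ω : Field.Carrier F)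
  (ω-root : FieldLemmas.PrimitiveCubeRoot F ω) where

  open FieldLemmas F

  private module SemiringSolver = Algebra.Solver.Ring.NaturalCoefficients.Default
                        (CommutativeRing.commutativeSemiring commutativeRing)

  +-cancelʳ : ∀ {x y} z → x + z ≈ y + z → x ≈ y
  +-cancelʳ {x} {y} z h = begin
    x              ≈⟨ sym (+-identityʳ x) ⟩
    x + 0#         ≈⟨ +-congˡ (sym (-‿inverseʳ z)) ⟩
    x + (z + - z)  ≈⟨ sym (+-assoc _ _ _) ⟩
    x + z + - z    ≈⟨ +-congʳ h ⟩
    y + z + - z    ≈⟨ +-assoc _ _ _ ⟩
    y + (z + - z)  ≈⟨ +-congˡ (-‿inverseʳ z) ⟩
    y + 0#         ≈⟨ +-identityʳ y ⟩
    y              ∎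

  ω³≈1 : ω * ω * ω ≈ 1#
  ω³≈1 = +-cancelʳ (ω * ω + ω) (begin
    ω * ω * ω + (ω * ω + ω)  ≈⟨ SemiringSolver.solve 1 (λ w → w SemiringSolver.:* w SemiringSolver.:* w SemiringSolver.:+ (w SemiringSolver.:* w SemiringSolver.:+ w)
                                    SemiringSolver.:= w SemiringSolver.:* (w SemiringSolver.:* w SemiringSolver.:+ w SemiringSolver.:+ SemiringSolver.con 1)) refl ω ⟩
    ω * (ω * ω + ω + 1#)     ≈⟨ *-congˡ ω-root ⟩
    ω * 0#                   ≈⟨ zeroʳ ω ⟩
    0#                       ≈⟨ sym ω-root ⟩
    ω * ω + ω + 1#           ≈⟨ +-comm _ _ ⟩
    1# + (ω * ω + ω)         ∎)

  private
    combination : Carrier → Carrier → Carrier → Carrier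
    combination x y z = x + y * ω + z * (ω * ω)

    general : Eisenstein → Carrier
    general (a , b , c) = combination (a · 1#) (b · 1#) (c · 1#)

    -- The constants 0, 1 and ω are interpreted on the nose, so that solver goals match.
    value : Eisenstein → Carrier
    value (0 , 0 , 0) = 0#
    value (1 , 0 , 0) = 1#
    value (0 , 1 , 0) = ω
    value t           = general t

    c100 : general (1 , 0 , 0) ≈ 1#
    c100 = trans (+-cong (+-cong (+-identityʳ 1#) (zeroˡ ω)) (zeroˡ _)) (trans (+-identityʳ _) (+-identityʳ 1#))

    c000 : general (0 , 0 , 0) ≈ 0#
    c000 = trans (+-cong (+-congˡ (zeroˡ ω)) (zeroˡ _)) (trans (+-identityʳ _) (+-identityʳ 0#))

    c010 : general (0 , 1 , 0) ≈ ω
    c010 = trans (+-cong (+-congˡ (trans (*-congʳ (+-identityʳ 1#)) (*-identityˡ ω))) (zeroˡ _))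
                 (trans (+-identityʳ _) (+-identityˡ ω))

    value≈general : ∀ t → value t ≈ general t
    value≈general (0 , 0 , 0)           = sym c000
    value≈general (1 , 0 , 0)           = sym c100
    value≈general (0 , 1 , 0)           = sym c010
    value≈general (0 , 0 , suc _)       = refl
    value≈general (0 , 1 , suc _)       = refl
    value≈general (0 , suc (suc _) , _) = refl
    value≈general (1 , 0 , suc _)       = refl
    value≈general (1 , suc _ , _)       = refl
    value≈general (suc (suc _) , _ , _) = refl

    -- Multiplication uses ω³ = 1 alone. The relation 1 + ω + ω² = 0 enters through the null triples
    -- (n, n, n), so an element has many representatives.
    _⊕_ _⊗_ : Eisenstein → Eisenstein → Eisenstein
    (a , b , c) ⊕ (a′ , b′ , c′) = a ℕ.+ a′ , b ℕ.+ b′ , c ℕ.+ c′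
    (a , b , c) ⊗ (a′ , b′ , c′) =
        a ℕ.* a′ ℕ.+ (b ℕ.* c′ ℕ.+ c ℕ.* b′)
      , a ℕ.* b′ ℕ.+ b ℕ.* a′ ℕ.+ c ℕ.* c′
      , a ℕ.* c′ ℕ.+ c ℕ.* a′ ℕ.+ b ℕ.* b′

    ⊖_ : Eisenstein → Eisenstein
    ⊖ (a , b , c) = b ℕ.+ c , a ℕ.+ c , a ℕ.+ b

    combination-cong : ∀ {x x′ y y′ z z′} → x ≈ x′ → y ≈ y′ → z ≈ z′ →
                       combination x y z ≈ combination x′ y′ z′
    combination-cong p q r = +-cong (+-cong p (*-congʳ q)) (*-congʳ r)

    ·-+ : ∀ m n → (m ℕ.+ n) · 1# ≈ m · 1# + n · 1#
    ·-+ = ×-homo-+ 1#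

    ·-** : ∀ m n k l → (m ℕ.* n ℕ.+ k ℕ.* l) · 1# ≈ m · 1# * (n · 1#) + k · 1# * (l · 1#)
    ·-** m n k l = trans (·-+ (m ℕ.* n) _) (+-cong (×1-homo-* m n) (×1-homo-* k l))

    general-⊕ : ∀ s t → general (s ⊕ t) ≈ general s + general t
    general-⊕ (a , b , c) (a′ , b′ , c′) = trans
      (combination-cong (·-+ a a′) (·-+ b b′) (·-+ c c′))
      (SemiringSolver.solve 7 (λ a b c a′ b′ c′ w →
          (a :+ a′) :+ (b :+ b′) :* w :+ (c :+ c′) :* (w :* w)
          := (a :+ b :* w :+ c :* (w :* w)) :+ (a′ :+ b′ :* w :+ c′ :* (w :* w)))
        refl (a · 1#) (b · 1#) (c · 1#) (a′ · 1#) (b′ · 1#) (c′ · 1#) ω)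
      where open SemiringSolver using (_:+_; _:*_; _:=_)

    general-⊗ : ∀ s t → general (s ⊗ t) ≈ general s * general t
    general-⊗ (a , b , c) (a′ , b′ , c′) = begin
      general ((a , b , c) ⊗ (a′ , b′ , c′))
        ≈⟨ combination-cong
             (trans (·-+ (a ℕ.* a′) _) (+-cong (×1-homo-* a a′) (·-** b c′ c b′)))
             (trans (·-+ (a ℕ.* b′ ℕ.+ b ℕ.* a′) _) (+-cong (·-** a b′ b a′) (×1-homo-* c c′)))
             (trans (·-+ (a ℕ.* c′ ℕ.+ c ℕ.* a′) _) (+-cong (·-** a c′ c a′) (×1-homo-* b b′))) ⟩
      combination (x * x′ + (y * z′ + z * y′)) (x * y′ + y * x′ + z * z′) (x * z′ + z * x′ + y * y′)
        ≈⟨ combination-cong (+-congˡ (sym (*-identityʳ _))) (+-congˡ (sym (*-identityʳ _))) refl ⟩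
      combination (x * x′ + (y * z′ + z * y′) * 1#) (x * y′ + y * x′ + z * z′ * 1#) (x * z′ + z * x′ + y * y′)
        ≈⟨ combination-cong (+-congˡ (*-congˡ (sym ω³≈1))) (+-congˡ (*-congˡ (sym ω³≈1))) refl ⟩
      combination (x * x′ + (y * z′ + z * y′) * (ω * ω * ω)) (x * y′ + y * x′ + z * z′ * (ω * ω * ω))
                  (x * z′ + z * x′ + y * y′)
        ≈⟨ SemiringSolver.solve 7 (λ a b c a′ b′ c′ w →
             (a :* a′ :+ (b :* c′ :+ c :* b′) :* (w :* w :* w))
               :+ (a :* b′ :+ b :* a′ :+ c :* c′ :* (w :* w :* w)) :* w
               :+ (a :* c′ :+ c :* a′ :+ b :* b′) :* (w :* w)
             := (a :+ b :* w :+ c :* (w :* w)) :* (a′ :+ b′ :* w :+ c′ :* (w :* w)))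
             refl x y z x′ y′ z′ ω ⟩
      combination x y z * combination x′ y′ z′ ∎
      where
      open SemiringSolver using (_:+_; _:*_; _:=_)
      x y z x′ y′ z′ : Carrier
      x = a · 1# ; y = b · 1# ; z = c · 1# ; x′ = a′ · 1# ; y′ = b′ · 1# ; z′ = c′ · 1#

    1+ω+ω²≈0 : 1# + ω + ω * ω ≈ 0#
    1+ω+ω²≈0 = trans (trans (+-comm _ _) (trans (+-congˡ (+-comm 1# ω)) (sym (+-assoc _ _ _)))) ω-root

    general-diagonal : ∀ n → general (n , n , n) ≈ 0#
    general-diagonal n = begin
      combination (n · 1#) (n · 1#) (n · 1#)
        ≈⟨ +-congʳ (+-congʳ (sym (*-identityʳ _))) ⟩
      n · 1# * 1# + n · 1# * ω + n · 1# * (ω * ω)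
        ≈⟨ +-congʳ (sym (distribˡ _ _ _)) ⟩
      n · 1# * (1# + ω) + n · 1# * (ω * ω)
        ≈⟨ sym (distribˡ _ _ _) ⟩
      n · 1# * (1# + ω + ω * ω)
        ≈⟨ *-congˡ 1+ω+ω²≈0 ⟩
      n · 1# * 0#
        ≈⟨ zeroʳ _ ⟩
      0# ∎

    inverse-unique : ∀ {x y} → x + y ≈ 0# → y ≈ - x
    inverse-unique {x} {y} h = +-cancelʳ x (trans (+-comm y x) (trans h (sym (-‿inverseˡ x))))

    general-⊖ : ∀ t → general (⊖ t) ≈ - general t
    general-⊖ t@(a , b , c) = inverse-unique (begin
      general t + general (⊖ t) ≈⟨ sym (general-⊕ t (⊖ t)) ⟩
      general (t ⊕ (⊖ t))       ≈⟨ reflexive (≡.cong₂ (λ u v → general (a ℕ.+ (b ℕ.+ c) , u , v))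
                                    (≡.trans (≡.sym (ℕₚ.+-assoc b a c)) (≡.trans (≡.cong (ℕ._+ c) (ℕₚ.+-comm b a)) (ℕₚ.+-assoc a b c)))
                                    (≡.trans (ℕₚ.+-comm c (a ℕ.+ b)) (ℕₚ.+-assoc a b c))) ⟩
      general (a ℕ.+ (b ℕ.+ c) , a ℕ.+ (b ℕ.+ c) , a ℕ.+ (b ℕ.+ c)) ≈⟨ general-diagonal (a ℕ.+ (b ℕ.+ c)) ⟩
      0# ∎)

    eisensteinRing : RawRing 0ℓ 0ℓ
    eisensteinRing = record
      { Carrier = Eisenstein ; _≈_ = _≡_ ; _+_ = _⊕_ ; _*_ = _⊗_ ; -_ = ⊖_
      ; 0# = 0 , 0 , 0 ; 1# = 1 , 0 , 0 }

    almostRing : ACR.AlmostCommutativeRing c ℓ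
    almostRing = ACR.fromCommutativeRing commutativeRing

    evaluation : eisensteinRing ACR.-Raw-AlmostCommutative⟶ almostRing
    evaluation = record
      { ⟦_⟧ = value
      ; +-homo = λ s t → lift₂ (s ⊕ t) s t +-cong (general-⊕ s t)
      ; *-homo = λ s t → lift₂ (s ⊗ t) s t *-cong (general-⊗ s t)
      ; -‿homo = λ t → trans (value≈general (⊖ t)) (trans (general-⊖ t) (-‿cong (sym (value≈general t))))
      ; 0-homo = refl
      ; 1-homo = refl
      }
      where
      lift₂ : ∀ u s t {_∙_ : Carrier → Carrier → Carrier} →
              (∀ {x x′ y y′} → x ≈ x′ → y ≈ y′ → (x ∙ y) ≈ (x′ ∙ y′)) →
              general u ≈ (general s ∙ general t) → value u ≈ (value s ∙ value t)
      lift₂ u s t cong h = trans (value≈general u)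
        (trans h (cong (sym (value≈general s)) (sym (value≈general t))))

    -- a + b ω + c ω² = a′ + b′ ω + c′ ω² exactly when a − a′ = b − b′ = c − c′.
    coefficient≟ : WeaklyDecidable (ACR.Induced-equivalence evaluation)
    coefficient≟ s@(a , b , c) t@(a′ , b′ , c′)
      with a ℕ.+ b′ ℕₚ.≟ a′ ℕ.+ b | a ℕ.+ c′ ℕₚ.≟ a′ ℕ.+ c
    ... | no  _ | _     = nothing
    ... | yes _ | no _  = nothing
    ... | yes p | yes q = just (trans (value≈general s) (trans equal (sym (value≈general t))))
      where
      -- The triples (a′, a′, a′) and (a, a, a) have value 0, and adding them turns `s` and `t` into
      -- the same triple.
      equal : general s ≈ general t
      equal = +-cancelʳ (general (a′ , a′ , a′)) (begin
        general s + general (a′ , a′ , a′)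
          ≈⟨ sym (general-⊕ s (a′ , a′ , a′)) ⟩
        general (a ℕ.+ a′ , b ℕ.+ a′ , c ℕ.+ a′)
          ≈⟨ reflexive (≡.cong₂ (λ u v → general (a ℕ.+ a′ , u , v))
               (≡.trans (ℕₚ.+-comm b a′) (≡.trans (≡.sym p) (ℕₚ.+-comm a b′)))
               (≡.trans (ℕₚ.+-comm c a′) (≡.trans (≡.sym q) (ℕₚ.+-comm a c′)))) ⟩
        general (a ℕ.+ a′ , b′ ℕ.+ a , c′ ℕ.+ a)
          ≈⟨ reflexive (≡.cong (λ u → general (u , b′ ℕ.+ a , c′ ℕ.+ a)) (ℕₚ.+-comm a a′)) ⟩
        general (t ⊕ (a , a , a))
          ≈⟨ general-⊕ t (a , a , a) ⟩
        general t + general (a , a , a)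
          ≈⟨ +-congˡ (trans (general-diagonal a) (sym (general-diagonal a′))) ⟩
        general t + general (a′ , a′ , a′) ∎)

  open Algebra.Solver.Ring eisensteinRing almostRing evaluation coefficient≟ public
    using (Polynomial; con; var; ⟦_⟧; ⟦_⟧↓; _:+_; _:*_; _:-_; :-_; _:=_; correct; normalise)

  :0 :1 :ω : ∀ {n} → Polynomial n
  :0 = con (0 , 0 , 0)
  :1 = con (1 , 0 , 0)
  :ω = con (0 , 1 , 0)

  -- Coefficients have several representations, so equality of normal forms is not enough:
  -- the difference has to normalise to zero.  At least one variable is needed, since constant
  -- polynomials without variables are not reduced.
  solve : ∀ n (f : N-ary n (Polynomial n) (Polynomial n × Polynomial n)) →
          let e = f $ⁿ Vec.map var (allFin n) in
          Eqʰ n _≈_ (curryⁿ ⟦ proj₁ e :- proj₂ e ⟧↓) (curryⁿ (λ (_ : Vec Carrier n) → 0#)) →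
          Eq n _≈_ (curryⁿ ⟦ proj₁ e ⟧) (curryⁿ ⟦ proj₂ e ⟧)
  solve n f hyp = curryⁿ-cong _≈_ ⟦ proj₁ e ⟧ ⟦ proj₂ e ⟧ λ ρ →
    x-y≈0⇒x≈y (trans (sym (correct (proj₁ e :- proj₂ e) ρ))
      (curryⁿ-cong⁻¹ _≈_ ⟦ proj₁ e :- proj₂ e ⟧↓ (λ _ → 0#) (Eqʰ-to-Eq n _≈_ hyp) ρ))
    where e = f $ⁿ Vec.map var (allFin n)

-- Local weights and the dynamical Yang-Baxter equation.

data Spin : Set where
  ⊞ ⊟ : Spin

module Weights {c ℓ} (F : Field c ℓ) (ω : Field.Carrier F)
  (ω-root : FieldLemmas.PrimitiveCubeRoot F ω) where

  open FieldLemmas F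
  open EisensteinSolver F ω ω-root

  -- Opaque so that the summand can be inferred from the sum.
  opaque
    ∑ˢ : (Spin → Carrier) → Carrier
    ∑ˢ f = f ⊞ + f ⊟

    ∑ˢ-def : ∀ f → ∑ˢ f ≈ f ⊞ + f ⊟
    ∑ˢ-def f = refl

  -- `L` is q^(λ + a) at height a. A step down divides by q = ω, that is, multiplies by ω².
  shift : Carrier → Spin → Carrier
  shift L ⊞ = ω * L
  shift L ⊟ = ω * ω * L

  f : Carrier → Carrier
  f L = 1# + - L

  -- The names are those of the six-vertex model. The six proper patterns are exactly those with top
  -- + right = left + bottom; `forbidden` collects the patterns around which the heights do not
  -- close up.
  data Vertex : Set where
    a b⁺ b⁻ c⁺ c⁻ forbidden : Vertex

  vertex : (top right bottom left : Spin) → Vertex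
  vertex ⊞ ⊞ ⊞ ⊞ = a
  vertex ⊟ ⊟ ⊟ ⊟ = a
  vertex ⊞ ⊟ ⊞ ⊟ = b⁺
  vertex ⊟ ⊞ ⊟ ⊞ = b⁻
  vertex ⊟ ⊞ ⊞ ⊟ = c⁺
  vertex ⊞ ⊟ ⊟ ⊞ = c⁻
  vertex _ _ _ _ = forbidden

  δ : Carrier → Carrier
  δ L = f L * f (ω * L) * f (ω * ω * L)

  -- (1 − ω) ξ υ R(λ, u) with x = ω z = ξ², y = υ² and L = q^λ, where d stands for 1 / δ L;
  -- δ is invariant under L ↦ ω L, so that d is the same for all heights and the weights are
  -- polynomials.
  vertexWeight : (d L : Carrier) → Vertex → (z y : Carrier) → Carrier
  vertexWeight d L a  z y = (y + - (ω * ω * z)) * (δ L * d)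
  vertexWeight d L b⁺ z y = (y + - (ω * z)) * f (ω * L) * (f (ω * L) * f (ω * ω * L) * d)
  vertexWeight d L b⁻ z y = ω * (y + - (ω * z)) * f (ω * ω * L) * (f (ω * L) * f (ω * ω * L) * d)
  vertexWeight d L c⁺ z y = (1# + - ω) * (y + - (L * ω * z)) * (f (ω * L) * f (ω * ω * L) * d)
  vertexWeight d L c⁻ z y = (1# + - ω) * (ω * z + - (L * y)) * (f (ω * L) * f (ω * ω * L) * d)
  vertexWeight d L forbidden z y = 0#

  weight : (d L : Carrier) (top right bottom left : Spin) (z y : Carrier) → Carrier
  weight d L t r b l z y = vertexWeight d L (vertex t r b l) z y

  private
   module Syntax {n : ℕ} where
    ∑P : (Spin → Polynomial n) → Polynomial n
    ∑P f = f ⊞ :+ f ⊟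

    shiftP : Polynomial n → Spin → Polynomial n
    shiftP L ⊞ = :ω :* L
    shiftP L ⊟ = :ω :* :ω :* L

    fP : Polynomial n → Polynomial n
    fP L = :1 :- L

    vertexWeightP : (d L : Polynomial n) → Vertex → (z y : Polynomial n) → Polynomial n
    vertexWeightP d L a  z y = (y :- :ω :* :ω :* z) :* (fP L :* fP (:ω :* L) :* fP (:ω :* :ω :* L) :* d)
    vertexWeightP d L b⁺ z y = (y :- :ω :* z) :* fP (:ω :* L) :* (fP (:ω :* L) :* fP (:ω :* :ω :* L) :* d)
    vertexWeightP d L b⁻ z y = :ω :* (y :- :ω :* z) :* fP (:ω :* :ω :* L) :* (fP (:ω :* L) :* fP (:ω :* :ω :* L) :* d)
    vertexWeightP d L c⁺ z y = (:1 :- :ω) :* (y :- L :* :ω :* z) :* (fP (:ω :* L) :* fP (:ω :* :ω :* L) :* d)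
    vertexWeightP d L c⁻ z y = (:1 :- :ω) :* (:ω :* z :- L :* y) :* (fP (:ω :* L) :* fP (:ω :* :ω :* L) :* d)
    vertexWeightP d L forbidden z y = :0

    weightP : (d L : Polynomial n) (top right bottom left : Spin) (z y : Polynomial n) → Polynomial n
    weightP d L t r b l z y = vertexWeightP d L (vertex t r b l) z y
  open Syntax

  private
    identity : (l l′ t c r r′ : Spin) (d z z′ y L : Polynomial 5) → Polynomial 5 × Polynomial 5
    identity l l′ t c r r′ d z z′ y L =
      ∑P (λ k → ∑P λ k′ → ∑P λ b → weightP d L k k′ l′ l z (:ω :* z′)
        :* (weightP d L t r b k z′ y :* weightP d (shiftP L k) b r′ c k′ z y))
      := ∑P (λ k → ∑P λ k′ → ∑P λ b → weightP d L t k b l z y :* weightP d (shiftP L l) b k′ c l′ z′ y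
        :* weightP d (shiftP L t) r r′ k′ k z (:ω :* z′))

  opaque
   unfolding ∑ˢ

   -- In the crossing of the two rows, x′ = ω z′ takes the place of y. For each of the 64 choices of
   -- boundary spins the two sides agree as polynomials in `d`, `z`, `z′`, `y` and `L`, with `d` an
   -- independent variable, so the solver settles every case.
   yangBaxter : ∀ l l′ t c r r′ d z z′ y L →
     ∑ˢ (λ k → ∑ˢ λ k′ → ∑ˢ λ b → weight d L k k′ l′ l z (ω * z′)
         * (weight d L t r b k z′ y * weight d (shift L k) b r′ c k′ z y))
     ≈ ∑ˢ (λ k → ∑ˢ λ k′ → ∑ˢ λ b → weight d L t k b l z y * weight d (shift L l) b k′ c l′ z′ y
         * weight d (shift L t) r r′ k′ k z (ω * z′))
   yangBaxter ⊞ ⊞ ⊞ ⊞ ⊞ ⊞ = solve 5 (identity ⊞ ⊞ ⊞ ⊞ ⊞ ⊞) refl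
   yangBaxter ⊞ ⊞ ⊞ ⊞ ⊞ ⊟ = solve 5 (identity ⊞ ⊞ ⊞ ⊞ ⊞ ⊟) refl
   yangBaxter ⊞ ⊞ ⊞ ⊞ ⊟ ⊞ = solve 5 (identity ⊞ ⊞ ⊞ ⊞ ⊟ ⊞) refl
   yangBaxter ⊞ ⊞ ⊞ ⊞ ⊟ ⊟ = solve 5 (identity ⊞ ⊞ ⊞ ⊞ ⊟ ⊟) refl
   yangBaxter ⊞ ⊞ ⊞ ⊟ ⊞ ⊞ = solve 5 (identity ⊞ ⊞ ⊞ ⊟ ⊞ ⊞) refl
   yangBaxter ⊞ ⊞ ⊞ ⊟ ⊞ ⊟ = solve 5 (identity ⊞ ⊞ ⊞ ⊟ ⊞ ⊟) refl
   yangBaxter ⊞ ⊞ ⊞ ⊟ ⊟ ⊞ = solve 5 (identity ⊞ ⊞ ⊞ ⊟ ⊟ ⊞) refl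
   yangBaxter ⊞ ⊞ ⊞ ⊟ ⊟ ⊟ = solve 5 (identity ⊞ ⊞ ⊞ ⊟ ⊟ ⊟) refl
   yangBaxter ⊞ ⊞ ⊟ ⊞ ⊞ ⊞ = solve 5 (identity ⊞ ⊞ ⊟ ⊞ ⊞ ⊞) refl
   yangBaxter ⊞ ⊞ ⊟ ⊞ ⊞ ⊟ = solve 5 (identity ⊞ ⊞ ⊟ ⊞ ⊞ ⊟) refl
   yangBaxter ⊞ ⊞ ⊟ ⊞ ⊟ ⊞ = solve 5 (identity ⊞ ⊞ ⊟ ⊞ ⊟ ⊞) refl
   yangBaxter ⊞ ⊞ ⊟ ⊞ ⊟ ⊟ = solve 5 (identity ⊞ ⊞ ⊟ ⊞ ⊟ ⊟) refl
   yangBaxter ⊞ ⊞ ⊟ ⊟ ⊞ ⊞ = solve 5 (identity ⊞ ⊞ ⊟ ⊟ ⊞ ⊞) refl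
   yangBaxter ⊞ ⊞ ⊟ ⊟ ⊞ ⊟ = solve 5 (identity ⊞ ⊞ ⊟ ⊟ ⊞ ⊟) refl
   yangBaxter ⊞ ⊞ ⊟ ⊟ ⊟ ⊞ = solve 5 (identity ⊞ ⊞ ⊟ ⊟ ⊟ ⊞) refl
   yangBaxter ⊞ ⊞ ⊟ ⊟ ⊟ ⊟ = solve 5 (identity ⊞ ⊞ ⊟ ⊟ ⊟ ⊟) refl
   yangBaxter ⊞ ⊟ ⊞ ⊞ ⊞ ⊞ = solve 5 (identity ⊞ ⊟ ⊞ ⊞ ⊞ ⊞) refl
   yangBaxter ⊞ ⊟ ⊞ ⊞ ⊞ ⊟ = solve 5 (identity ⊞ ⊟ ⊞ ⊞ ⊞ ⊟) refl
   yangBaxter ⊞ ⊟ ⊞ ⊞ ⊟ ⊞ = solve 5 (identity ⊞ ⊟ ⊞ ⊞ ⊟ ⊞) refl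
   yangBaxter ⊞ ⊟ ⊞ ⊞ ⊟ ⊟ = solve 5 (identity ⊞ ⊟ ⊞ ⊞ ⊟ ⊟) refl
   yangBaxter ⊞ ⊟ ⊞ ⊟ ⊞ ⊞ = solve 5 (identity ⊞ ⊟ ⊞ ⊟ ⊞ ⊞) refl
   yangBaxter ⊞ ⊟ ⊞ ⊟ ⊞ ⊟ = solve 5 (identity ⊞ ⊟ ⊞ ⊟ ⊞ ⊟) refl
   yangBaxter ⊞ ⊟ ⊞ ⊟ ⊟ ⊞ = solve 5 (identity ⊞ ⊟ ⊞ ⊟ ⊟ ⊞) refl
   yangBaxter ⊞ ⊟ ⊞ ⊟ ⊟ ⊟ = solve 5 (identity ⊞ ⊟ ⊞ ⊟ ⊟ ⊟) refl
   yangBaxter ⊞ ⊟ ⊟ ⊞ ⊞ ⊞ = solve 5 (identity ⊞ ⊟ ⊟ ⊞ ⊞ ⊞) refl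
   yangBaxter ⊞ ⊟ ⊟ ⊞ ⊞ ⊟ = solve 5 (identity ⊞ ⊟ ⊟ ⊞ ⊞ ⊟) refl
   yangBaxter ⊞ ⊟ ⊟ ⊞ ⊟ ⊞ = solve 5 (identity ⊞ ⊟ ⊟ ⊞ ⊟ ⊞) refl
   yangBaxter ⊞ ⊟ ⊟ ⊞ ⊟ ⊟ = solve 5 (identity ⊞ ⊟ ⊟ ⊞ ⊟ ⊟) refl
   yangBaxter ⊞ ⊟ ⊟ ⊟ ⊞ ⊞ = solve 5 (identity ⊞ ⊟ ⊟ ⊟ ⊞ ⊞) refl
   yangBaxter ⊞ ⊟ ⊟ ⊟ ⊞ ⊟ = solve 5 (identity ⊞ ⊟ ⊟ ⊟ ⊞ ⊟) refl
   yangBaxter ⊞ ⊟ ⊟ ⊟ ⊟ ⊞ = solve 5 (identity ⊞ ⊟ ⊟ ⊟ ⊟ ⊞) refl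
   yangBaxter ⊞ ⊟ ⊟ ⊟ ⊟ ⊟ = solve 5 (identity ⊞ ⊟ ⊟ ⊟ ⊟ ⊟) refl
   yangBaxter ⊟ ⊞ ⊞ ⊞ ⊞ ⊞ = solve 5 (identity ⊟ ⊞ ⊞ ⊞ ⊞ ⊞) refl
   yangBaxter ⊟ ⊞ ⊞ ⊞ ⊞ ⊟ = solve 5 (identity ⊟ ⊞ ⊞ ⊞ ⊞ ⊟) refl
   yangBaxter ⊟ ⊞ ⊞ ⊞ ⊟ ⊞ = solve 5 (identity ⊟ ⊞ ⊞ ⊞ ⊟ ⊞) refl
   yangBaxter ⊟ ⊞ ⊞ ⊞ ⊟ ⊟ = solve 5 (identity ⊟ ⊞ ⊞ ⊞ ⊟ ⊟) refl
   yangBaxter ⊟ ⊞ ⊞ ⊟ ⊞ ⊞ = solve 5 (identity ⊟ ⊞ ⊞ ⊟ ⊞ ⊞) refl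
   yangBaxter ⊟ ⊞ ⊞ ⊟ ⊞ ⊟ = solve 5 (identity ⊟ ⊞ ⊞ ⊟ ⊞ ⊟) refl
   yangBaxter ⊟ ⊞ ⊞ ⊟ ⊟ ⊞ = solve 5 (identity ⊟ ⊞ ⊞ ⊟ ⊟ ⊞) refl
   yangBaxter ⊟ ⊞ ⊞ ⊟ ⊟ ⊟ = solve 5 (identity ⊟ ⊞ ⊞ ⊟ ⊟ ⊟) refl
   yangBaxter ⊟ ⊞ ⊟ ⊞ ⊞ ⊞ = solve 5 (identity ⊟ ⊞ ⊟ ⊞ ⊞ ⊞) refl
   yangBaxter ⊟ ⊞ ⊟ ⊞ ⊞ ⊟ = solve 5 (identity ⊟ ⊞ ⊟ ⊞ ⊞ ⊟) refl
   yangBaxter ⊟ ⊞ ⊟ ⊞ ⊟ ⊞ = solve 5 (identity ⊟ ⊞ ⊟ ⊞ ⊟ ⊞) refl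
   yangBaxter ⊟ ⊞ ⊟ ⊞ ⊟ ⊟ = solve 5 (identity ⊟ ⊞ ⊟ ⊞ ⊟ ⊟) refl
   yangBaxter ⊟ ⊞ ⊟ ⊟ ⊞ ⊞ = solve 5 (identity ⊟ ⊞ ⊟ ⊟ ⊞ ⊞) refl
   yangBaxter ⊟ ⊞ ⊟ ⊟ ⊞ ⊟ = solve 5 (identity ⊟ ⊞ ⊟ ⊟ ⊞ ⊟) refl
   yangBaxter ⊟ ⊞ ⊟ ⊟ ⊟ ⊞ = solve 5 (identity ⊟ ⊞ ⊟ ⊟ ⊟ ⊞) refl
   yangBaxter ⊟ ⊞ ⊟ ⊟ ⊟ ⊟ = solve 5 (identity ⊟ ⊞ ⊟ ⊟ ⊟ ⊟) refl
   yangBaxter ⊟ ⊟ ⊞ ⊞ ⊞ ⊞ = solve 5 (identity ⊟ ⊟ ⊞ ⊞ ⊞ ⊞) refl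
   yangBaxter ⊟ ⊟ ⊞ ⊞ ⊞ ⊟ = solve 5 (identity ⊟ ⊟ ⊞ ⊞ ⊞ ⊟) refl
   yangBaxter ⊟ ⊟ ⊞ ⊞ ⊟ ⊞ = solve 5 (identity ⊟ ⊟ ⊞ ⊞ ⊟ ⊞) refl
   yangBaxter ⊟ ⊟ ⊞ ⊞ ⊟ ⊟ = solve 5 (identity ⊟ ⊟ ⊞ ⊞ ⊟ ⊟) refl
   yangBaxter ⊟ ⊟ ⊞ ⊟ ⊞ ⊞ = solve 5 (identity ⊟ ⊟ ⊞ ⊟ ⊞ ⊞) refl
   yangBaxter ⊟ ⊟ ⊞ ⊟ ⊞ ⊟ = solve 5 (identity ⊟ ⊟ ⊞ ⊟ ⊞ ⊟) refl
   yangBaxter ⊟ ⊟ ⊞ ⊟ ⊟ ⊞ = solve 5 (identity ⊟ ⊟ ⊞ ⊟ ⊟ ⊞) refl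
   yangBaxter ⊟ ⊟ ⊞ ⊟ ⊟ ⊟ = solve 5 (identity ⊟ ⊟ ⊞ ⊟ ⊟ ⊟) refl
   yangBaxter ⊟ ⊟ ⊟ ⊞ ⊞ ⊞ = solve 5 (identity ⊟ ⊟ ⊟ ⊞ ⊞ ⊞) refl
   yangBaxter ⊟ ⊟ ⊟ ⊞ ⊞ ⊟ = solve 5 (identity ⊟ ⊟ ⊟ ⊞ ⊞ ⊟) refl
   yangBaxter ⊟ ⊟ ⊟ ⊞ ⊟ ⊞ = solve 5 (identity ⊟ ⊟ ⊟ ⊞ ⊟ ⊞) refl
   yangBaxter ⊟ ⊟ ⊟ ⊞ ⊟ ⊟ = solve 5 (identity ⊟ ⊟ ⊟ ⊞ ⊟ ⊟) refl
   yangBaxter ⊟ ⊟ ⊟ ⊟ ⊞ ⊞ = solve 5 (identity ⊟ ⊟ ⊟ ⊟ ⊞ ⊞) refl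
   yangBaxter ⊟ ⊟ ⊟ ⊟ ⊞ ⊟ = solve 5 (identity ⊟ ⊟ ⊟ ⊟ ⊞ ⊟) refl
   yangBaxter ⊟ ⊟ ⊟ ⊟ ⊟ ⊞ = solve 5 (identity ⊟ ⊟ ⊟ ⊟ ⊟ ⊞) refl
   yangBaxter ⊟ ⊟ ⊟ ⊟ ⊟ ⊟ = solve 5 (identity ⊟ ⊟ ⊟ ⊟ ⊟ ⊟) refl

-- Sums over spins and the partition function as a product of row transfer matrices.

module Transfer {c ℓ} (F : Field c ℓ) (ω : Field.Carrier F)
  (ω-root : FieldLemmas.PrimitiveCubeRoot F ω) where

  open FieldLemmas F
  open EisensteinSolver F ω ω-root
  open Weights F ω ω-root

  f-cong : ∀ {L L′} → L ≈ L′ → f L ≈ f L′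
  f-cong p = +-congˡ (-‿cong p)

  vertexWeight-cong : ∀ {d L L′ z z′ y y′} v → L ≈ L′ → z ≈ z′ → y ≈ y′ →
                      vertexWeight d L v z y ≈ vertexWeight d L′ v z′ y′
  vertexWeight-cong {d} {L} {L′} {z} {z′} {y} {y′} v L≈ z≈ y≈ = go v
    where
    y-_ : ∀ {u u′} → u ≈ u′ → y + - u ≈ y′ + - u′
    y- p = +-cong y≈ (-‿cong p)
    f₁ = f-cong (*-congˡ {ω} L≈)
    f₂ = f-cong (*-congˡ {ω * ω} L≈)
    g = *-congʳ {d} (*-cong f₁ f₂)
    go : ∀ v → vertexWeight d L v z y ≈ vertexWeight d L′ v z′ y′
    go a         = *-cong (y- *-congˡ z≈) (*-congʳ (*-cong (*-cong (f-cong L≈) f₁) f₂))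
    go b⁺        = *-cong (*-cong (y- *-congˡ z≈) f₁) g
    go b⁻        = *-cong (*-cong (*-congˡ (y- *-congˡ z≈)) f₂) g
    go c⁺        = *-cong (*-congˡ (y- *-cong (*-congʳ L≈) z≈)) g
    go c⁻        = *-cong (*-congˡ (+-cong (*-congˡ z≈) (-‿cong (*-cong L≈ y≈)))) g
    go forbidden = refl

  opaque
    unfolding ∑ˢ

    ∑ˢ-cong : ∀ {g h : Spin → Carrier} → (∀ s → g s ≈ h s) → ∑ˢ g ≈ ∑ˢ h
    ∑ˢ-cong p = +-cong (p ⊞) (p ⊟)

    ∑ˢ-0 : ∀ {g : Spin → Carrier} → (∀ s → g s ≈ 0#) → ∑ˢ g ≈ 0#
    ∑ˢ-0 p = trans (+-cong (p ⊞) (p ⊟)) (+-identityˡ 0#)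

    *-∑ˢ : ∀ x (g : Spin → Carrier) → x * ∑ˢ g ≈ ∑ˢ (λ s → x * g s)
    *-∑ˢ x g = distribˡ _ _ _

    ∑ˢ-* : ∀ (g : Spin → Carrier) x → ∑ˢ g * x ≈ ∑ˢ (λ s → g s * x)
    ∑ˢ-* g x = distribʳ _ _ _

    ∑ˢ-comm : ∀ (g : Spin → Spin → Carrier) → ∑ˢ (λ s → ∑ˢ λ t → g s t) ≈ ∑ˢ (λ t → ∑ˢ λ s → g s t)
    ∑ˢ-comm g = solve 4 (λ p q r s → (p :+ q) :+ (r :+ s) := (p :+ r) :+ (q :+ s)) refl _ _ _ _

  ∑ᵛ : ∀ n → (Vec Spin n → Carrier) → Carrier
  ∑ᵛ zero    g = g []
  ∑ᵛ (suc n) g = ∑ˢ λ s → ∑ᵛ n λ σ → g (s ∷ σ)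

  ∑ᵛ-cong : ∀ n {g h : Vec Spin n → Carrier} → (∀ σ → g σ ≈ h σ) → ∑ᵛ n g ≈ ∑ᵛ n h
  ∑ᵛ-cong zero    p = p []
  ∑ᵛ-cong (suc n) p = ∑ˢ-cong λ s → ∑ᵛ-cong n λ σ → p (s ∷ σ)

  *-∑ᵛ : ∀ n x (g : Vec Spin n → Carrier) → x * ∑ᵛ n g ≈ ∑ᵛ n (λ σ → x * g σ)
  *-∑ᵛ zero    x g = refl
  *-∑ᵛ (suc n) x g = trans (*-∑ˢ x _) (∑ˢ-cong λ s → *-∑ᵛ n x _)

  ∑ᵛ-* : ∀ n (g : Vec Spin n → Carrier) x → ∑ᵛ n g * x ≈ ∑ᵛ n (λ σ → g σ * x)
  ∑ᵛ-* zero    g x = refl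
  ∑ᵛ-* (suc n) g x = trans (∑ˢ-* _ x) (∑ˢ-cong λ s → ∑ᵛ-* n _ x)

  ∑ᵛ-∑ˢ : ∀ n (g : Vec Spin n → Spin → Carrier) →
          ∑ᵛ n (λ σ → ∑ˢ (g σ)) ≈ ∑ˢ (λ s → ∑ᵛ n λ σ → g σ s)
  ∑ᵛ-∑ˢ zero    g = refl
  ∑ᵛ-∑ˢ (suc n) g = trans (∑ˢ-cong λ s → ∑ᵛ-∑ˢ n _) (∑ˢ-comm _)

  ∑ᵛ-comm : ∀ m n (g : Vec Spin m → Vec Spin n → Carrier) →
            ∑ᵛ m (λ σ → ∑ᵛ n (g σ)) ≈ ∑ᵛ n (λ τ → ∑ᵛ m λ σ → g σ τ)
  ∑ᵛ-comm m zero    g = refl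
  ∑ᵛ-comm m (suc n) g = trans (∑ᵛ-∑ˢ m _) (∑ˢ-cong λ s → ∑ᵛ-comm m n _)

  ∑ᵛ-0 : ∀ n {g : Vec Spin n → Carrier} → (∀ σ → g σ ≈ 0#) → ∑ᵛ n g ≈ 0#
  ∑ᵛ-0 zero    p = p []
  ∑ᵛ-0 (suc n) p = ∑ˢ-0 λ s → ∑ᵛ-0 n λ σ → p (s ∷ σ)

  [_=⊟] : Spin → Carrier
  [ ⊞ =⊟] = 0#
  [ ⊟ =⊟] = 1#

  [_all⊟] : ∀ {n} → Vec Spin n → Carrier
  [ []    all⊟] = 1#
  [ s ∷ σ all⊟] = [ s =⊟] * [ σ all⊟]

  -- One row of blocks with upper left height L: σ and τ are the steps of its upper and lower
  -- boundary, l the step of its left boundary; the step of its right boundary is ⊟.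
  row : ∀ {n} (d L : Carrier) (l : Spin) (σ τ : Vec Spin n) (z : Carrier) (ys : Vec Carrier n) → Carrier
  row d L l []      []      z []       = [ l =⊟]
  row d L l (t ∷ σ) (b ∷ τ) z (y ∷ ys) = ∑ˢ λ r → weight d L t r b l z y * row d (shift L t) r σ τ z ys

  -- The left boundary step of every row is ⊞, which takes `L` to ω L from one row to the next; the
  -- indicator at the end imposes the lower boundary. The number of rows is independent of the
  -- number of columns and the upper boundary is arbitrary, as the inductions over rows and columns
  -- require.
  partition : ∀ {n} (d L : Carrier) (σ : Vec Spin n) (zs : List Carrier) (ys : Vec Carrier n) → Carrier
  partition     d L σ []       ys = [ σ all⊟]
  partition {n} d L σ (z ∷ zs) ys = ∑ᵛ n λ τ → row d L ⊞ σ τ z ys * partition d (ω * L) τ zs ys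

  shift-cong : ∀ {L L′} s → L ≈ L′ → shift L s ≈ shift L′ s
  shift-cong ⊞ p = *-congˡ p
  shift-cong ⊟ p = *-congˡ p

  row-cong : ∀ {n d L L′ l z z′} (σ τ : Vec Spin n) {ys ys′} → L ≈ L′ → z ≈ z′ → Pointwiseᵛ _≈_ ys ys′ →
    row d L l σ τ z ys ≈ row d L′ l σ τ z′ ys′
  row-cong         []      []      p q []      = refl
  row-cong {l = l} (t ∷ σ) (b ∷ τ) p q (e ∷ es) = ∑ˢ-cong λ r →
    *-cong (vertexWeight-cong (vertex t r b l) p q e) (row-cong σ τ (shift-cong t p) q es)

  partition-cong : ∀ {n d L zs zs′} (σ : Vec Spin n) {ys ys′} → Pointwise _≈_ zs zs′ → Pointwiseᵛ _≈_ ys ys′ →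
    partition d L σ zs ys ≈ partition d L σ zs′ ys′
  partition-cong     σ []       es = refl
  partition-cong {n} σ (q ∷ qs) es = ∑ᵛ-cong n λ τ → *-cong (row-cong σ τ refl q es) (partition-cong τ qs es)

  ≈ᵛ-refl : ∀ {n} {ys : Vec Carrier n} → Pointwiseᵛ _≈_ ys ys
  ≈ᵛ-refl = Pointwiseᵛₚ.refl refl

  -- The step of the lower right corner of a block is the same along both paths.
  weight-shift : ∀ {d L z y} t r b l {X : Carrier → Carrier} → (∀ {M N} → M ≈ N → X M ≈ X N) →
    weight d L t r b l z y * X (shift (shift L l) b) ≈ weight d L t r b l z y * X (shift (shift L t) r)
  weight-shift {d} {L} {z} {y} t r b l {X} X-cong = go t r b l
    where
    W = λ t r b l → weight d L t r b l z y * X (shift (shift L l) b)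
    W′ = λ t r b l → weight d L t r b l z y * X (shift (shift L t) r)
    zeros : ∀ {x y} → 0# * x ≈ 0# * y
    zeros = trans (zeroˡ _) (sym (zeroˡ _))
    p = solve 2 (λ w l → w :* w :* (w :* l) := w :* (w :* w :* l)) refl ω L
    go : ∀ t r b l → W t r b l ≈ W′ t r b l
    go ⊞ ⊞ ⊞ ⊞ = refl
    go ⊟ ⊟ ⊟ ⊟ = refl
    go ⊞ ⊟ ⊞ ⊟ = *-congˡ (X-cong (sym p))
    go ⊟ ⊞ ⊟ ⊞ = *-congˡ (X-cong p)
    go ⊟ ⊞ ⊞ ⊟ = refl
    go ⊞ ⊟ ⊟ ⊞ = refl
    go ⊞ ⊞ ⊞ ⊟ = zeros
    go ⊞ ⊞ ⊟ ⊞ = zeros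
    go ⊞ ⊞ ⊟ ⊟ = zeros
    go ⊞ ⊟ ⊞ ⊞ = zeros
    go ⊞ ⊟ ⊟ ⊟ = zeros
    go ⊟ ⊞ ⊞ ⊞ = zeros
    go ⊟ ⊞ ⊟ ⊟ = zeros
    go ⊟ ⊟ ⊞ ⊞ = zeros
    go ⊟ ⊟ ⊞ ⊟ = zeros
    go ⊟ ⊟ ⊟ ⊞ = zeros

  twoRows : ∀ {n} (d L : Carrier) (l l′ : Spin) (σ τ : Vec Spin n) (z z′ : Carrier) (ys : Vec Carrier n) → Carrier
  twoRows {n} d L l l′ σ τ z z′ ys = ∑ᵛ n λ ρ → row d L l σ ρ z ys * row d (shift L l) l′ ρ τ z′ ys

  -- Peels off the first column: the right spins `r` and `r′` of its two blocks become the left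
  -- spins of what remains. `weight-shift` identifies the level of the lower row as computed along
  -- either side of the upper block.
  twoRows-∷ : ∀ {n} d L l l′ t c (σ τ : Vec Spin n) z z′ y ys →
    twoRows d L l l′ (t ∷ σ) (c ∷ τ) z z′ (y ∷ ys)
    ≈ ∑ˢ λ r → ∑ˢ λ r′ → ∑ˢ λ b → weight d L t r b l z y * weight d (shift L l) b r′ c l′ z′ y
                                    * twoRows d (shift L t) r r′ σ τ z z′ ys
  twoRows-∷ {n} d L l l′ t c σ τ z z′ y ys = begin
    ∑ˢ (λ b → ∑ᵛ n λ ρ → ∑ˢ (λ r → weight d L t r b l z y * row d (shift L t) r σ ρ z ys)
                       * ∑ˢ (λ r′ → weight d (shift L l) b r′ c l′ z′ y * row d (shift (shift L l) b) r′ ρ τ z′ ys))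
      ≈⟨ ∑ˢ-cong (λ b → ∑ᵛ-cong n λ ρ → trans (∑ˢ-* _ _) (∑ˢ-cong λ r → trans (*-∑ˢ _ _) (∑ˢ-cong λ r′ → term b ρ r r′))) ⟩
    ∑ˢ (λ b → ∑ᵛ n λ ρ → ∑ˢ λ r → ∑ˢ λ r′ → Wt b r r′ * Rw r r′ ρ)
      ≈⟨ ∑ˢ-cong (λ b → trans (∑ᵛ-∑ˢ n _) (∑ˢ-cong λ r → trans (∑ᵛ-∑ˢ n _) (∑ˢ-cong λ r′ → sym (*-∑ᵛ n _ _)))) ⟩
    ∑ˢ (λ b → ∑ˢ λ r → ∑ˢ λ r′ → Wt b r r′ * twoRows d (shift L t) r r′ σ τ z z′ ys)
      ≈⟨ trans (∑ˢ-comm _) (∑ˢ-cong λ r → ∑ˢ-comm _) ⟩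
    ∑ˢ (λ r → ∑ˢ λ r′ → ∑ˢ λ b → Wt b r r′ * twoRows d (shift L t) r r′ σ τ z z′ ys) ∎
    where
    Wt = λ b r r′ → weight d L t r b l z y * weight d (shift L l) b r′ c l′ z′ y
    Rw = λ r r′ ρ → row d (shift L t) r σ ρ z ys * row d (shift (shift L t) r) r′ ρ τ z′ ys
    term : ∀ b ρ r r′ →
      weight d L t r b l z y * row d (shift L t) r σ ρ z ys
        * (weight d (shift L l) b r′ c l′ z′ y * row d (shift (shift L l) b) r′ ρ τ z′ ys)
      ≈ Wt b r r′ * Rw r r′ ρ
    term b ρ r r′ = begin
      w * x * (w′ * X (shift (shift L l) b))   ≈⟨ solve 4 (λ w x w′ v → w :* x :* (w′ :* v) := w :* v :* (w′ :* x)) refl _ _ _ _ ⟩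
      w * X (shift (shift L l) b) * (w′ * x)   ≈⟨ *-congʳ (weight-shift t r b l {X} (λ p → row-cong ρ τ p refl ≈ᵛ-refl)) ⟩
      w * X (shift (shift L t) r) * (w′ * x)   ≈⟨ solve 4 (λ w x w′ v → w :* v :* (w′ :* x) := w :* w′ :* (x :* v)) refl _ _ _ _ ⟩
      w * w′ * (x * X (shift (shift L t) r))   ∎
      where
      w = weight d L t r b l z y
      w′ = weight d (shift L l) b r′ c l′ z′ y
      x = row d (shift L t) r σ ρ z ys
      X = λ M → row d M r′ ρ τ z′ ys

-- Exchange of two adjacent rows by the Yang-Baxter equation.

module RowExchange {c ℓ} (F : Field c ℓ) (ω : Field.Carrier F)
  (ω-root : FieldLemmas.PrimitiveCubeRoot F ω) where

  open FieldLemmas F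
  open EisensteinSolver F ω ω-root
  open Weights F ω ω-root
  open Transfer F ω ω-root

  δ-shift : ∀ L s → δ (shift L s) ≈ δ L
  δ-shift L ⊞ = solve 1 (λ L → g (:ω :* L) := g L) refl L
    where g = λ L → (:1 :- L) :* (:1 :- :ω :* L) :* (:1 :- :ω :* :ω :* L)
  δ-shift L ⊟ = solve 1 (λ L → g (:ω :* :ω :* L) := g L) refl L
    where g = λ L → (:1 :- L) :* (:1 :- :ω :* L) :* (:1 :- :ω :* :ω :* L)

  δ-shift-unit : ∀ {d L} s → δ L * d ≈ 1# → δ (shift L s) * d ≈ 1#
  δ-shift-unit s h = trans (*-congʳ (δ-shift _ s)) h

  cross : (d L : Carrier) (l l′ k k′ : Spin) (z z′ : Carrier) → Carrier
  cross d L l l′ k k′ z z′ = weight d L k k′ l′ l z (ω * z′)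

  private
    ∑³ : (Spin → Spin → Spin → Carrier) → Carrier
    ∑³ g = ∑ˢ λ r → ∑ˢ λ r′ → ∑ˢ λ b → g r r′ b

    ∑³-* : ∀ (g : Spin → Spin → Spin → Carrier) x → ∑³ g * x ≈ ∑³ (λ r r′ b → g r r′ b * x)
    ∑³-* g x = trans (∑ˢ-* _ x) (∑ˢ-cong λ r → trans (∑ˢ-* _ x) (∑ˢ-cong λ r′ → ∑ˢ-* _ x))

    *-∑³ : ∀ x (g : Spin → Spin → Spin → Carrier) → x * ∑³ g ≈ ∑³ (λ r r′ b → x * g r r′ b)
    *-∑³ x g = trans (*-∑ˢ x _) (∑ˢ-cong λ r → trans (*-∑ˢ x _) (∑ˢ-cong λ r′ → *-∑ˢ x _))

    ∑²-comm : ∀ (g : Spin → Spin → Spin → Spin → Carrier) →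
      ∑ˢ (λ k → ∑ˢ λ k′ → ∑ˢ λ r → ∑ˢ λ r′ → g k k′ r r′)
      ≈ ∑ˢ (λ r → ∑ˢ λ r′ → ∑ˢ λ k → ∑ˢ λ k′ → g k k′ r r′)
    ∑²-comm g = begin
      ∑ˢ (λ k → ∑ˢ λ k′ → ∑ˢ λ r → ∑ˢ λ r′ → g k k′ r r′)
        ≈⟨ ∑ˢ-cong (λ k → trans (∑ˢ-comm _) (∑ˢ-cong λ r → ∑ˢ-comm _)) ⟩
      ∑ˢ (λ k → ∑ˢ λ r → ∑ˢ λ r′ → ∑ˢ λ k′ → g k k′ r r′)
        ≈⟨ trans (∑ˢ-comm _) (∑ˢ-cong λ r → ∑ˢ-comm _) ⟩
      ∑ˢ (λ r → ∑ˢ λ r′ → ∑ˢ λ k → ∑ˢ λ k′ → g k k′ r r′) ∎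

  -- The crossing is moved through the two rows from left to right, one column at a time.
  railway : ∀ {n d L} l l′ (σ τ : Vec Spin n) z z′ ys → δ L * d ≈ 1# →
    ∑ˢ (λ k → ∑ˢ λ k′ → cross d L l l′ k k′ z z′ * twoRows d L k k′ σ τ z′ z ys)
    ≈ (ω * z′ + - (ω * ω * z)) * twoRows d L l l′ σ τ z z′ ys
  railway {d = d} {L} l l′ [] [] z z′ [] unit = trans
    (trans (∑ˢ-def _) (+-cong (∑ˢ-def _) (∑ˢ-def _))) (go l l′)
    where
    e = ω * z′ + - (ω * ω * z)
    X = λ l l′ k k′ → cross d L l l′ k k′ z z′
    absent : ∀ p q r {s t} → s ≈ 0# → t ≈ 0# →
      p * (0# * 0#) + q * (0# * 1#) + (r * (1# * 0#) + s * (1# * 1#)) ≈ e * t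
    absent p q r s≈0 t≈0 = trans
      (+-congˡ (+-congˡ (*-congʳ s≈0)))
      (trans (solve 3 (λ p q r → p :* (:0 :* :0) :+ q :* (:0 :* :1) :+ (r :* (:1 :* :0) :+ :0 :* (:1 :* :1)) := :0) refl p q r)
        (sym (trans (*-congˡ t≈0) (zeroʳ e))))
    -- At the right boundary only the spins ⊟, ⊟ survive; the crossing is then an `a` vertex, whose
    -- weight is e because δ L d = 1.
    go : ∀ l l′ → X l l′ ⊞ ⊞ * (0# * 0#) + X l l′ ⊞ ⊟ * (0# * 1#) + (X l l′ ⊟ ⊞ * (1# * 0#) + X l l′ ⊟ ⊟ * (1# * 1#))
                  ≈ e * ([ l =⊟] * [ l′ =⊟])
    go ⊞ ⊞ = absent _ _ _ refl (zeroˡ _)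
    go ⊞ ⊟ = absent _ _ _ refl (zeroˡ _)
    go ⊟ ⊞ = absent _ _ _ refl (zeroʳ _)
    go ⊟ ⊟ = begin
      0# * (0# * 0#) + 0# * (0# * 1#) + (0# * (1# * 0#) + e * (δ L * d) * (1# * 1#))
        ≈⟨ solve 2 (λ e u → :0 :* (:0 :* :0) :+ :0 :* (:0 :* :1) :+ (:0 :* (:1 :* :0) :+ e :* u :* (:1 :* :1)) := e :* u) refl e (δ L * d) ⟩
      e * (δ L * d)   ≈⟨ *-congˡ unit ⟩
      e * 1#          ≈⟨ *-congˡ (sym (*-identityˡ 1#)) ⟩
      e * (1# * 1#)   ∎
  railway {suc n} {d} {L} l l′ (t ∷ σ) (c ∷ τ) z z′ (y ∷ ys) unit = begin
    ∑ˢ (λ k → ∑ˢ λ k′ → X k k′ * twoRows d L k k′ (t ∷ σ) (c ∷ τ) z′ z (y ∷ ys))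
      ≈⟨ ∑ˢ-cong (λ k → ∑ˢ-cong λ k′ → *-congˡ (twoRows-∷ d L k k′ t c σ τ z′ z y ys)) ⟩
    ∑ˢ (λ k → ∑ˢ λ k′ → X k k′ * ∑³ λ r r′ b → V′ k k′ r r′ b * R′ r r′)
      ≈⟨ ∑ˢ-cong (λ k → ∑ˢ-cong λ k′ → trans (*-∑ˢ _ _) (∑ˢ-cong λ r → trans (*-∑ˢ _ _) (∑ˢ-cong λ r′ →
           trans (*-congˡ (sym (∑ˢ-* _ _))) (sym (*-assoc _ _ _))))) ⟩
    ∑ˢ (λ k → ∑ˢ λ k′ → ∑ˢ λ r → ∑ˢ λ r′ → X k k′ * ∑ˢ (V′ k k′ r r′) * R′ r r′)
      ≈⟨ ∑²-comm _ ⟩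
    ∑ˢ (λ r → ∑ˢ λ r′ → ∑ˢ λ k → ∑ˢ λ k′ → X k k′ * ∑ˢ (V′ k k′ r r′) * R′ r r′)
      ≈⟨ ∑ˢ-cong (λ r → ∑ˢ-cong λ r′ → trans
           (trans (∑ˢ-cong λ k → sym (∑ˢ-* _ _)) (sym (∑ˢ-* _ _)))
           (*-congʳ (trans (∑ˢ-cong λ k → ∑ˢ-cong λ k′ → *-∑ˢ _ _) (yangBaxter l l′ t c r r′ d z z′ y L)))) ⟩
    ∑ˢ (λ r → ∑ˢ λ r′ → ∑³ (λ k k′ b → V k k′ b * Y k k′ r r′) * R′ r r′)
      ≈⟨ ∑ˢ-cong (λ r → ∑ˢ-cong λ r′ → trans (∑³-* _ _) (∑ˢ-cong λ k → ∑ˢ-cong λ k′ →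
           trans (∑ˢ-cong λ b → *-assoc _ _ _) (sym (∑ˢ-* _ _)))) ⟩
    ∑ˢ (λ r → ∑ˢ λ r′ → ∑ˢ λ k → ∑ˢ λ k′ → ∑ˢ (V k k′) * (Y k k′ r r′ * R′ r r′))
      ≈⟨ sym (∑²-comm _) ⟩
    ∑ˢ (λ k → ∑ˢ λ k′ → ∑ˢ λ r → ∑ˢ λ r′ → ∑ˢ (V k k′) * (Y k k′ r r′ * R′ r r′))
      ≈⟨ ∑ˢ-cong (λ k → ∑ˢ-cong λ k′ → trans (trans (∑ˢ-cong λ r → sym (*-∑ˢ _ _)) (sym (*-∑ˢ _ _)))
           (*-congˡ (railway k k′ σ τ z z′ ys (δ-shift-unit t unit)))) ⟩
    ∑ˢ (λ k → ∑ˢ λ k′ → ∑ˢ (V k k′) * (e * U k k′))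
      ≈⟨ ∑ˢ-cong (λ k → ∑ˢ-cong λ k′ → trans (∑ˢ-* _ _) (∑ˢ-cong λ b →
           solve 3 (λ v e r → v :* (e :* r) := e :* (v :* r)) refl _ _ _)) ⟩
    ∑³ (λ k k′ b → e * (V k k′ b * U k k′))
      ≈⟨ sym (*-∑³ _ _) ⟩
    e * ∑³ (λ k k′ b → V k k′ b * U k k′)
      ≈⟨ *-congˡ (sym (twoRows-∷ d L l l′ t c σ τ z z′ y ys)) ⟩
    e * twoRows d L l l′ (t ∷ σ) (c ∷ τ) z z′ (y ∷ ys) ∎
    where
    e = ω * z′ + - (ω * ω * z)
    X = λ k k′ → cross d L l l′ k k′ z z′
    Y = λ k k′ r r′ → cross d (shift L t) k k′ r r′ z z′
    V′ = λ k k′ r r′ b → weight d L t r b k z′ y * weight d (shift L k) b r′ c k′ z y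
    V = λ k k′ b → weight d L t k b l z y * weight d (shift L l) b k′ c l′ z′ y
    R′ = λ r r′ → twoRows d (shift L t) r r′ σ τ z′ z ys
    U = λ k k′ → twoRows d (shift L t) k k′ σ τ z z′ ys

  -- On the left boundary the crossing is a scalar.
  twoRows-swap : ∀ {n d L} (σ τ : Vec Spin n) z z′ ys → δ L * d ≈ 1# → ω * z′ + - (ω * ω * z) ≉ 0# →
    twoRows d L ⊞ ⊞ σ τ z z′ ys ≈ twoRows d L ⊞ ⊞ σ τ z′ z ys
  twoRows-swap {d = d} {L} σ τ z z′ ys unit e≉0 = *-cancelˡ-nz e≉0 (begin
    e * twoRows d L ⊞ ⊞ σ τ z z′ ys   ≈⟨ sym (railway ⊞ ⊞ σ τ z z′ ys unit) ⟩
    ∑ˢ (λ k → ∑ˢ λ k′ → cross d L ⊞ ⊞ k k′ z z′ * U k k′)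
      ≈⟨ trans (∑ˢ-def _) (+-cong (∑ˢ-def _) (∑ˢ-def _)) ⟩
    e * (δ L * d) * U ⊞ ⊞ + 0# * U ⊞ ⊟ + (0# * U ⊟ ⊞ + 0# * U ⊟ ⊟)
      ≈⟨ solve 5 (λ e p q r s → e :* p :+ :0 :* q :+ (:0 :* r :+ :0 :* s) := e :* p) refl _ _ _ _ _ ⟩
    e * (δ L * d) * U ⊞ ⊞             ≈⟨ *-congʳ (trans (*-congˡ unit) (*-identityʳ e)) ⟩
    e * U ⊞ ⊞                         ∎)
    where
    e = ω * z′ + - (ω * ω * z)
    U = λ k k′ → twoRows d L k k′ σ τ z′ z ys

  partition-∷∷ : ∀ {n d L} (σ : Vec Spin n) z z′ zs ys →
    partition d L σ (z ∷ z′ ∷ zs) ys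
    ≈ ∑ᵛ n (λ τ → twoRows d L ⊞ ⊞ σ τ z z′ ys * partition d (ω * (ω * L)) τ zs ys)
  partition-∷∷ {n} σ z z′ zs ys = begin
    ∑ᵛ n (λ ρ → _ * ∑ᵛ n λ τ → _)     ≈⟨ ∑ᵛ-cong n (λ ρ → trans (*-∑ᵛ n _ _) (∑ᵛ-cong n λ τ → sym (*-assoc _ _ _))) ⟩
    ∑ᵛ n (λ ρ → ∑ᵛ n λ τ → _ * _ * _) ≈⟨ ∑ᵛ-comm n n _ ⟩
    ∑ᵛ n (λ τ → ∑ᵛ n λ ρ → _ * _ * _) ≈⟨ ∑ᵛ-cong n (λ τ → sym (∑ᵛ-* n _ _)) ⟩
    ∑ᵛ n (λ τ → twoRows _ _ ⊞ ⊞ σ τ z z′ ys * partition _ _ τ zs ys) ∎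

  partition-swap : ∀ {n d L} (σ : Vec Spin n) z z′ zs ys → δ L * d ≈ 1# → ω * z′ + - (ω * ω * z) ≉ 0# →
    partition d L σ (z ∷ z′ ∷ zs) ys ≈ partition d L σ (z′ ∷ z ∷ zs) ys
  partition-swap {n} σ z z′ zs ys unit e≉0 = trans (partition-∷∷ σ z z′ zs ys)
    (trans (∑ᵛ-cong n λ τ → *-congʳ (twoRows-swap σ τ z z′ ys unit e≉0)) (sym (partition-∷∷ σ z′ z zs ys)))

-- Frozen rows and columns, and the resulting recursions in the size.

module Freezing {c ℓ} (F : Field c ℓ) (ω : Field.Carrier F)
  (ω-root : FieldLemmas.PrimitiveCubeRoot F ω) where

  open FieldLemmas F
  open EisensteinSolver F ω ω-root
  open Weights F ω ω-root
  open Transfer F ω ω-root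
  open RowExchange F ω ω-root

  ⊞ⁿ ⊟ⁿ : ∀ {n} → Vec Spin n
  ⊞ⁿ = replicate _ ⊞
  ⊟ⁿ = replicate _ ⊟

  -- This is 1 - q, which is [1] up to the factor q^(-1/2).
  κ : Carrier
  κ = 1# + - ω

  ∑ˢ-⊞ : ∀ {g : Spin → Carrier} → g ⊟ ≈ 0# → ∑ˢ g ≈ g ⊞
  ∑ˢ-⊞ h = trans (∑ˢ-def _) (trans (+-congˡ h) (+-identityʳ _))

  ∑ˢ-⊟ : ∀ {g : Spin → Carrier} → g ⊞ ≈ 0# → ∑ˢ g ≈ g ⊟
  ∑ˢ-⊟ h = trans (∑ˢ-def _) (trans (+-congʳ h) (+-identityˡ _))

  ∑ᵛ-all⊟ : ∀ n (g : Vec Spin n → Carrier) → ∑ᵛ n (λ τ → g τ * [ τ all⊟]) ≈ g ⊟ⁿ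
  ∑ᵛ-all⊟ zero    g = *-identityʳ _
  ∑ᵛ-all⊟ (suc n) g = trans
    (∑ˢ-⊟ (∑ᵛ-0 n λ τ → trans (*-congˡ (zeroˡ _)) (zeroʳ _)))
    (trans (∑ᵛ-cong n λ τ → *-congˡ (*-identityˡ _)) (∑ᵛ-all⊟ n λ τ → g (⊟ ∷ τ)))

  -- Left and bottom spin ⊟ force top and right spin ⊟. So the row consists of `a` vertices only,
  -- and its upper boundary is forced too.
  row-⊟-⊟ⁿ : ∀ {n d L} (σ : Vec Spin n) z ys → δ L * d ≈ 1# →
    row d L ⊟ σ ⊟ⁿ z ys ≈ ∏ˡ (λ y → y + - (ω * ω * z)) (toList ys) * [ σ all⊟]
  row-⊟-⊟ⁿ [] z [] unit = sym (*-identityˡ 1#)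
  row-⊟-⊟ⁿ (⊞ ∷ σ) z (y ∷ ys) unit = trans
    (∑ˢ-0 λ { ⊞ → zeroˡ _ ; ⊟ → zeroˡ _ })
    (sym (trans (*-congˡ (zeroˡ _)) (zeroʳ _)))
  row-⊟-⊟ⁿ {d = d} {L} (⊟ ∷ σ) z (y ∷ ys) unit = begin
    ∑ˢ (λ r → _)                                 ≈⟨ ∑ˢ-⊟ (zeroˡ _) ⟩
    e * (δ L * d) * row d _ ⊟ σ ⊟ⁿ z ys          ≈⟨ *-cong (*-congˡ unit) (row-⊟-⊟ⁿ σ z ys (δ-shift-unit ⊟ unit)) ⟩
    e * 1# * (p * [ σ all⊟])                     ≈⟨ solve 3 (λ e p q → e :* :1 :* (p :* q) := e :* p :* (:1 :* q)) refl _ _ _ ⟩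
    e * p * (1# * [ σ all⊟])                     ∎
    where
    e = y + - (ω * ω * z)
    p = ∏ˡ (λ y → y + - (ω * ω * z)) (toList ys)

  row-⊞-⊞∷⊞ : ∀ {n d L} (σ τ : Vec Spin n) z y ys → δ L * d ≈ 1# →
    row d L ⊞ (⊞ ∷ σ) (⊞ ∷ τ) z (y ∷ ys) ≈ (y + - (ω * ω * z)) * row d (ω * L) ⊞ σ τ z ys
  row-⊞-⊞∷⊞ σ τ z y ys unit = trans (∑ˢ-⊞ (zeroˡ _)) (*-congʳ (trans (*-congˡ unit) (*-identityʳ _)))

  row-⊞-⊞∷⊟ : ∀ {n d L} (σ τ : Vec Spin n) z y ys →
    row d L ⊞ (⊞ ∷ σ) (⊟ ∷ τ) z (y ∷ ys) ≈ vertexWeight d L c⁻ z y * row d (ω * L) ⊟ σ τ z ys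
  row-⊞-⊞∷⊟ σ τ z y ys = ∑ˢ-⊟ (zeroˡ _)

  row-⊞-⊟∷⊞ : ∀ {n d L} (σ τ : Vec Spin n) z y ys →
    row d L ⊞ (⊟ ∷ σ) (⊞ ∷ τ) z (y ∷ ys) ≈ 0#
  row-⊞-⊟∷⊞ σ τ z y ys = ∑ˢ-0 λ { ⊞ → zeroˡ _ ; ⊟ → zeroˡ _ }

  row-⊞-⊟∷⊟ : ∀ {n d L} (σ τ : Vec Spin n) z y ys →
    row d L ⊞ (⊟ ∷ σ) (⊟ ∷ τ) z (y ∷ ys) ≈ vertexWeight d L b⁻ z y * row d (ω * ω * L) ⊞ σ τ z ys
  row-⊞-⊟∷⊟ σ τ z y ys = ∑ˢ-⊞ (zeroˡ _)

  -- Left spin ⊞ and top spin ⊟ admit only the vertex `b⁻`: once the first column has turned ⊟ it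
  -- stays ⊟, and the row continues to the right with left spin ⊞.
  partition-⊟∷ : ∀ {n d L} (σ : Vec Spin n) z zs y ys →
    partition d L (⊟ ∷ σ) (z ∷ zs) (y ∷ ys)
    ≈ ∑ᵛ n (λ τ → vertexWeight d L b⁻ z y * row d (ω * ω * L) ⊞ σ τ z ys * partition d (ω * L) (⊟ ∷ τ) zs (y ∷ ys))
  partition-⊟∷ {n} σ z zs y ys = trans
    (∑ˢ-⊟ (∑ᵛ-0 n λ τ → trans (*-congʳ (row-⊞-⊟∷⊞ σ τ z y ys)) (zeroˡ _)))
    (∑ᵛ-cong n λ τ → *-congʳ (row-⊞-⊟∷⊟ σ τ z y ys))

  -- The first column consists of `b⁻` vertices down to the last row, where the factor y - ω t is
  -- zero.
  partition-⊟∷-vanishes : ∀ {n d L} (σ : Vec Spin n) zs t ys →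
    partition d L (⊟ ∷ σ) (zs ++ t ∷ []) (ω * t ∷ ys) ≈ 0#
  partition-⊟∷-vanishes {n} {d} {L} σ [] t ys = trans (partition-⊟∷ σ t [] (ω * t) ys)
    (∑ᵛ-0 n λ τ → trans (*-congʳ (*-congʳ
      (solve 4 (λ w t p q → :ω :* (w :* t :- w :* t) :* p :* q := :0) refl ω t (f (ω * ω * L)) (f (ω * L) * f (ω * ω * L) * d))))
      (trans (*-congʳ (zeroˡ _)) (zeroˡ _)))
  partition-⊟∷-vanishes {n} σ (z ∷ zs) t ys = trans (partition-⊟∷ σ z (zs ++ t ∷ []) (ω * t) ys)
    (∑ᵛ-0 n λ τ → trans (*-congˡ (partition-⊟∷-vanishes τ zs t ys)) (zeroʳ _))

  -- At y = ω t the weight b⁻ of the last row vanishes: the first column stays ⊞ up to that row.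
  freeze-last : ∀ {n d L} (σ : Vec Spin n) zs t ys → δ L * d ≈ 1# →
    partition d L (⊞ ∷ σ) (zs ++ t ∷ []) (ω * t ∷ ys)
    ≈ κ * (ω * t) * ∏ˡ (λ z → ω * t + - (ω * ω * z)) zs * ∏ˡ (λ y → y + - (ω * ω * t)) (toList ys)
      * partition d (ω * L) σ zs ys
  freeze-last {n} {d} {L} σ [] t ys unit = begin
    ∑ᵛ (suc n) (λ τ → row d L ⊞ (⊞ ∷ σ) τ t (ω * t ∷ ys) * [ τ all⊟])
      ≈⟨ ∑ᵛ-all⊟ (suc n) (λ τ → row d L ⊞ (⊞ ∷ σ) τ t (ω * t ∷ ys)) ⟩
    row d L ⊞ (⊞ ∷ σ) ⊟ⁿ t (ω * t ∷ ys)      ≈⟨ row-⊞-⊞∷⊟ σ ⊟ⁿ t (ω * t) ys ⟩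
    vertexWeight d L c⁻ t (ω * t) * row d (ω * L) ⊟ σ ⊟ⁿ t ys
      -- At y = ω t the weight `c⁻` contains ω t - L ω t = ω t f L, and this f L completes the
      -- product δ L.
      ≈⟨ *-cong (solve 4 (λ L t d w → (:1 :- w) :* (w :* t :- L :* (w :* t)) :* ((:1 :- w :* L) :* (:1 :- w :* w :* L) :* d)
                     := (:1 :- w) :* (w :* t) :* (((:1 :- L) :* (:1 :- w :* L) :* (:1 :- w :* w :* L)) :* d)) refl L t d ω)
                (row-⊟-⊟ⁿ σ t ys (δ-shift-unit ⊞ unit)) ⟩
    κ * (ω * t) * (δ L * d) * (p * [ σ all⊟]) ≈⟨ *-congʳ (*-congˡ unit) ⟩
    κ * (ω * t) * 1# * (p * [ σ all⊟])        ≈⟨ sym (*-assoc _ _ _) ⟩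
    κ * (ω * t) * 1# * p * [ σ all⊟]          ∎
    where p = ∏ˡ (λ y → y + - (ω * ω * t)) (toList ys)
  freeze-last {n} {d} {L} σ (z ∷ zs) t ys unit = begin
    ∑ˢ (λ b → ∑ᵛ n λ τ → row d L ⊞ (⊞ ∷ σ) (b ∷ τ) z (ω * t ∷ ys) * partition d (ω * L) (b ∷ τ) (zs ++ t ∷ []) (ω * t ∷ ys))
      ≈⟨ ∑ˢ-⊞ (∑ᵛ-0 n λ τ → trans (*-congˡ (partition-⊟∷-vanishes τ zs t ys)) (zeroʳ _)) ⟩
    ∑ᵛ n (λ τ → row d L ⊞ (⊞ ∷ σ) (⊞ ∷ τ) z (ω * t ∷ ys) * partition d (ω * L) (⊞ ∷ τ) (zs ++ t ∷ []) (ω * t ∷ ys))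
      ≈⟨ ∑ᵛ-cong n (λ τ → *-cong (row-⊞-⊞∷⊞ σ τ z (ω * t) ys unit) (freeze-last τ zs t ys (δ-shift-unit ⊞ unit))) ⟩
    ∑ᵛ n (λ τ → e * row d (ω * L) ⊞ σ τ z ys * (κ * (ω * t) * p * q * partition d (ω * (ω * L)) τ zs ys))
      ≈⟨ ∑ᵛ-cong n (λ τ → solve 6 (λ e r k p q s → e :* r :* (k :* p :* q :* s) := k :* (e :* p) :* q :* (r :* s)) refl _ _ _ _ _ _) ⟩
    ∑ᵛ n (λ τ → κ * (ω * t) * (e * p) * q * (row d (ω * L) ⊞ σ τ z ys * partition d (ω * (ω * L)) τ zs ys))
      ≈⟨ sym (*-∑ᵛ n _ _) ⟩
    κ * (ω * t) * (e * p) * q * partition d (ω * L) σ (z ∷ zs) ys ∎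
    where
    e = ω * t + - (ω * ω * z)
    p = ∏ˡ (λ z → ω * t + - (ω * ω * z)) zs
    q = ∏ˡ (λ y → y + - (ω * ω * t)) (toList ys)

  -- With δ M d = 1, the weight `b⁻` at level ω M is ω (y - ω z) f M / f (ω M). Down the first
  -- column these quotients telescope to f M / f (ωᵏ M) for k rows, and the remaining columns start
  -- at level ω² ω M = M.
  partition-⊟∷-strip : ∀ {n d M} (σ : Vec Spin n) zs y ys → δ M * d ≈ 1# →
    f (pow ω (length zs) * M) * partition d (ω * M) (⊟ ∷ σ) zs (y ∷ ys)
    ≈ f M * ∏ˡ (λ z → ω * (y + - (ω * z))) zs * partition d M σ zs ys
  partition-⊟∷-strip σ [] y ys unit = *-cong
    (trans (f-cong (*-identityˡ _)) (sym (*-identityʳ _))) (*-identityˡ _)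
  partition-⊟∷-strip {n} {d} {M} σ (z ∷ zs) y ys unit = begin
    f (ω * pow ω k * M) * partition d (ω * M) (⊟ ∷ σ) (z ∷ zs) (y ∷ ys)
      ≈⟨ *-cong (f-cong (solve 2 (λ w x → :ω :* w :* x := w :* (:ω :* x)) refl (pow ω k) M)) (partition-⊟∷ σ z zs y ys) ⟩
    g * ∑ᵛ n (λ τ → vertexWeight d (ω * M) b⁻ z y * row d (ω * ω * (ω * M)) ⊞ σ τ z ys * partition d (ω * (ω * M)) (⊟ ∷ τ) zs (y ∷ ys))
      ≈⟨ *-∑ᵛ n _ _ ⟩
    ∑ᵛ n (λ τ → g * (vertexWeight d (ω * M) b⁻ z y * row d (ω * ω * (ω * M)) ⊞ σ τ z ys * partition d (ω * (ω * M)) (⊟ ∷ τ) zs (y ∷ ys)))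
      ≈⟨ ∑ᵛ-cong n (λ τ → trans
           (solve 4 (λ g b r s → g :* (b :* r :* s) := b :* r :* (g :* s)) refl _ _ _ _)
           (*-cong (*-congˡ (row-cong σ τ (solve 1 (λ M → :ω :* :ω :* (:ω :* M) := M) refl M) refl ≈ᵛ-refl))
                   (partition-⊟∷-strip τ zs y ys (δ-shift-unit ⊞ unit)))) ⟩
    ∑ᵛ n (λ τ → vertexWeight d (ω * M) b⁻ z y * row d M ⊞ σ τ z ys * (f (ω * M) * p * partition d (ω * M) τ zs ys))
      ≈⟨ ∑ᵛ-cong n (λ τ → solve 5 (λ b r g p s → b :* r :* (g :* p :* s) := (g :* b) :* p :* (r :* s)) refl _ _ _ _ _) ⟩
    ∑ᵛ n (λ τ → f (ω * M) * vertexWeight d (ω * M) b⁻ z y * p * (row d M ⊞ σ τ z ys * partition d (ω * M) τ zs ys))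
      ≈⟨ sym (*-∑ᵛ n _ _) ⟩
    f (ω * M) * vertexWeight d (ω * M) b⁻ z y * p * partition d M σ (z ∷ zs) ys
      ≈⟨ *-congʳ (*-congʳ (solve 4 (λ M z y d →
           let g = λ L → :1 :- L in
           g (:ω :* M) :* (:ω :* (y :- :ω :* z) :* g (:ω :* :ω :* (:ω :* M)) :* (g (:ω :* (:ω :* M)) :* g (:ω :* :ω :* (:ω :* M)) :* d))
           := g M :* (:ω :* (y :- :ω :* z)) :* (g M :* g (:ω :* M) :* g (:ω :* :ω :* M) :* d)) refl M z y d)) ⟩
    f M * e * (δ M * d) * p * partition d M σ (z ∷ zs) ys
      ≈⟨ *-congʳ (trans (*-congʳ (trans (*-congˡ unit) (*-identityʳ _))) (*-assoc _ _ _)) ⟩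
    f M * (e * p) * partition d M σ (z ∷ zs) ys ∎
    where
    k = length zs
    g = f (pow ω k * (ω * M))
    e = ω * (y + - (ω * z))
    p = ∏ˡ (λ z → ω * (y + - (ω * z))) zs

  -- Left spin ⊟ and top spin ⊞ admit only the vertex `b⁺`, so the lower boundary repeats the upper
  -- one.
  ∑ᵛ-row-⊟-⊞ⁿ : ∀ n {d L} z (ys : Vec Carrier n) (G : Vec Spin n → Carrier) →
    ∑ᵛ n (λ τ → row d L ⊟ ⊞ⁿ τ z ys * G τ) ≈ row d L ⊟ ⊞ⁿ ⊞ⁿ z ys * G ⊞ⁿ
  ∑ᵛ-row-⊟-⊞ⁿ zero z [] G = refl
  ∑ᵛ-row-⊟-⊞ⁿ (suc n) {d} {L} z (y ∷ ys) G = begin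
    ∑ˢ (λ b → ∑ᵛ n λ τ → row d L ⊟ (⊞ ∷ ⊞ⁿ) (b ∷ τ) z (y ∷ ys) * G (b ∷ τ))
      ≈⟨ ∑ˢ-⊞ (∑ᵛ-0 n λ τ → trans (*-congʳ (∑ˢ-0 λ { ⊞ → zeroˡ _ ; ⊟ → zeroˡ _ })) (zeroˡ _)) ⟩
    ∑ᵛ n (λ τ → row d L ⊟ (⊞ ∷ ⊞ⁿ) (⊞ ∷ τ) z (y ∷ ys) * G (⊞ ∷ τ))
      ≈⟨ ∑ᵛ-cong n (λ τ → trans (*-congʳ (∑ˢ-⊟ (zeroˡ _))) (*-assoc _ _ _)) ⟩
    ∑ᵛ n (λ τ → vertexWeight d L b⁺ z y * (row d (ω * L) ⊟ ⊞ⁿ τ z ys * G (⊞ ∷ τ)))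
      ≈⟨ sym (*-∑ᵛ n _ _) ⟩
    vertexWeight d L b⁺ z y * ∑ᵛ n (λ τ → row d (ω * L) ⊟ ⊞ⁿ τ z ys * G (⊞ ∷ τ))
      ≈⟨ *-congˡ (∑ᵛ-row-⊟-⊞ⁿ n z ys (λ τ → G (⊞ ∷ τ))) ⟩
    vertexWeight d L b⁺ z y * (row d (ω * L) ⊟ ⊞ⁿ ⊞ⁿ z ys * G ⊞ⁿ)
      ≈⟨ sym (trans (*-congʳ (∑ˢ-⊟ (zeroˡ _))) (*-assoc _ _ _)) ⟩
    row d L ⊟ ⊞ⁿ ⊞ⁿ z (y ∷ ys) * G ⊞ⁿ ∎

  -- The weight `b⁺` is (y - ω z) f (ω L) / f L, and the quotients telescope along the row.
  row-⊟-⊞ⁿ : ∀ n {d L} z (ys : Vec Carrier n) → δ L * d ≈ 1# →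
    f L * row d L ⊟ ⊞ⁿ ⊞ⁿ z ys ≈ ∏ˡ (λ y → y + - (ω * z)) (toList ys) * f (pow ω n * L)
  row-⊟-⊞ⁿ zero {d} {L} z [] unit = trans (*-identityʳ _) (trans (f-cong (sym (*-identityˡ L))) (sym (*-identityˡ _)))
  row-⊟-⊞ⁿ (suc n) {d} {L} z (y ∷ ys) unit = begin
    f L * row d L ⊟ ⊞ⁿ ⊞ⁿ z (y ∷ ys)
      ≈⟨ *-congˡ (∑ˢ-⊟ (zeroˡ _)) ⟩
    f L * (vertexWeight d L b⁺ z y * row d (ω * L) ⊟ ⊞ⁿ ⊞ⁿ z ys)
      ≈⟨ solve 6 (λ a b c d k r → a :* (k :* b :* (b :* c :* d) :* r) := k :* (a :* b :* c :* d) :* (b :* r)) refl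
           (f L) (f (ω * L)) (f (ω * ω * L)) d (y + - (ω * z)) (row d (ω * L) ⊟ ⊞ⁿ ⊞ⁿ z ys) ⟩
    (y + - (ω * z)) * (δ L * d) * (f (ω * L) * row d (ω * L) ⊟ ⊞ⁿ ⊞ⁿ z ys)
      ≈⟨ *-cong (trans (*-congˡ unit) (*-identityʳ _)) (row-⊟-⊞ⁿ n z ys (δ-shift-unit ⊞ unit)) ⟩
    (y + - (ω * z)) * (∏ˡ (λ y → y + - (ω * z)) (toList ys) * f (pow ω n * (ω * L)))
      ≈⟨ trans (sym (*-assoc _ _ _)) (*-congˡ (f-cong (solve 3 (λ w p L → p :* (w :* L) := w :* p :* L) refl ω (pow ω n) L))) ⟩
    ∏ˡ (λ y → y + - (ω * z)) (toList (y ∷ ys)) * f (pow ω (suc n) * L) ∎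

  -- At y = ω² t the weight a of the first row vanishes: the first column flips in that row.
  freeze-first : ∀ n {d L} t zs ys → length zs ≡ n → δ L * d ≈ 1# →
    f (pow ω n * L) * partition {suc n} d L ⊞ⁿ (t ∷ zs) (ω * ω * t ∷ ys)
    ≈ κ * (ω * t) * ∏ˡ (λ z → ω * (ω * ω * t + - (ω * z))) zs * ∏ˡ (λ y → y + - (ω * t)) (toList ys)
      * (f (pow ω (suc n) * L) * partition d L ⊞ⁿ zs ys)
  freeze-first n {d} {L} t zs ys ≡.refl unit = begin
    g * ∑ˢ (λ b → ∑ᵛ n λ τ → row d L ⊞ ⊞ⁿ (b ∷ τ) t (y ∷ ys) * partition d (ω * L) (b ∷ τ) zs (y ∷ ys))
      ≈⟨ *-congˡ (∑ˢ-⊟ (∑ᵛ-0 n λ τ → trans (*-congʳ (trans (row-⊞-⊞∷⊞ ⊞ⁿ τ t y ys unit)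
           (trans (*-congʳ (-‿inverseʳ _)) (zeroˡ _)))) (zeroˡ _))) ⟩
    g * ∑ᵛ n (λ τ → row d L ⊞ ⊞ⁿ (⊟ ∷ τ) t (y ∷ ys) * partition d (ω * L) (⊟ ∷ τ) zs (y ∷ ys))
      ≈⟨ *-congˡ (trans (∑ᵛ-cong n λ τ → trans (*-congʳ (row-⊞-⊞∷⊟ ⊞ⁿ τ t y ys)) (*-assoc _ _ _)) (sym (*-∑ᵛ n _ _))) ⟩
    g * (w * ∑ᵛ n (λ τ → row d (ω * L) ⊟ ⊞ⁿ τ t ys * partition d (ω * L) (⊟ ∷ τ) zs (y ∷ ys)))
      ≈⟨ *-congˡ (*-congˡ (∑ᵛ-row-⊟-⊞ⁿ n t ys (λ τ → partition d (ω * L) (⊟ ∷ τ) zs (y ∷ ys)))) ⟩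
    g * (w * (row d (ω * L) ⊟ ⊞ⁿ ⊞ⁿ t ys * partition d (ω * L) (⊟ ∷ ⊞ⁿ) zs (y ∷ ys)))
      ≈⟨ solve 9 (λ L t d w r s g p q →
           g :* ((:1 :- w) :* (w :* t :- L :* (w :* w :* t)) :* (p :* q :* d) :* (r :* s))
           := (:1 :- w) :* (w :* t) :* (q :* d) :* ((:1 :- w :* L) :* (p :* r)) :* (g :* s))
           refl L t d ω _ _ g (f (ω * L)) (f (ω * ω * L)) ⟩
    κ * (ω * t) * (f (ω * ω * L) * d) * (f (ω * L) * (f (ω * L) * row d (ω * L) ⊟ ⊞ⁿ ⊞ⁿ t ys))
      * (g * partition d (ω * L) (⊟ ∷ ⊞ⁿ) zs (y ∷ ys))
      ≈⟨ *-cong (*-congˡ (*-congˡ (row-⊟-⊞ⁿ n t ys (δ-shift-unit ⊞ unit)))) (partition-⊟∷-strip ⊞ⁿ zs y ys unit) ⟩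
    κ * (ω * t) * (f (ω * ω * L) * d) * (f (ω * L) * (q * f (pow ω n * (ω * L)))) * (f L * p * partition d L ⊞ⁿ zs ys)
      ≈⟨ solve 9 (λ k a b c d q h p s → k :* (c :* d) :* (b :* (q :* h)) :* (a :* p :* s) := (a :* b :* c :* d) :* (k :* p :* q :* (h :* s)))
           refl _ _ _ _ _ _ _ _ _ ⟩
    δ L * d * (κ * (ω * t) * p * q * (f (pow ω n * (ω * L)) * partition d L ⊞ⁿ zs ys))
      ≈⟨ trans (*-congʳ unit) (*-identityˡ _) ⟩
    κ * (ω * t) * p * q * (f (pow ω n * (ω * L)) * partition d L ⊞ⁿ zs ys)
      ≈⟨ *-congˡ (*-congʳ (f-cong (solve 3 (λ w p L → p :* (w :* L) := w :* p :* L) refl ω (pow ω n) L))) ⟩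
    κ * (ω * t) * p * q * (f (pow ω (suc n) * L) * partition d L ⊞ⁿ zs ys) ∎
    where
    y = ω * ω * t
    g = f (pow ω n * L)
    w = vertexWeight d L c⁻ t y
    p = ∏ˡ (λ z → ω * (y + - (ω * z))) zs
    q = ∏ˡ (λ y → y + - (ω * t)) (toList ys)

-- Determinants by Laplace expansion over lists.

module Determinants {c ℓ} (F : Field c ℓ) (ω : Field.Carrier F)
  (ω-root : FieldLemmas.PrimitiveCubeRoot F ω) where

  open FieldLemmas F
  open EisensteinSolver F ω ω-root

  private
    variable
      ℓ₁ ℓ₂ ℓ₃ : Level
      A : Set ℓ₁
      B : Set ℓ₂
      A′ : Set ℓ₃

  -- The rows left over are handed to a continuation `G`, which lets expansions along several
  -- columns be nested and interchanged without minors as separate objects.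
  laplace : (A → Carrier) → List A → (List A → Carrier) → Carrier
  laplace v []       G = 0#
  laplace v (x ∷ xs) G = v x * G xs + - laplace v xs (G ∘ (x ∷_))

  -- Rows xs, columns ys and entries m x y; the value is 0 unless there are as many rows as columns.
  det : (A → B → Carrier) → List A → List B → Carrier
  det m []      []       = 1#
  det m (_ ∷ _) []       = 0#
  det m xs      (y ∷ ys) = laplace (λ x → m x y) xs (λ r → det m r ys)

  laplace-cong : ∀ {v w : A → Carrier} xs {G H : List A → Carrier} → (∀ x → v x ≈ w x) →
    (∀ r → suc (length r) ≡ length xs → G r ≈ H r) → laplace v xs G ≈ laplace w xs H
  laplace-cong []       p q = refl
  laplace-cong (x ∷ xs) p q = +-cong (*-cong (p x) (q xs ≡.refl))
    (-‿cong (laplace-cong xs p λ r e → q (x ∷ r) (≡.cong suc e)))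

  laplace-congʳ : ∀ {v : A → Carrier} xs {G H : List A → Carrier} →
    (∀ r → G r ≈ H r) → laplace v xs G ≈ laplace v xs H
  laplace-congʳ xs q = laplace-cong xs (λ _ → refl) (λ r _ → q r)

  laplace-linear : ∀ (v : A → Carrier) xs x y (G H : List A → Carrier) →
    laplace v xs (λ r → x * G r + y * H r) ≈ x * laplace v xs G + y * laplace v xs H
  laplace-linear v []       x y G H = solve 2 (λ x y → :0 := x :* :0 :+ y :* :0) refl x y
  laplace-linear v (a ∷ xs) x y G H = trans
    (+-congˡ (-‿cong (laplace-linear v xs x y (G ∘ (a ∷_)) (H ∘ (a ∷_)))))
    (solve 7 (λ v x y g h l m → v :* (x :* g :+ y :* h) :- (x :* l :+ y :* m)
                := x :* (v :* g :- l) :+ y :* (v :* h :- m)) refl _ _ _ _ _ _ _)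

  laplace-* : ∀ (v : A → Carrier) xs x (G : List A → Carrier) →
    laplace v xs (λ r → x * G r) ≈ x * laplace v xs G
  laplace-* v xs x G = begin
    laplace v xs (λ r → x * G r)             ≈⟨ laplace-congʳ xs (λ r → solve 2 (λ x g → x :* g := x :* g :+ :0 :* g) refl x (G r)) ⟩
    laplace v xs (λ r → x * G r + 0# * G r)  ≈⟨ laplace-linear v xs x 0# G G ⟩
    x * laplace v xs G + 0# * laplace v xs G ≈⟨ solve 2 (λ x g → x :* g :+ :0 :* g := x :* g) refl x _ ⟩
    x * laplace v xs G                       ∎

  laplace-0ʳ : ∀ (v : A → Carrier) xs → laplace v xs (λ _ → 0#) ≈ 0#
  laplace-0ʳ v xs = trans (laplace-congʳ xs (λ _ → sym (zeroˡ 0#))) (trans (laplace-* v xs 0# (λ _ → 0#)) (zeroˡ _))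

  laplace-‿- : ∀ (v : A → Carrier) xs (G : List A → Carrier) →
    laplace v xs (λ r → - G r) ≈ - laplace v xs G
  laplace-‿- v xs G = trans (laplace-congʳ xs (λ r → sym (-1*x≈-x (G r)))) (trans (laplace-* v xs (- 1#) G) (-1*x≈-x _))

  laplace-linearˡ : ∀ (v w : A → Carrier) x xs (G : List A → Carrier) →
    laplace (λ a → v a + x * w a) xs G ≈ laplace v xs G + x * laplace w xs G
  laplace-linearˡ v w x []       G = solve 1 (λ x → :0 := :0 :+ x :* :0) refl x
  laplace-linearˡ v w x (a ∷ xs) G = trans
    (+-congˡ (-‿cong (laplace-linearˡ v w x xs (G ∘ (a ∷_)))))
    (solve 6 (λ v x w g l m → (v :+ x :* w) :* g :- (l :+ x :* m) := (v :* g :- l) :+ x :* (w :* g :- m)) refl _ _ _ _ _ _)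

  laplace-0ˡ : ∀ {v : A → Carrier} {xs} (G : List A → Carrier) → All (λ x → v x ≈ 0#) xs → laplace v xs G ≈ 0#
  laplace-0ˡ G []       = refl
  laplace-0ˡ G (h ∷ hs) = trans (+-cong (trans (*-congʳ h) (zeroˡ _)) (-‿cong (laplace-0ˡ _ hs)))
    (solve 0 (:0 :- :0 := :0) refl)

  laplace-map : ∀ (g : A′ → A) (v : A → Carrier) xs (G : List A → Carrier) →
    laplace v (map g xs) G ≡ laplace (v ∘ g) xs (G ∘ map g)
  laplace-map g v []       G = ≡.refl
  laplace-map g v (x ∷ xs) G = ≡.cong (λ u → v (g x) * G (map g xs) + - u) (laplace-map g v xs (G ∘ (g x ∷_)))

  laplace-comm : ∀ (v : A → Carrier) (w : B → Carrier) xs ys (G : List A → List B → Carrier) →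
    laplace v xs (λ r → laplace w ys (G r)) ≈ laplace w ys (λ s → laplace v xs λ r → G r s)
  laplace-comm v w []       ys G = sym (laplace-0ʳ w ys)
  laplace-comm v w (x ∷ xs) ys G = begin
    v x * laplace w ys (G xs) + - laplace v xs (λ r → laplace w ys (G (x ∷ r)))
      ≈⟨ +-congˡ (trans (-‿cong (laplace-comm v w xs ys (G ∘ (x ∷_)))) (sym (-1*x≈-x _))) ⟩
    v x * laplace w ys (G xs) + - 1# * laplace w ys (λ s → laplace v xs λ r → G (x ∷ r) s)
      ≈⟨ sym (laplace-linear w ys _ _ _ _) ⟩
    laplace w ys (λ s → v x * G xs s + - 1# * laplace v xs (λ r → G (x ∷ r) s))
      ≈⟨ laplace-congʳ ys (λ s → +-congˡ (-1*x≈-x _)) ⟩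
    laplace w ys (λ s → v x * G xs s + - laplace v xs (λ r → G (x ∷ r) s)) ∎

  private
    laplace-laplace-∷ : ∀ (v w : A → Carrier) x xs (G : List A → Carrier) →
      laplace v (x ∷ xs) (λ r → laplace w r G)
      ≈ v x * laplace w xs G + (- (w x * laplace v xs G) + laplace v xs (λ r → laplace w r (G ∘ (x ∷_))))
    laplace-laplace-∷ v w x xs G = +-congˡ (begin
      - laplace v xs (λ r → w x * G r + - laplace w r (G ∘ (x ∷_)))
        ≈⟨ -‿cong (laplace-congʳ xs λ r → +-congˡ (sym (-1*x≈-x _))) ⟩
      - laplace v xs (λ r → w x * G r + - 1# * laplace w r (G ∘ (x ∷_)))
        ≈⟨ -‿cong (laplace-linear v xs _ _ _ _) ⟩
      - (w x * laplace v xs G + - 1# * laplace v xs (λ r → laplace w r (G ∘ (x ∷_))))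
        ≈⟨ solve 2 (λ p q → :- (p :+ :- :1 :* q) := :- p :+ q) refl _ _ ⟩
      - (w x * laplace v xs G) + laplace v xs (λ r → laplace w r (G ∘ (x ∷_))) ∎)

  -- Either `v` takes the first row, or `w` takes it, or neither does. The first two kinds of terms
  -- exchange their roles with opposite signs, and the third is the induction hypothesis.
  laplace-antisym : ∀ (v w : A → Carrier) xs (G : List A → Carrier) →
    laplace v xs (λ r → laplace w r G) ≈ - laplace w xs (λ r → laplace v r G)
  laplace-antisym v w []       G = sym -0#≈0#
  laplace-antisym v w (x ∷ xs) G = begin
    laplace v (x ∷ xs) (λ r → laplace w r G)  ≈⟨ laplace-laplace-∷ v w x xs G ⟩
    p + (- q + s)                             ≈⟨ +-congˡ (+-congˡ (laplace-antisym v w xs (G ∘ (x ∷_)))) ⟩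
    p + (- q + - s′)                          ≈⟨ solve 3 (λ p q s → p :+ (:- q :- s) := :- (q :+ (:- p :+ s))) refl p q s′ ⟩
    - (q + (- p + s′))                        ≈⟨ -‿cong (sym (laplace-laplace-∷ w v x xs G)) ⟩
    - laplace w (x ∷ xs) (λ r → laplace v r G) ∎
    where
    p = v x * laplace w xs G
    q = w x * laplace v xs G
    s = laplace v xs (λ r → laplace w r (G ∘ (x ∷_)))
    s′ = laplace w xs (λ r → laplace v r (G ∘ (x ∷_)))

  -- The same splitting makes the terms cancel in pairs. Antisymmetry by itself would only show that
  -- twice the value is zero.
  laplace-twice : ∀ (v : A → Carrier) xs (G : List A → Carrier) → laplace v xs (λ r → laplace v r G) ≈ 0#
  laplace-twice v []       G = refl
  laplace-twice v (x ∷ xs) G = trans (laplace-laplace-∷ v v x xs G)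
    (trans (+-congˡ (+-congˡ (laplace-twice v xs (G ∘ (x ∷_)))))
      (solve 1 (λ p → p :+ (:- p :+ :0) := :0) refl _))

  det-cong : ∀ {m m′ : A → B → Carrier} xs ys → (∀ x y → m x y ≈ m′ x y) → det m xs ys ≈ det m′ xs ys
  det-cong []       []       p = refl
  det-cong (_ ∷ _)  []       p = refl
  det-cong []       (y ∷ ys) p = refl
  det-cong (x ∷ xs) (y ∷ ys) p = laplace-cong (x ∷ xs) (λ x → p x y) (λ r _ → det-cong r ys p)

  det-∷ : ∀ (m : A → B → Carrier) xs y ys → det m xs (y ∷ ys) ≡ laplace (λ x → m x y) xs (λ r → det m r ys)
  det-∷ m []      y ys = ≡.refl
  det-∷ m (_ ∷ _) y ys = ≡.refl

  det-tail : ∀ {m : A → B → Carrier} y {ys ys′} → (∀ xs → det m xs ys ≈ det m xs ys′) →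
             ∀ xs → det m xs (y ∷ ys) ≈ det m xs (y ∷ ys′)
  det-tail {m = m} y {ys} {ys′} p xs = begin
    det m xs (y ∷ ys)   ≡⟨ det-∷ m xs y ys ⟩
    laplace _ xs _      ≈⟨ laplace-congʳ xs p ⟩
    laplace _ xs _      ≡⟨ ≡.sym (det-∷ m xs y ys′) ⟩
    det m xs (y ∷ ys′)  ∎

  private
    det-∷∷ : ∀ (m : A → B → Carrier) xs y y′ ys →
      det m xs (y ∷ y′ ∷ ys) ≈ laplace (λ x → m x y) xs (λ r → laplace (λ x → m x y′) r (λ s → det m s ys))
    det-∷∷ m xs y y′ ys = trans (reflexive (det-∷ m xs y (y′ ∷ ys))) (laplace-congʳ xs (λ r → reflexive (det-∷ m r y′ ys)))

  det-swap : ∀ (m : A → B → Carrier) xs y y′ ys → det m xs (y ∷ y′ ∷ ys) ≈ - det m xs (y′ ∷ y ∷ ys)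
  det-swap m xs y y′ ys = trans (det-∷∷ m xs y y′ ys)
    (trans (laplace-antisym _ _ xs _) (-‿cong (sym (det-∷∷ m xs y′ y ys))))

  det-twice : ∀ (m : A → B → Carrier) xs y ys → det m xs (y ∷ y ∷ ys) ≈ 0#
  det-twice m xs y ys = trans (det-∷∷ m xs y y ys) (laplace-twice _ xs _)

  alternate : ℕ → Carrier → Carrier
  alternate zero    x = x
  alternate (suc k) x = - alternate k x

  alternate-cong : ∀ k {x y} → x ≈ y → alternate k x ≈ alternate k y
  alternate-cong zero    p = p
  alternate-cong (suc k) p = -‿cong (alternate-cong k p)

  alternate-0 : ∀ k → alternate k 0# ≈ 0#
  alternate-0 zero    = refl
  alternate-0 (suc k) = trans (-‿cong (alternate-0 k)) -0#≈0#

  laplace-alternate : ∀ k (v : A → Carrier) xs (G : List A → Carrier) →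
    laplace v xs (alternate k ∘ G) ≈ alternate k (laplace v xs G)
  laplace-alternate zero    v xs G = refl
  laplace-alternate (suc k) v xs G = trans (laplace-‿- v xs (alternate k ∘ G)) (-‿cong (laplace-alternate k v xs G))

  alternate-‿- : ∀ k x → alternate k (- x) ≈ - alternate k x
  alternate-‿- zero    x = refl
  alternate-‿- (suc k) x = -‿cong (alternate-‿- k x)

  det-shift : ∀ (m : A → B → Carrier) ps y ys xs → det m xs (ps ++ y ∷ ys) ≈ alternate (length ps) (det m xs (y ∷ ps ++ ys))
  det-shift m []       y ys xs = refl
  det-shift m (p ∷ ps) y ys xs = begin
    det m xs (p ∷ ps ++ y ∷ ys)                           ≡⟨ det-∷ m xs p _ ⟩
    laplace _ xs (λ r → det m r (ps ++ y ∷ ys))           ≈⟨ laplace-congʳ xs (det-shift m ps y ys) ⟩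
    laplace _ xs (λ r → alternate k (det m r (y ∷ ps ++ ys))) ≈⟨ laplace-alternate k _ xs _ ⟩
    alternate k (laplace _ xs (λ r → det m r (y ∷ ps ++ ys))) ≡⟨ ≡.cong (alternate k) (≡.sym (det-∷ m xs p _)) ⟩
    alternate k (det m xs (p ∷ y ∷ ps ++ ys))             ≈⟨ alternate-cong k (det-swap m xs p y (ps ++ ys)) ⟩
    alternate k (- det m xs (y ∷ p ∷ ps ++ ys))           ≈⟨ alternate-‿- k _ ⟩
    - alternate k (det m xs (y ∷ p ∷ ps ++ ys))           ∎
    where k = length ps

  det-repeated : ∀ (m : A → B → Carrier) y ps ys xs → det m xs (y ∷ ps ++ y ∷ ys) ≈ 0#
  det-repeated m y ps ys xs = begin
    det m xs (y ∷ ps ++ y ∷ ys)                            ≡⟨ det-∷ m xs y _ ⟩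
    laplace _ xs (λ r → det m r (ps ++ y ∷ ys))            ≈⟨ laplace-congʳ xs (det-shift m ps y ys) ⟩
    laplace _ xs (λ r → alternate k (det m r (y ∷ ps ++ ys)))  ≈⟨ laplace-alternate k _ xs _ ⟩
    alternate k (laplace _ xs (λ r → det m r (y ∷ ps ++ ys)))  ≡⟨ ≡.cong (alternate k) (≡.sym (det-∷ m xs y _)) ⟩
    alternate k (det m xs (y ∷ y ∷ ps ++ ys))              ≈⟨ alternate-cong k (det-twice m xs y _) ⟩
    alternate k 0#                                         ≈⟨ alternate-0 k ⟩
    0#                                                     ∎
    where k = length ps

  det-member : ∀ (m : A → B → Carrier) {y ys} xs → y ∈ ys → det m xs (y ∷ ys) ≈ 0#
  det-member m {y} xs y∈ys with ps , qs , ≡.refl ← ∈-∃++ y∈ys = det-repeated m y ps qs xs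

  -- Both expansions, along the first column and then the first row or vice versa, agree.
  det-transpose : ∀ (m : A → B → Carrier) xs ys → det m xs ys ≈ det (flip m) ys xs
  det-transpose {A = A} {B = B} m xs ys = go (length ys) xs ys ℕₚ.≤-refl
    where
    m′ = flip m
    go : ∀ n (xs : List A) (ys : List B) → length ys ℕ.≤ n → det m xs ys ≈ det m′ ys xs
    go n       []       []       _ = refl
    go n       (_ ∷ _)  []       _ = refl
    go n       []       (_ ∷ _)  _ = refl
    go (suc n) (x ∷ xs) (y ∷ ys) (ℕ.s≤s ys≤n) = begin
      m x y * det m xs ys + - laplace (λ x → m x y) xs (λ r → det m (x ∷ r) ys)
        ≈⟨ +-cong (*-congˡ (go n xs ys ys≤n)) (-‿cong (laplace-congʳ xs λ r →
             trans (go n (x ∷ r) ys ys≤n) (reflexive (det-∷ m′ ys x r)))) ⟩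
      m x y * det m′ ys xs + - laplace (λ x → m x y) xs (λ r → laplace (m x) ys (λ s → det m′ s r))
        ≈⟨ +-congˡ (-‿cong (laplace-comm _ _ xs ys _)) ⟩
      m x y * det m′ ys xs + - laplace (m x) ys (λ s → laplace (λ x → m x y) xs (λ r → det m′ s r))
        ≈⟨ +-congˡ (-‿cong (laplace-cong ys (λ _ → refl) λ s e → trans
             (laplace-congʳ xs λ r → sym (go n r s (ℕₚ.≤-trans (ℕₚ.n≤1+n _) (ℕₚ.≤-trans (ℕₚ.≤-reflexive e) ys≤n))))
             (trans (reflexive (≡.sym (det-∷ m xs y s))) (go n xs (y ∷ s) (ℕₚ.≤-trans (ℕₚ.≤-reflexive e) ys≤n))))) ⟩
      m x y * det m′ ys xs + - laplace (m x) ys (λ s → det m′ (y ∷ s) xs) ∎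

  det-mapˡ : ∀ (g : A′ → A) (m : A → B → Carrier) xs ys → det m (map g xs) ys ≡ det (m ∘ g) xs ys
  det-mapˡ g m []       []       = ≡.refl
  det-mapˡ g m (_ ∷ _)  []       = ≡.refl
  det-mapˡ {B = B} g m xs (y ∷ ys) = ≡.trans (det-∷ m (map g xs) y ys)
    (≡.trans (laplace-map g (λ x → m x y) xs _) (≡.trans (laplace-≡ xs (λ r → det-mapˡ g m r ys)) (≡.sym (det-∷ (m ∘ g) xs y ys))))
    where
    laplace-≡ : ∀ {v : _ → Carrier} xs {G H : List _ → Carrier} → (∀ r → G r ≡ H r) → laplace v xs G ≡ laplace v xs H
    laplace-≡ []       p = ≡.refl
    laplace-≡ (x ∷ xs) p = ≡.cong₂ (λ u w → _ * u + - w) (p xs) (laplace-≡ xs (λ r → p (x ∷ r)))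

  det-scale : ∀ (h : Carrier → Carrier) (m : A → Carrier → Carrier) xs ys →
    det (λ x y → h y * m x y) xs ys ≈ ∏ˡ h ys * det m xs ys
  det-scale h m []       []       = sym (*-identityˡ 1#)
  det-scale h m (_ ∷ _)  []       = sym (zeroʳ _)
  det-scale {A = A} h m xs (y ∷ ys) = begin
    det m′ xs (y ∷ ys)                              ≡⟨ det-∷ m′ xs y ys ⟩
    laplace (λ x → h y * m x y) xs (λ r → det m′ r ys)
      ≈⟨ laplace-cong xs (λ x → solve 1 (λ u → u := :0 :+ u) refl _) (λ r _ → det-scale h m r ys) ⟩
    laplace (λ x → 0# + h y * m x y) xs (λ r → p * det m r ys)
      ≈⟨ laplace-linearˡ _ _ (h y) xs _ ⟩
    laplace (λ _ → 0#) xs (λ r → p * det m r ys) + h y * laplace (λ x → m x y) xs (λ r → p * det m r ys)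
      ≈⟨ +-cong (laplace-0ˡ _ (zeros xs)) (*-congˡ (laplace-* _ xs p _)) ⟩
    0# + h y * (p * laplace (λ x → m x y) xs (λ r → det m r ys))
      ≈⟨ trans (+-identityˡ _) (sym (*-assoc _ _ _)) ⟩
    h y * p * laplace (λ x → m x y) xs (λ r → det m r ys)
      ≡⟨ ≡.cong (h y * p *_) (≡.sym (det-∷ m xs y ys)) ⟩
    h y * p * det m xs (y ∷ ys) ∎
    where
    m′ = λ x y → h y * m x y
    p = ∏ˡ h ys
    zeros : ∀ (xs : List A) → All (λ _ → 0# ≈ 0#) xs
    zeros []       = []
    zeros (_ ∷ xs) = refl ∷ zeros xs

  -- Columns are functions of the point, so that a column operation changes one entry of a list. The
  -- column `ψ` must already be present, which makes the additional determinant vanish.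
  det-column-operation : ∀ (zs : List A) (ps : List (A → Carrier)) {ψ} φ x qs → ψ ∈ ps →
    det (λ z φ → φ z) zs (ps ++ (λ z → φ z + x * ψ z) ∷ qs) ≈ det (λ z φ → φ z) zs (ps ++ φ ∷ qs)
  det-column-operation {A = A} zs ps {ψ} φ x qs ψ∈ps = begin
    det m zs (ps ++ (λ z → φ z + x * ψ z) ∷ qs)
      ≈⟨ det-shift m ps _ qs zs ⟩
    alternate k (det m zs ((λ z → φ z + x * ψ z) ∷ ps ++ qs))
      ≈⟨ alternate-cong k (trans (reflexive (det-∷ m zs _ _)) (trans (laplace-linearˡ φ ψ x zs _)
           (+-cong (reflexive (≡.sym (det-∷ m zs φ _))) (*-congˡ (trans (reflexive (≡.sym (det-∷ m zs ψ _)))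
             (det-member m zs (∈-++⁺ˡ ψ∈ps))))))) ⟩
    alternate k (det m zs (φ ∷ ps ++ qs) + x * 0#)
      ≈⟨ alternate-cong k (trans (+-congˡ (zeroʳ x)) (+-identityʳ _)) ⟩
    alternate k (det m zs (φ ∷ ps ++ qs))
      ≈⟨ sym (det-shift m ps φ qs zs) ⟩
    det m zs (ps ++ φ ∷ qs) ∎
    where
    m : A → (A → Carrier) → Carrier
    m z φ = φ z
    k = length ps

  pow-+ : ∀ x i j → pow x (i ℕ.+ j) ≈ pow x i * pow x j
  pow-+ x zero    j = sym (*-identityˡ _)
  pow-+ x (suc i) j = trans (*-congˡ (pow-+ x i j)) (sym (*-assoc _ _ _))

  pow-cong : ∀ {x y} k → x ≈ y → pow x k ≈ pow y k
  pow-cong zero    p = refl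
  pow-cong (suc k) p = *-cong p (pow-cong k p)

  monomial : ℕ → Carrier → Carrier
  monomial k z = pow z k

  alternant : List ℕ → List Carrier → Carrier
  alternant ks zs = det monomial ks zs

  -- Certifies that in the sequence of exponents `ps` followed by d + k for k in `ks`, each d + k
  -- comes after its own k. This is what makes the column operations subtracting x zᵏ from zᵈ⁺ᵏ
  -- possible.
  data Reachable (d : ℕ) : (ps ks : List ℕ) → Set where
    []  : ∀ {ps} → Reachable d ps []
    _∷_ : ∀ {ps k ks} → k ∈ ps → Reachable d (ps ++ (d ℕ.+ k) ∷ []) ks → Reachable d ps (k ∷ ks)

  Reachable-shift : ∀ {d ps ks} e → Reachable d ps ks → Reachable d (map (e ℕ.+_) ps) (map (e ℕ.+_) ks)
  Reachable-shift e [] = []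
  Reachable-shift {d} {ps} e (_∷_ {k = k} k∈ps r) = ∈-map⁺ (e ℕ.+_) k∈ps ∷
    ≡.subst (λ qs → Reachable d qs _)
      (≡.trans (Listₚ.map-++ (e ℕ.+_) ps _) (≡.cong (λ j → map (e ℕ.+_) ps ++ j ∷ [])
        (≡.trans (≡.sym (ℕₚ.+-assoc e d k)) (≡.trans (≡.cong (ℕ._+ k) (ℕₚ.+-comm e d)) (ℕₚ.+-assoc d e k)))))
      (Reachable-shift e r)

  Reachable-weaken : ∀ {d ps qs ks} → ps ⊆ qs → Reachable d ps ks → Reachable d qs ks
  Reachable-weaken ps⊆qs []       = []
  Reachable-weaken ps⊆qs (k∈ps ∷ r) = ps⊆qs k∈ps ∷ Reachable-weaken (++⁺ˡ _ ps⊆qs) r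

  -- Going through the columns from the last to the first, z ^ (d + k) is replaced by
  -- (z ^ d − x) z ^ k; the column z ^ k is still present then.
  alternant-reduce : ∀ d x zs ps {ks} → Reachable d ps ks →
    det (λ z φ → φ z) zs (map monomial ps ++ map (λ k → monomial (d ℕ.+ k)) ks)
    ≈ det (λ z φ → φ z) zs (map monomial ps ++ map (λ k z → (pow z d + - x) * pow z k) ks)
  alternant-reduce d x zs ps [] = refl
  alternant-reduce d x zs ps (_∷_ {k = k} {ks} k∈ps r) = begin
    det m zs (map monomial ps ++ monomial (d ℕ.+ k) ∷ map (λ k → monomial (d ℕ.+ k)) ks)
      ≡⟨ ≡.cong (det m zs) (regroup (map (λ k → monomial (d ℕ.+ k)) ks)) ⟩
    det m zs (map monomial (ps ++ (d ℕ.+ k) ∷ []) ++ map (λ k → monomial (d ℕ.+ k)) ks)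
      ≈⟨ alternant-reduce d x zs (ps ++ (d ℕ.+ k) ∷ []) r ⟩
    det m zs (map monomial (ps ++ (d ℕ.+ k) ∷ []) ++ rest)
      ≡⟨ ≡.cong (det m zs) (≡.sym (regroup rest)) ⟩
    det m zs (map monomial ps ++ monomial (d ℕ.+ k) ∷ rest)
      ≈⟨ sym (det-column-operation zs (map monomial ps) (monomial (d ℕ.+ k)) (- x) rest (∈-map⁺ monomial k∈ps)) ⟩
    det m zs (map monomial ps ++ (λ z → monomial (d ℕ.+ k) z + - x * pow z k) ∷ rest)
      ≈⟨ det-column-cong (map monomial ps) rest (λ z → trans (+-congʳ (pow-+ z d k)) (sym (distribʳ _ _ _))) zs ⟩
    det m zs (map monomial ps ++ (λ z → (pow z d + - x) * pow z k) ∷ rest) ∎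
    where
    m : Carrier → (Carrier → Carrier) → Carrier
    m z φ = φ z
    rest = map (λ k z → (pow z d + - x) * pow z k) ks
    regroup : ∀ qs → map monomial ps ++ monomial (d ℕ.+ k) ∷ qs ≡ map monomial (ps ++ (d ℕ.+ k) ∷ []) ++ qs
    regroup qs = ≡.trans (≡.sym (Listₚ.++-assoc (map monomial ps) (monomial (d ℕ.+ k) ∷ []) qs))
      (≡.cong (_++ qs) (≡.sym (Listₚ.map-++ monomial ps _)))
    det-column-cong : ∀ ps qs {φ φ′} → (∀ z → φ z ≈ φ′ z) → ∀ zs → det m zs (ps ++ φ ∷ qs) ≈ det m zs (ps ++ φ′ ∷ qs)
    det-column-cong []       qs p zs = trans (reflexive (det-∷ m zs _ qs))
      (trans (laplace-cong zs p (λ _ _ → refl)) (reflexive (≡.sym (det-∷ m zs _ qs))))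
    det-column-cong (ψ ∷ ps) qs p zs = det-tail ψ (det-column-cong ps qs p) zs

-- Factorisation of alternants at special points.

module Alternants {c ℓ} (F : Field c ℓ) (ω : Field.Carrier F)
  (ω-root : FieldLemmas.PrimitiveCubeRoot F ω) where

  open FieldLemmas F
  open EisensteinSolver F ω ω-root
  open Determinants F ω ω-root

  private
    apply : (Carrier → Carrier) → Carrier → Carrier
    apply φ z = φ z

    alternant-functions : ∀ ks zs → alternant ks zs ≈ det (flip apply) zs (map monomial ks)
    alternant-functions ks zs = trans (reflexive (≡.sym (det-mapˡ monomial apply ks zs))) (det-transpose apply (map monomial ks) zs)

    alternant-reduced : ∀ d x ps {ks} zs → Reachable d ps ks →
      alternant (ps ++ map (d ℕ.+_) ks) zs
      ≈ det apply (map monomial ps ++ map (λ k z → (pow z d + - x) * pow z k) ks) zs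
    alternant-reduced d x ps {ks} zs r = begin
      alternant (ps ++ map (d ℕ.+_) ks) zs
        ≈⟨ alternant-functions (ps ++ map (d ℕ.+_) ks) zs ⟩
      det (flip apply) zs (map monomial (ps ++ map (d ℕ.+_) ks))
        ≡⟨ ≡.cong (det (flip apply) zs) (≡.trans (Listₚ.map-++ monomial ps _) (≡.cong (map monomial ps ++_) (≡.sym (Listₚ.map-∘ ks)))) ⟩
      det (flip apply) zs (map monomial ps ++ map (λ k → monomial (d ℕ.+ k)) ks)
        ≈⟨ alternant-reduce d x zs ps r ⟩
      det (flip apply) zs (map monomial ps ++ map (λ k z → (pow z d + - x) * pow z k) ks)
        ≈⟨ det-transpose (flip apply) zs _ ⟩
      det apply (map monomial ps ++ map (λ k z → (pow z d + - x) * pow z k) ks) zs ∎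

    det-reduced : ∀ d x ks zs → det apply (map (λ k z → (pow z d + - x) * pow z k) ks) zs
                                ≈ ∏ˡ (λ z → pow z d + - x) zs * alternant ks zs
    det-reduced d x ks zs = trans (reflexive (det-mapˡ (λ k z → (pow z d + - x) * pow z k) apply ks zs))
      (det-scale (λ z → pow z d + - x) monomial ks zs)

    vanishing : ∀ d x ks t → pow t d ≈ x → All (λ φ → φ t ≈ 0#) (map (λ k z → (pow z d + - x) * pow z k) ks)
    vanishing d x []       t h = []
    vanishing d x (k ∷ ks) t h = trans (*-congʳ (x≈y⇒x-y≈0 h)) (zeroˡ _) ∷ vanishing d x ks t h

  -- Column operations turn zᵏ⁺¹ into (z - t) zᵏ. These columns vanish at `t`, so the expansion at
  -- `t` keeps only the constant column.
  alternant-∷ : ∀ {ks} t zs → Reachable 1 (0 ∷ []) ks →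
    alternant (0 ∷ map suc ks) (t ∷ zs) ≈ ∏ˡ (λ z → z + - t) zs * alternant ks zs
  alternant-∷ {ks} t zs r = begin
    alternant (0 ∷ map suc ks) (t ∷ zs)
      ≈⟨ alternant-reduced 1 t (0 ∷ []) (t ∷ zs) r ⟩
    1# * det apply (map χ ks) zs + - laplace (λ φ → φ t) (map χ ks) _
      ≈⟨ +-cong (*-identityˡ _) (-‿cong (laplace-0ˡ _ (vanishing 1 t ks t (*-identityʳ t)))) ⟩
    det apply (map χ ks) zs + - 0#
      ≈⟨ solve 1 (λ x → x :- :0 := x) refl _ ⟩
    det apply (map χ ks) zs
      ≈⟨ det-reduced 1 t ks zs ⟩
    ∏ˡ (λ z → pow z 1 + - t) zs * alternant ks zs
      ≈⟨ *-congʳ (∏ˡ-cong zs λ z → +-congʳ (*-identityʳ z)) ⟩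
    ∏ˡ (λ z → z + - t) zs * alternant ks zs ∎
    where χ = λ k z → (pow z 1 + - t) * pow z k

  -- Column operations turn zᵏ⁺³ into (z³ - t³) zᵏ, which vanishes at both `t` and `u`. The two
  -- points therefore only meet the columns `i` and `j`, and their 2 × 2 minor splits off.
  alternant-∷∷ : ∀ {ks} i j t u zs → Reachable 3 (i ∷ j ∷ []) ks → pow u 3 ≈ pow t 3 →
    alternant (i ∷ j ∷ map (3 ℕ.+_) ks) (t ∷ u ∷ zs)
    ≈ (pow t i * pow u j + - (pow t j * pow u i)) * ∏ˡ (λ z → pow z 3 + - pow t 3) zs * alternant ks zs
  alternant-∷∷ {ks} i j t u zs r u³≈t³ = begin
    alternant (i ∷ j ∷ map (3 ℕ.+_) ks) (t ∷ u ∷ zs)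
      ≈⟨ alternant-reduced 3 x (i ∷ j ∷ []) (t ∷ u ∷ zs) r ⟩
    pow t i * (pow u j * D + - laplace (λ φ → φ u) (map χ ks) _)
      + - (pow t j * (pow u i * D + - laplace (λ φ → φ u) (map χ ks) _) + - laplace (λ φ → φ t) (map χ ks) _)
      ≈⟨ +-cong (*-congˡ (+-congˡ (-‿cong (laplace-0ˡ _ vu))))
                (-‿cong (+-cong (*-congˡ (+-congˡ (-‿cong (laplace-0ˡ _ vu)))) (-‿cong (laplace-0ˡ _ (vanishing 3 x ks t refl))))) ⟩
    pow t i * (pow u j * D + - 0#) + - (pow t j * (pow u i * D + - 0#) + - 0#)
      ≈⟨ solve 5 (λ a b c d D → a :* (b :* D :- :0) :- (c :* (d :* D :- :0) :- :0) := (a :* b :- c :* d) :* D) refl _ _ _ _ _ ⟩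
    (pow t i * pow u j + - (pow t j * pow u i)) * D
      ≈⟨ trans (*-congˡ (det-reduced 3 x ks zs)) (sym (*-assoc _ _ _)) ⟩
    (pow t i * pow u j + - (pow t j * pow u i)) * ∏ˡ (λ z → pow z 3 + - x) zs * alternant ks zs ∎
    where
    x = pow t 3
    χ = λ k z → (pow z 3 + - x) * pow z k
    D = det apply (map χ ks) zs
    vu = vanishing 3 x ks u u³≈t³

  range : ℕ → List ℕ
  range zero    = []
  range (suc n) = 0 ∷ map suc (range n)

  range-reachable : ∀ n → Reachable 1 (0 ∷ []) (range n)
  range-reachable zero    = []
  range-reachable (suc n) = here ≡.refl ∷ Reachable-weaken there (Reachable-shift 1 (range-reachable n))

  vandermonde : List Carrier → Carrier
  vandermonde []       = 1#
  vandermonde (z ∷ zs) = ∏ˡ (λ w → w + - z) zs * vandermonde zs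

  alternant-range : ∀ zs → alternant (range (length zs)) zs ≈ vandermonde zs
  alternant-range []       = refl
  alternant-range (z ∷ zs) = trans (alternant-∷ z zs (range-reachable (length zs))) (*-congˡ (alternant-range zs))

  pow-pow : ∀ x i j → pow (pow x i) j ≈ pow (pow x j) i
  pow-pow x i zero    = sym (pow-1 i)
    where
    pow-1 : ∀ i → pow 1# i ≈ 1#
    pow-1 zero    = refl
    pow-1 (suc i) = trans (*-identityˡ _) (pow-1 i)
  pow-pow x i (suc j) = trans (*-congˡ (pow-pow x i j)) (sym (pow-distrib x (pow x j) i))
    where
    pow-distrib : ∀ x y i → pow (x * y) i ≈ pow x i * pow y i
    pow-distrib x y zero    = sym (*-identityˡ 1#)
    pow-distrib x y (suc i) = trans (*-congˡ (pow-distrib x y i))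
      (solve 4 (λ x y p q → x :* y :* (p :* q) := x :* p :* (y :* q)) refl _ _ _ _)

  -- At the points 1, q, q², … the exponents and the points exchange their roles.
  alternant-geometric : ∀ q ks → alternant ks (map (pow q) (range (length ks))) ≈ vandermonde (map (pow q) ks)
  alternant-geometric q ks = begin
    det monomial ks (map (pow q) is)               ≈⟨ det-transpose monomial ks _ ⟩
    det (flip monomial) (map (pow q) is) ks        ≡⟨ det-mapˡ (pow q) (flip monomial) is ks ⟩
    det (λ i k → pow (pow q i) k) is ks            ≈⟨ det-cong is ks (λ i k → pow-pow q i k) ⟩
    det (λ i k → pow (pow q k) i) is ks            ≈⟨ det-transpose _ is ks ⟩
    det (λ k i → pow (pow q k) i) ks is            ≡⟨ ≡.sym (det-mapˡ (pow q) (flip monomial) ks is) ⟩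
    det (flip monomial) (map (pow q) ks) is        ≈⟨ det-transpose (flip monomial) _ is ⟩
    alternant is (map (pow q) ks)                  ≡⟨ ≡.cong (λ n → alternant (range n) (map (pow q) ks)) (≡.sym (Listₚ.length-map (pow q) ks)) ⟩
    alternant (range (length (map (pow q) ks))) (map (pow q) ks) ≈⟨ alternant-range (map (pow q) ks) ⟩
    vandermonde (map (pow q) ks)                  ∎
    where is = range (length ks)

  triples : (i j n : ℕ) → List ℕ
  triples i j zero    = []
  triples i j (suc n) = i ∷ j ∷ map (3 ℕ.+_) (triples i j n)

  triples-reachable : ∀ i j n → Reachable 3 (i ∷ j ∷ []) (triples i j n)
  triples-reachable i j zero    = []
  triples-reachable i j (suc n) = here ≡.refl ∷ there (here ≡.refl)
    ∷ Reachable-weaken (λ { (here p) → there (there (here p)) ; (there (here p)) → there (there (there (here p))) })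
        (Reachable-shift 3 (triples-reachable i j n))

-- Polynomial functions with degree bounds.

module PolynomialFunctions {c ℓ} (F : Field c ℓ) (ω : Field.Carrier F)
  (ω-root : FieldLemmas.PrimitiveCubeRoot F ω) where

  open FieldLemmas F
  open EisensteinSolver F ω ω-root
  open Weights F ω ω-root
  open Transfer F ω ω-root
  open Determinants F ω ω-root
  open Alternants F ω ω-root

  -- A property of a function rather than a type of coefficient lists: the partition function and
  -- the alternants remain what they are, and only a Horner form with an upper bound for the degree
  -- is recorded. `const` is allowed at every bound.
  data Poly : ℕ → (Carrier → Carrier) → Set (c ⊔ ℓ) where
    const : ∀ {n g} x₀ → (∀ x → g x ≈ x₀) → Poly n g
    horner : ∀ {n g h} x₀ → Poly n h → (∀ x → g x ≈ x₀ + x * h x) → Poly (suc n) g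

  Poly-ext : ∀ {n g h} → (∀ x → h x ≈ g x) → Poly n g → Poly n h
  Poly-ext h≈g (const x₀ p)    = const x₀ λ x → trans (h≈g x) (p x)
  Poly-ext h≈g (horner x₀ k p) = horner x₀ k λ x → trans (h≈g x) (p x)

  Poly-≤ : ∀ {m n g} → m ℕ.≤ n → Poly m g → Poly n g
  Poly-≤ m≤n         (const x₀ p)    = const x₀ p
  Poly-≤ (ℕ.s≤s m≤n) (horner x₀ k p) = horner x₀ (Poly-≤ m≤n k) p

  Poly-* : ∀ {n g} x → Poly n g → Poly n (λ y → x * g y)
  Poly-* x (const x₀ p)    = const (x * x₀) λ y → *-congˡ (p y)
  Poly-* x (horner x₀ k p) = horner (x * x₀) (Poly-* x k) λ y → trans (*-congˡ (p y))
    (solve 4 (λ x x₀ y h → x :* (x₀ :+ y :* h) := x :* x₀ :+ y :* (x :* h)) refl _ _ _ _)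

  Poly-+ : ∀ {n g h} → Poly n g → Poly n h → Poly n (λ x → g x + h x)
  Poly-+ (const x₀ p)    (const y₀ q)    = const (x₀ + y₀) λ x → +-cong (p x) (q x)
  Poly-+ (const x₀ p)    (horner y₀ l q) = horner (x₀ + y₀) l λ x → trans (+-cong (p x) (q x)) (sym (+-assoc _ _ _))
  Poly-+ (horner x₀ k p) (const y₀ q)    = horner (x₀ + y₀) k λ x → trans (+-cong (p x) (q x))
    (solve 3 (λ x₀ y₀ z → x₀ :+ z :+ y₀ := x₀ :+ y₀ :+ z) refl _ _ _)
  Poly-+ (horner x₀ k p) (horner y₀ l q) = horner (x₀ + y₀) (Poly-+ k l) λ x → trans (+-cong (p x) (q x))
    (solve 5 (λ x₀ y₀ x g h → x₀ :+ x :* g :+ (y₀ :+ x :* h) := x₀ :+ y₀ :+ x :* (g :+ h)) refl _ _ _ _ _)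

  Poly-mul : ∀ {m n g h} → Poly m g → Poly n h → Poly (m ℕ.+ n) (λ x → g x * h x)
  Poly-mul {m} (const x₀ p) q = Poly-ext (λ x → *-congʳ (p x)) (Poly-≤ (ℕₚ.m≤n+m _ m) (Poly-* x₀ q))
  Poly-mul {suc m} (horner {h = k} x₀ p e) q = Poly-ext
    (λ x → trans (*-congʳ (e x)) (solve 4 (λ x₀ x k h → (x₀ :+ x :* k) :* h := x₀ :* h :+ (:0 :+ x :* (k :* h))) refl _ _ _ _))
    (Poly-+ (Poly-≤ (ℕₚ.m≤n+m _ (suc m)) (Poly-* x₀ q)) (horner 0# (Poly-mul p q) (λ _ → refl)))

  Poly-‿- : ∀ {n g} → Poly n g → Poly n (λ x → - g x)
  Poly-‿- p = Poly-ext (λ x → sym (-1*x≈-x _)) (Poly-* (- 1#) p)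

  Poly-const : ∀ {n} x → Poly n (λ _ → x)
  Poly-const x = const x λ _ → refl

  Poly-id : Poly 1 (λ x → x)
  Poly-id = horner 0# (Poly-const 1#) λ x → solve 1 (λ x → x := :0 :+ x :* :1) refl x

  Poly-pow : ∀ {n} k → k ℕ.≤ n → Poly n (λ x → pow x k)
  Poly-pow zero    _           = Poly-const 1#
  Poly-pow (suc k) (ℕ.s≤s k≤n) = horner 0# (Poly-pow k k≤n) λ x → sym (+-identityˡ _)

  -- Synthetic division by x - r, read off from the Horner form.
  Poly-factor : ∀ {n g} → Poly (suc n) g → ∀ r → Σ[ h ∈ (Carrier → Carrier) ] Poly n h × (∀ x → g x ≈ g r + (x + - r) * h x)
  Poly-factor (const x₀ p) r = (λ _ → 0#) , Poly-const 0# , λ x → trans (p x)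
    (trans (solve 2 (λ x₀ y → x₀ := x₀ :+ y :* :0) refl x₀ (x + - r)) (+-congʳ (sym (p r))))
  Poly-factor {g = g} (horner {h = h} x₀ (const y₀ q) p) r = (λ _ → y₀) , Poly-const y₀ , λ x → begin
    g x                                 ≈⟨ p x ⟩
    x₀ + x * h x                        ≈⟨ +-congˡ (*-congˡ (q x)) ⟩
    x₀ + x * y₀                         ≈⟨ solve 4 (λ x₀ x y₀ r → x₀ :+ x :* y₀ := x₀ :+ r :* y₀ :+ (x :- r) :* y₀) refl _ _ _ _ ⟩
    x₀ + r * y₀ + (x + - r) * y₀        ≈⟨ +-congʳ (sym (trans (p r) (+-congˡ (*-congˡ (q r))))) ⟩
    g r + (x + - r) * y₀                ∎
  Poly-factor {g = g} (horner {h = h} x₀ k@(horner _ _ _) p) r with l , l-poly , e ← Poly-factor k r =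
    (λ x → h r + x * l x) , horner (h r) l-poly (λ _ → refl) , λ x → begin
    g x                                         ≈⟨ p x ⟩
    x₀ + x * h x                                ≈⟨ +-congˡ (*-congˡ (e x)) ⟩
    x₀ + x * (h r + (x + - r) * l x)            ≈⟨ solve 5 (λ x₀ x h r l → x₀ :+ x :* (h :+ (x :- r) :* l)
                                                     := x₀ :+ r :* h :+ (x :- r) :* (h :+ x :* l)) refl _ _ _ _ _ ⟩
    x₀ + r * h r + (x + - r) * (h r + x * l x)  ≈⟨ +-congʳ (sym (p r)) ⟩
    g r + (x + - r) * (h r + x * l x)           ∎

  Poly-vanishes : ∀ {n g} rs → Poly n g → n ℕ.< length rs → AllPairs _≉_ rs → All (λ r → g r ≈ 0#) rs → ∀ x → g x ≈ 0#
  Poly-vanishes {zero} (r ∷ _) (const x₀ p) _ _ (gr≈0 ∷ _) x = trans (p x) (trans (sym (p r)) gr≈0)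
  Poly-vanishes {suc n} {g} (r ∷ rs) p (ℕ.s≤s n<) (r≉ ∷ distinct) (gr≈0 ∷ roots) x
    with h , h-poly , e ← Poly-factor p r = trans (e′ x) (trans (*-congˡ (Poly-vanishes rs h-poly n< distinct (roots′ r≉ roots) x)) (zeroʳ _))
    where
    e′ : ∀ x → g x ≈ (x + - r) * h x
    e′ x = trans (e x) (trans (+-congʳ gr≈0) (+-identityˡ _))
    roots′ : ∀ {rs} → All (r ≉_) rs → All (λ r → g r ≈ 0#) rs → All (λ r → h r ≈ 0#) rs
    roots′ [] [] = []
    roots′ (r≉s ∷ ps) (gs≈0 ∷ qs) = *-zero-cancelˡ (λ s-r≈0 → r≉s (sym (x-y≈0⇒x≈y s-r≈0))) (trans (sym (e′ _)) gs≈0) ∷ roots′ ps qs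

  Poly-∑ˢ : ∀ {n} {g : Carrier → Spin → Carrier} → (∀ s → Poly n (λ x → g x s)) → Poly n (λ x → ∑ˢ (g x))
  Poly-∑ˢ p = Poly-ext (λ x → ∑ˢ-def _) (Poly-+ (p ⊞) (p ⊟))

  Poly-∑ᵛ : ∀ {n} k {g : Carrier → Vec Spin k → Carrier} → (∀ σ → Poly n (λ x → g x σ)) → Poly n (λ x → ∑ᵛ k (g x))
  Poly-∑ᵛ zero    p = p []
  Poly-∑ᵛ (suc k) p = Poly-∑ˢ λ s → Poly-∑ᵛ k λ σ → p (s ∷ σ)

  Poly-vertexWeight : ∀ {m d L g h} v → Poly m g → Poly m h → Poly m (λ x → vertexWeight d L v (g x) (h x))
  Poly-vertexWeight {m} {d} {L} {g} {h} v p q = go v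
    where
    f₁ = f (ω * L)
    f₂ = f (ω * ω * L)
    κ = 1# + - ω
    linear : ∀ x y {w : Carrier → Carrier} → (∀ u → w u ≈ x * g u + y * h u) → Poly m w
    linear x y e = Poly-ext e (Poly-+ (Poly-* x p) (Poly-* y q))
    go : ∀ v → Poly m (λ x → vertexWeight d L v (g x) (h x))
    go a = linear (- (ω * ω * (δ L * d))) (δ L * d) λ u →
      solve 4 (λ w e z y → (y :- w :* w :* z) :* e := :- (w :* w :* e) :* z :+ e :* y) refl _ _ _ _
    go b⁺ = linear (- (ω * (f₁ * (f₁ * f₂ * d)))) (f₁ * (f₁ * f₂ * d)) λ u →
      solve 5 (λ w e f z y → (y :- w :* z) :* e :* f := :- (w :* (e :* f)) :* z :+ e :* f :* y) refl _ _ _ _ _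
    go b⁻ = linear (- (ω * ω * (f₂ * (f₁ * f₂ * d)))) (ω * (f₂ * (f₁ * f₂ * d))) λ u →
      solve 5 (λ w e f z y → w :* (y :- w :* z) :* e :* f := :- (w :* w :* (e :* f)) :* z :+ w :* (e :* f) :* y) refl _ _ _ _ _
    go c⁺ = linear (- (κ * (L * ω) * (f₁ * f₂ * d))) (κ * (f₁ * f₂ * d)) λ u →
      solve 5 (λ k w e z y → k :* (y :- w :* z) :* e := :- (k :* w :* e) :* z :+ k :* e :* y) refl _ _ _ _ _
    go c⁻ = linear (κ * ω * (f₁ * f₂ * d)) (- (κ * L * (f₁ * f₂ * d))) λ u →
      solve 6 (λ k w L e z y → k :* (w :* z :- L :* y) :* e := k :* w :* e :* z :+ :- (k :* L :* e) :* y) refl _ _ _ _ _ _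
    go forbidden = Poly-const 0#

  -- The variable enters only the first block of each row, and every weight is linear in it; so the
  -- degree is at most the number of rows.
  Poly-partition : ∀ {n d L} (σ : Vec Spin (suc n)) zs ys → Poly (length zs) (λ y → partition d L σ zs (y ∷ ys))
  Poly-partition σ [] ys = Poly-const _
  Poly-partition {n} {d} {L} σ (z ∷ zs) ys = Poly-∑ᵛ (suc n)
    {λ y τ → row d L ⊞ σ τ z (y ∷ ys) * partition d (ω * L) τ zs (y ∷ ys)}
    λ τ → Poly-mul (Poly-row σ τ) (Poly-partition τ zs ys)
    where
    Poly-row : ∀ (σ τ : Vec Spin (suc n)) → Poly 1 (λ y → row d L ⊞ σ τ z (y ∷ ys))
    Poly-row (t ∷ σ) (b ∷ τ) = Poly-∑ˢ λ r → Poly-ext (λ x → *-comm _ _)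
      (Poly-* (row d (shift L t) r σ τ z ys) (Poly-vertexWeight (vertex t r b ⊞) (Poly-const z) Poly-id))

  Poly-alternant : ∀ {n} ks zs → All (ℕ._≤ n) ks → Poly n (λ y → alternant ks (y ∷ zs))
  Poly-alternant {n} ks zs ks≤n = Poly-ext (λ y → reflexive (det-∷ monomial ks y zs)) (go ks (λ r → det monomial r zs) ks≤n)
    where
    go : ∀ ks G → All (ℕ._≤ n) ks → Poly n (λ y → laplace (λ k → monomial k y) ks G)
    go []       G []           = Poly-const 0#
    go (k ∷ ks) G (k≤n ∷ ks≤n) = Poly-+ (Poly-ext (λ y → *-comm _ _) (Poly-* _ (Poly-pow k k≤n))) (Poly-‿- (go ks _ ks≤n))

  range-bounded : ∀ n → All (ℕ._< n) (range n)
  range-bounded zero    = []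
  range-bounded (suc n) = ℕ.s≤s ℕ.z≤n ∷ Allₚ.map⁺ (All.map ℕ.s≤s (range-bounded n))

  triples-bounded : ∀ {i j} n → i ℕ.≤ j → All (ℕ._≤ n ℕ.* 3 ℕ.+ j) (triples i j (suc n))
  triples-bounded zero    i≤j = i≤j ∷ ℕₚ.≤-refl ∷ []
  triples-bounded (suc n) i≤j = ℕₚ.≤-trans i≤j (ℕₚ.m≤n+m _ (suc n ℕ.* 3)) ∷ ℕₚ.m≤n+m _ (suc n ℕ.* 3)
    ∷ Allₚ.map⁺ (All.map (ℕₚ.+-monoʳ-≤ 3) (triples-bounded n i≤j))

-- Both sides of the determinant formula, and its reduction in size.

module Determinant {c ℓ} (F : Field c ℓ) (ω : Field.Carrier F)
  (ω-root : FieldLemmas.PrimitiveCubeRoot F ω) where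

  open FieldLemmas F
  open EisensteinSolver F ω ω-root
  open Weights F ω ω-root
  open Transfer F ω ω-root
  open Freezing F ω ω-root
  open Determinants F ω ω-root
  open Alternants F ω ω-root

  ∏ˡ-++ : ∀ (g : Carrier → Carrier) xs ys → ∏ˡ g (xs ++ ys) ≈ ∏ˡ g xs * ∏ˡ g ys
  ∏ˡ-++ g []       ys = sym (*-identityˡ _)
  ∏ˡ-++ g (x ∷ xs) ys = trans (*-congˡ (∏ˡ-++ g xs ys)) (sym (*-assoc _ _ _))

  ∏ˡ-* : ∀ (g h : Carrier → Carrier) xs → ∏ˡ (λ x → g x * h x) xs ≈ ∏ˡ g xs * ∏ˡ h xs
  ∏ˡ-* g h []       = sym (*-identityˡ 1#)
  ∏ˡ-* g h (x ∷ xs) = trans (*-congˡ (∏ˡ-* g h xs))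
    (solve 4 (λ g h p q → g :* h :* (p :* q) := g :* p :* (h :* q)) refl _ _ _ _)

  ∏ˡ-scale : ∀ {g h : Carrier → Carrier} s xs → (∀ x → g x ≈ s * h x) → ∏ˡ g xs ≈ pow s (length xs) * ∏ˡ h xs
  ∏ˡ-scale s []       p = sym (*-identityˡ 1#)
  ∏ˡ-scale s (x ∷ xs) p = trans (*-cong (p x) (∏ˡ-scale s xs p))
    (solve 4 (λ a h p q → a :* h :* (p :* q) := a :* p :* (h :* q)) refl _ _ _ _)

  ∏ˡ-shift : ∀ (g : Carrier → Carrier) xs y ys → ∏ˡ g (xs ++ y ∷ ys) ≈ g y * ∏ˡ g (xs ++ ys)
  ∏ˡ-shift g []       y ys = refl
  ∏ˡ-shift g (x ∷ xs) y ys = trans (*-congˡ (∏ˡ-shift g xs y ys))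
    (solve 3 (λ x y p → x :* (y :* p) := y :* (x :* p)) refl _ _ _)

  product : List Carrier → Carrier
  product = ∏ˡ (λ z → z)

  double : ℕ → ℕ
  double zero    = zero
  double (suc n) = suc (suc (double n))

  double≡ : ∀ n → double n ≡ n ℕ.+ n
  double≡ zero    = ≡.refl
  double≡ (suc n) = ≡.cong suc (≡.trans (≡.cong suc (double≡ n)) (≡.sym (ℕₚ.+-suc n n)))

  -- The two factors are the denominators 1 - λωⁿ⁺¹ and 1 - λωⁿ⁺² of the final formula. Multiplied
  -- by them, the partition function turns out to be quadratic in `L`.
  numerator : ∀ {n} (d L : Carrier) (zs : List Carrier) (ys : Vec Carrier n) → Carrier
  numerator {n} d L zs ys = f (pow ω (suc n) * L) * f (pow ω (suc (suc n)) * L) * partition d L ⊞ⁿ zs ys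

  -- Collects the constants of the successive reductions: κ from the `c⁻` vertex and a factor - ω²
  -- for each of the n frozen blocks whose linear factor has to be made monic in z.
  scalar : ℕ → Carrier
  scalar zero    = 1#
  scalar (suc n) = κ * pow (- (ω * ω)) n * scalar n

  combination : (n : ℕ) (L ∏z ∏y D₁ D₂ : Carrier) → Carrier
  combination n L ∏z ∏y D₁ D₂ = scalar n *
    (pow ω n * ∏z * D₁ + pow (- 1#) n * L * D₂ + pow ω n * pow ω n * (L * L) * ∏y * D₁)

  -- The three alternants are separate arguments because they are rescaled together while everything
  -- else stays: by the sign of a reordering of the points, later by a power of q - 1.
  defect : (n : ℕ) (L N ∏z ∏y V D₁ D₂ : Carrier) → Carrier
  defect n L N ∏z ∏y V D₁ D₂ = N * V + - combination n L ∏z ∏y D₁ D₂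

  defect-cong : ∀ n L {N N′ ∏z ∏z′ ∏y V V′ D₁ D₁′ D₂ D₂′} → N ≈ N′ → ∏z ≈ ∏z′ → V ≈ V′ → D₁ ≈ D₁′ → D₂ ≈ D₂′ →
    defect n L N ∏z ∏y V D₁ D₂ ≈ defect n L N′ ∏z′ ∏y V′ D₁′ D₂′
  defect-cong n L N≈ z≈ V≈ D₁≈ D₂≈ = +-cong (*-cong N≈ V≈) (-‿cong (*-congˡ
    (+-cong (+-cong (*-cong (*-congˡ z≈) D₁≈) (*-congˡ D₂≈)) (*-congˡ D₁≈))))

  alternate≈* : ∀ k x → alternate k x ≈ alternate k 1# * x
  alternate≈* zero    x = sym (*-identityˡ x)
  alternate≈* (suc k) x = trans (-‿cong (alternate≈* k x)) (-‿distribˡ-* _ _)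

  defect-* : ∀ n L N ∏z ∏y V D₁ D₂ s →
    defect n L N ∏z ∏y (s * V) (s * D₁) (s * D₂) ≈ s * defect n L N ∏z ∏y V D₁ D₂
  defect-* n L N ∏z ∏y V D₁ D₂ s = solve 11 (λ p w m L N z y V D E s →
      N :* (s :* V) :- p :* (w :* z :* (s :* D) :+ m :* L :* (s :* E) :+ w :* w :* (L :* L) :* y :* (s :* D))
      := s :* (N :* V :- p :* (w :* z :* D :+ m :* L :* E :+ w :* w :* (L :* L) :* y :* D)))
    refl (scalar n) (pow ω n) (pow (- 1#) n) L N ∏z ∏y V D₁ D₂ s

  V D₁ D₂ : ℕ → List Carrier → Carrier
  V n = alternant (range (double n))
  D₁ n = alternant (triples 0 1 n)
  D₂ n = alternant (triples 0 2 n)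

  defectAt : ∀ {n} (d L : Carrier) (zs : List Carrier) (ys : Vec Carrier n) (ps : List Carrier) → Carrier
  defectAt {n} d L zs ys ps =
    defect n L (numerator d L zs ys) (product zs) (product (toList ys)) (V n ps) (D₁ n ps) (D₂ n ps)

  -- The identity for n implies the identity for n + 1 if y is one of ω t, ω² t, where t′ is the
  -- other one and t one of the zs.
  defect-induct : ∀ {n} d L L′ t y t′ {N} zs (ys : Vec Carrier n) →
    (∀ v → (v + - t) * (v + - y) * (v + - t′) ≈ pow v 3 + - pow t 3) → pow y 3 ≈ pow t 3 →
    ω * t * (y + - t) * L′ ≈ - (L * (y * y + - (t * t))) →
    ω * t * (y + - t) * (L′ * L′) ≈ ω * ω * (L * L) * y * (y + - t) →
    N ≈ κ * (ω * t) * (pow (- (ω * ω)) n * ∏ˡ (λ v → v + - t′) (toList ys ++ zs)) * numerator d L′ zs ys →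
    defectAt d L′ zs ys (toList ys ++ zs) ≈ 0# →
    let ps = t ∷ y ∷ toList ys ++ zs in
    defect (suc n) L N (t * product zs) (y * product (toList ys)) (V (suc n) ps) (D₁ (suc n) ps) (D₂ (suc n) ps) ≈ 0#
  defect-induct {n} d L L′ t y t′ {N} zs ys cubes y³≈t³ hyp₁ hyp₂ N≈ IH = x≈y⇒x-y≈0 (begin
    N * V (suc n) ps
      ≈⟨ *-cong N≈ V≈ ⟩
    κ * (ω * t) * (q * ∏ˡ (λ v → v + - t′) rest) * Nₙ * ((y + - t) * (∏ˡ (λ v → v + - t) rest * ∏ˡ (λ v → v + - y) rest) * Vₙ)
      ≈⟨ solve 10 (λ k w t q a N y b c V → k :* (w :* t) :* (q :* a) :* N :* ((y :- t) :* (b :* c) :* V)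
           := k :* q :* (w :* t :* (y :- t)) :* (b :* c :* a) :* (N :* V)) refl κ ω t q _ Nₙ y _ _ Vₙ ⟩
    κ * q * (ω * t * (y + - t)) * (∏ˡ (λ v → v + - t) rest * ∏ˡ (λ v → v + - y) rest * ∏ˡ (λ v → v + - t′) rest) * (Nₙ * Vₙ)
      ≈⟨ *-cong (*-congˡ cubes′) (x-y≈0⇒x≈y IH) ⟩
    κ * q * (ω * t * (y + - t)) * Γ * (scalar n * (w * ∏z * E₁ + m * L′ * E₂ + w * w * (L′ * L′) * ∏y * E₁))
      ≈⟨ solve 13 (λ k q u Γ p w z E m L E′ L₂ y → k :* q :* u :* Γ :* (p :* (w :* z :* E :+ m :* L :* E′ :+ w :* w :* L₂ :* y :* E))
           := k :* q :* p :* (w :* z :* (u :* Γ :* E) :+ m :* (u :* L) :* Γ :* E′ :+ w :* w :* (u :* L₂) :* y :* Γ :* E))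
           refl κ q (ω * t * (y + - t)) Γ (scalar n) w ∏z E₁ m L′ E₂ (L′ * L′) ∏y ⟩
    κ * q * scalar n * (w * ∏z * (ω * t * (y + - t) * Γ * E₁) + m * (ω * t * (y + - t) * L′) * Γ * E₂
      + w * w * (ω * t * (y + - t) * (L′ * L′)) * ∏y * Γ * E₁)
      -- The three cube roots have sum t + y + t′ = 0, so `hyp₁` amounts to ω t L′ = L t′: L′ = ω L
      -- for y = ω t and L′ = L for y = ω² t. `hyp₂` is the matching relation for the quadratic
      -- term.
      ≈⟨ *-congˡ (+-cong (+-congˡ (*-congʳ (*-congʳ (*-congˡ hyp₁)))) (*-congʳ (*-congʳ (*-congʳ (*-congˡ hyp₂))))) ⟩
    κ * q * scalar n * (w * ∏z * (ω * t * (y + - t) * Γ * E₁) + m * - (L * (y * y + - (t * t))) * Γ * E₂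
      + w * w * (ω * ω * (L * L) * y * (y + - t)) * ∏y * Γ * E₁)
      ≈⟨ *-congˡ (solve 11 (λ w z v t y Γ E m L E′ p →
             w :* z :* (v :* t :* (y :- t) :* Γ :* E) :+ m :* (:- (L :* (y :* y :- t :* t))) :* Γ :* E′
               :+ w :* w :* (v :* v :* (L :* L) :* y :* (y :- t)) :* p :* Γ :* E
             := v :* w :* (t :* z) :* ((y :- t) :* Γ :* E) :+ :- :1 :* m :* L :* ((y :* y :- t :* t) :* Γ :* E′)
               :+ v :* w :* (v :* w) :* (L :* L) :* (y :* p) :* ((y :- t) :* Γ :* E))
           refl w ∏z ω t y Γ E₁ m L E₂ ∏y) ⟩
    κ * q * scalar n * (ω * w * (t * ∏z) * ((y + - t) * Γ * E₁) + - 1# * m * L * ((y * y + - (t * t)) * Γ * E₂)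
      + ω * w * (ω * w) * (L * L) * (y * ∏y) * ((y + - t) * Γ * E₁))
      ≈⟨ *-congˡ (+-cong (+-cong (*-congˡ (sym D₁≈)) (*-congˡ (sym D₂≈))) (*-congˡ (sym D₁≈))) ⟩
    combination (suc n) L (t * ∏z) (y * ∏y) (D₁ (suc n) ps) (D₂ (suc n) ps) ∎)
    where
    rest = toList ys ++ zs
    ps = t ∷ y ∷ rest
    q = pow (- (ω * ω)) n
    w = pow ω n
    m = pow (- 1#) n
    ∏z = product zs
    ∏y = product (toList ys)
    Nₙ = numerator d L′ zs ys
    Vₙ = V n rest
    E₁ = D₁ n rest
    E₂ = D₂ n rest
    Γ = ∏ˡ (λ v → pow v 3 + - pow t 3) rest
    cubes′ : ∏ˡ (λ v → v + - t) rest * ∏ˡ (λ v → v + - y) rest * ∏ˡ (λ v → v + - t′) rest ≈ Γ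
    cubes′ = trans (*-congʳ (sym (∏ˡ-* _ _ rest))) (trans (sym (∏ˡ-* _ _ rest)) (∏ˡ-cong rest cubes))
    V≈ : V (suc n) ps ≈ (y + - t) * (∏ˡ (λ v → v + - t) rest * ∏ˡ (λ v → v + - y) rest) * Vₙ
    V≈ = trans (alternant-∷ t (y ∷ rest) (range-reachable (suc (double n))))
      (trans (*-congˡ (alternant-∷ y rest (range-reachable (double n))))
        (solve 4 (λ x a b v → x :* a :* (b :* v) := x :* (a :* b) :* v) refl _ _ _ _))
    D₁≈ : D₁ (suc n) ps ≈ (y + - t) * Γ * E₁
    D₁≈ = trans (alternant-∷∷ 0 1 t y rest (triples-reachable 0 1 n) y³≈t³)
      (*-congʳ (*-congʳ (solve 2 (λ t y → :1 :* (y :* :1) :- t :* :1 :* :1 := y :- t) refl t y)))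
    D₂≈ : D₂ (suc n) ps ≈ (y * y + - (t * t)) * Γ * E₂
    D₂≈ = trans (alternant-∷∷ 0 2 t y rest (triples-reachable 0 2 n) y³≈t³)
      (*-congʳ (*-congʳ (solve 2 (λ t y → :1 :* (y :* (y :* :1)) :- t :* (t :* :1) :* :1 := y :* y :- t :* t) refl t y)))

-- The determinant formula by interpolation.

module DeterminantIdentity {c ℓ} (F : Field c ℓ) (ω : Field.Carrier F)
  (ω-root : FieldLemmas.PrimitiveCubeRoot F ω) (char0 : FieldLemmas.CharacteristicZero F) where

  open FieldLemmas F
  open EisensteinSolver F ω ω-root
  open Weights F ω ω-root
  open Transfer F ω ω-root
  open RowExchange F ω ω-root
  open Freezing F ω ω-root
  open Determinants F ω ω-root
  open Alternants F ω ω-root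
  open PolynomialFunctions F ω ω-root
  open Determinant F ω ω-root

  -- (1 - ω)(1 - ω²) = 3, which is nonzero in characteristic zero.
  κ≉0 : κ ≉ 0#
  κ≉0 κ≈0 = char0 2 (trans
    (solve 1 (λ _ → :1 :+ (:1 :+ (:1 :+ :0)) := (:1 :- :ω) :* (:1 :- :ω :* :ω)) refl 0#)
    (trans (*-congʳ κ≈0) (zeroˡ _)))

  DistinctCubes : Carrier → Carrier → Set ℓ
  DistinctCubes u v = pow u 3 ≉ pow v 3

  -- Ensures that all the points v, ω v and ω² v are distinct: the interpolation nodes then are
  -- distinct and the crossing factors are invertible.
  Generic : List Carrier → Set _
  Generic ps = AllPairs DistinctCubes ps × All (_≉ 0#) ps

  All-remove : ∀ {ℓ′} {P : Carrier → Set ℓ′} ps {y qs} → All P (ps ++ y ∷ qs) → All P (ps ++ qs)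
  All-remove []       (_ ∷ h)  = h
  All-remove (_ ∷ ps) (p ∷ h) = p ∷ All-remove ps h

  AllPairs-remove : ∀ {ℓ′} {P : Carrier → Carrier → Set ℓ′} ps {y qs} → AllPairs P (ps ++ y ∷ qs) → AllPairs P (ps ++ qs)
  AllPairs-remove []       (_ ∷ h)  = h
  AllPairs-remove (_ ∷ ps) (p ∷ h) = All-remove ps p ∷ AllPairs-remove ps h

  Generic-remove : ∀ ps {y qs} → Generic (ps ++ y ∷ qs) → Generic (ps ++ qs)
  Generic-remove ps (h , k) = AllPairs-remove ps h , All-remove ps k

  Generic-++ʳ : ∀ ps {qs} → Generic (ps ++ qs) → Generic qs
  Generic-++ʳ []       h              = h
  Generic-++ʳ (_ ∷ ps) (_ ∷ h , _ ∷ k) = Generic-++ʳ ps (h , k)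

  cube-ω : ∀ u → pow (ω * u) 3 ≈ pow u 3
  cube-ω = solve 1 (λ u → :ω :* u :* (:ω :* u :* (:ω :* u :* :1)) := u :* (u :* (u :* :1))) refl

  ω*ω*ω* : ∀ u → ω * ω * (ω * u) ≈ u
  ω*ω*ω* = solve 1 (λ u → :ω :* :ω :* (:ω :* u) := u) refl

  ω*ω*ω*′ : ∀ u → ω * (ω * ω * u) ≈ u
  ω*ω*ω*′ = solve 1 (λ u → :ω :* (:ω :* :ω :* u) := u) refl

  distinct⇒≉ : ∀ {u v} → DistinctCubes u v → u ≉ v
  distinct⇒≉ h u≈v = h (pow-cong 3 u≈v)

  distinct⇒≉ω* : ∀ {u v} → DistinctCubes u v → u ≉ ω * v
  distinct⇒≉ω* h u≈ωv = h (trans (pow-cong 3 u≈ωv) (cube-ω _))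

  distinct-sym : ∀ {u v} → DistinctCubes u v → DistinctCubes v u
  distinct-sym h e = h (sym e)

  nonzero⇒≉ω* : ∀ {u} → u ≉ 0# → u ≉ ω * u
  nonzero⇒≉ω* {u} u≉0 u≈ωu = u≉0 (*-zero-cancelˡ κ≉0 (trans
    (solve 1 (λ u → (:1 :- :ω) :* u := u :- :ω :* u) refl u) (x≈y⇒x-y≈0 u≈ωu)))

  -- For two different points the cubes differ; for a single point u = ω u would give κ u = 0.
  Generic⇒≉ω* : ∀ {ps} → Generic ps → All (λ u → All (λ v → u ≉ ω * v) ps) ps
  Generic⇒≉ω* ([] , []) = []
  Generic⇒≉ω* (_∷_ {u} h hs , n ∷ ns) =
    (nonzero⇒≉ω* n ∷ All.map distinct⇒≉ω* h)
    ∷ All.zipWith (λ { (p , q) → p ∷ q }) (All.map (λ d → distinct⇒≉ω* (distinct-sym d)) h , Generic⇒≉ω* (hs , ns))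

  partition-prefix : ∀ {n d ys} as {bs bs′} →
    (∀ L (σ : Vec Spin n) → δ L * d ≈ 1# → partition d L σ bs ys ≈ partition d L σ bs′ ys) →
    ∀ L (σ : Vec Spin n) → δ L * d ≈ 1# → partition d L σ (as ++ bs) ys ≈ partition d L σ (as ++ bs′) ys
  partition-prefix     []       h L σ unit = h L σ unit
  partition-prefix {n} (x ∷ as) h L σ unit = ∑ᵛ-cong n λ τ → *-congˡ (partition-prefix as h (ω * L) τ (δ-shift-unit ⊞ unit))

  -- Exchanging z with the next b divides by the crossing factor ω b - ω² z, which is zero only for
  -- b = ω z.
  partition-move-last : ∀ {n d} (ys : Vec Carrier n) as z bs → All (λ b → b ≉ ω * z) bs →
    ∀ L (σ : Vec Spin n) → δ L * d ≈ 1# → partition d L σ (as ++ z ∷ bs) ys ≈ partition d L σ ((as ++ bs) ++ z ∷ []) ys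
  partition-move-last {n} {d} ys as z bs h L σ unit = trans
    (partition-prefix as (bubble bs h) L σ unit)
    (reflexive (≡.cong (λ zs → partition d L σ zs ys) (≡.sym (Listₚ.++-assoc as bs (z ∷ [])))))
    where
    bubble : ∀ bs → All (λ b → b ≉ ω * z) bs →
      ∀ L (σ : Vec Spin n) → δ L * d ≈ 1# → partition d L σ (z ∷ bs) ys ≈ partition d L σ (bs ++ z ∷ []) ys
    bubble []       []       L σ unit = refl
    bubble (b ∷ bs) (b≉ ∷ h) L σ unit = trans
      (partition-swap σ z b bs ys unit λ e → b≉ (trans (sym (ω*ω*ω* b))
        (trans (*-congˡ (x-y≈0⇒x≈y e)) (solve 1 (λ z → :ω :* :ω :* (:ω :* :ω :* z) := :ω :* z) refl z))))
      (∑ᵛ-cong n λ τ → *-congˡ (bubble bs h (ω * L) τ (δ-shift-unit ⊞ unit)))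

  -- `defect-induct` has `t` at the head of the points. Bringing it there multiplies all three
  -- alternants by one sign `s`, which the defect passes to the outside.
  defect-at : ∀ {n} d L L′ as t bs y t′ (ys : Vec Carrier n) →
    (∀ v → (v + - t) * (v + - y) * (v + - t′) ≈ pow v 3 + - pow t 3) → pow y 3 ≈ pow t 3 →
    ω * t * (y + - t) * L′ ≈ - (L * (y * y + - (t * t))) →
    ω * t * (y + - t) * (L′ * L′) ≈ ω * ω * (L * L) * y * (y + - t) →
    numerator d L (as ++ t ∷ bs) (y ∷ ys)
      ≈ κ * (ω * t) * (pow (- (ω * ω)) n * ∏ˡ (λ v → v + - t′) (toList ys ++ as ++ bs)) * numerator d L′ (as ++ bs) ys →
    defectAt d L′ (as ++ bs) ys (toList ys ++ as ++ bs) ≈ 0# →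
    defectAt d L (as ++ t ∷ bs) (y ∷ ys) (y ∷ toList ys ++ as ++ t ∷ bs) ≈ 0#
  defect-at {n} d L L′ as t bs y t′ ys cubes y³≈t³ hyp₁ hyp₂ N≈ IH = begin
    defectAt d L (as ++ t ∷ bs) (y ∷ ys) (y ∷ toList ys ++ as ++ t ∷ bs)
      ≈⟨ defect-cong (suc n) L refl (∏ˡ-shift (λ z → z) as t bs) (move (range (double (suc n))))
           (move (triples 0 1 (suc n))) (move (triples 0 2 (suc n))) ⟩
    defect (suc n) L N (t * product (as ++ bs)) (y * product (toList ys))
      (s * V (suc n) ps) (s * D₁ (suc n) ps) (s * D₂ (suc n) ps)
      ≈⟨ defect-* (suc n) L _ _ _ _ _ _ s ⟩
    s * defect (suc n) L N (t * product (as ++ bs)) (y * product (toList ys)) (V (suc n) ps) (D₁ (suc n) ps) (D₂ (suc n) ps)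
      ≈⟨ *-congˡ (defect-induct d L L′ t y t′ (as ++ bs) ys cubes y³≈t³ hyp₁ hyp₂ N≈ IH) ⟩
    s * 0#
      ≈⟨ zeroʳ s ⟩
    0# ∎
    where
    N = numerator d L (as ++ t ∷ bs) (y ∷ ys)
    ps = t ∷ y ∷ toList ys ++ as ++ bs
    qs = y ∷ toList ys ++ as
    s = alternate (length qs) 1#
    move : ∀ ks → alternant ks (y ∷ toList ys ++ as ++ t ∷ bs) ≈ s * alternant ks ps
    move ks = begin
      alternant ks (y ∷ toList ys ++ as ++ t ∷ bs)   ≡⟨ ≡.cong (λ zs → alternant ks (y ∷ zs)) (≡.sym (Listₚ.++-assoc (toList ys) as (t ∷ bs))) ⟩
      alternant ks (qs ++ t ∷ bs)                    ≈⟨ det-shift monomial qs t bs ks ⟩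
      alternate (length qs) (alternant ks (t ∷ qs ++ bs))  ≈⟨ alternate≈* (length qs) _ ⟩
      s * alternant ks (t ∷ qs ++ bs)                ≡⟨ ≡.cong (λ zs → s * alternant ks (t ∷ y ∷ zs)) (Listₚ.++-assoc (toList ys) as bs) ⟩
      s * alternant ks ps                            ∎

  -- Symmetry brings `t` to the last row, which freezes. The prefactors for size n + 1 at level `L`
  -- coincide with those for size n at level ω L.
  numerator-ω : ∀ {n d L} as t bs (ys : Vec Carrier n) → δ L * d ≈ 1# → length (as ++ bs) ≡ n → All (λ b → b ≉ ω * t) bs →
    numerator d L (as ++ t ∷ bs) (ω * t ∷ ys)
    ≈ κ * (ω * t) * (pow (- (ω * ω)) n * ∏ˡ (λ v → v + - (ω * ω * t)) (toList ys ++ as ++ bs)) * numerator d (ω * L) (as ++ bs) ys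
  numerator-ω {n} {d} {L} as t bs ys unit ≡.refl h = begin
    f (w * L) * f (ω * w * L) * partition d L ⊞ⁿ (as ++ t ∷ bs) (ω * t ∷ ys)
      ≈⟨ *-cong (*-cong (f-cong (sh w′)) (f-cong (sh w)))
                (trans (partition-move-last (ω * t ∷ ys) as t bs h L ⊞ⁿ unit) (freeze-last ⊞ⁿ (as ++ bs) t ys unit)) ⟩
    f (w′ * (ω * L)) * f (w * (ω * L)) * (κ * (ω * t) * ∏ˡ (λ z → ω * t + - (ω * ω * z)) zs * B * Z′)
      ≈⟨ *-congˡ (*-congʳ (*-congʳ (*-congˡ (∏ˡ-scale (- (ω * ω)) zs λ z →
           solve 2 (λ t z → :ω :* t :- :ω :* :ω :* z := :- (:ω :* :ω) :* (z :- :ω :* :ω :* t)) refl t z)))) ⟩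
    f (w′ * (ω * L)) * f (w * (ω * L)) * (κ * (ω * t) * (q * A) * B * Z′)
      ≈⟨ solve 7 (λ g h k q A B Z → g :* h :* (k :* (q :* A) :* B :* Z) := k :* (q :* (B :* A)) :* (g :* h :* Z)) refl _ _ _ _ _ _ _ ⟩
    κ * (ω * t) * (q * (B * A)) * (f (w′ * (ω * L)) * f (w * (ω * L)) * Z′)
      ≈⟨ *-congʳ (*-congˡ (*-congˡ (sym (∏ˡ-++ _ (toList ys) zs)))) ⟩
    κ * (ω * t) * (q * ∏ˡ (λ v → v + - (ω * ω * t)) (toList ys ++ zs)) * numerator d (ω * L) zs ys ∎
    where
    zs = as ++ bs
    w′ = pow ω (suc n)
    w = pow ω (suc (suc n))
    q = pow (- (ω * ω)) n
    A = ∏ˡ (λ v → v + - (ω * ω * t)) zs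
    B = ∏ˡ (λ v → v + - (ω * ω * t)) (toList ys)
    Z′ = partition d (ω * L) ⊞ⁿ zs ys
    sh : ∀ w → ω * w * L ≈ w * (ω * L)
    sh w = solve 3 (λ v w L → v :* w :* L := w :* (v :* L)) refl ω w L

  -- By ω³ = 1 the prefactor f (ωⁿ⁺³ L) is f (ωⁿ L), which `freeze-first` exchanges for f (ωⁿ⁺¹ L);
  -- this leaves the prefactors for size n at the same level.
  numerator-ω² : ∀ {n d L} t zs (ys : Vec Carrier n) → δ L * d ≈ 1# → length zs ≡ n →
    numerator d L (t ∷ zs) (ω * ω * t ∷ ys)
    ≈ κ * (ω * t) * (pow (- (ω * ω)) n * ∏ˡ (λ v → v + - (ω * t)) (toList ys ++ zs)) * numerator d L zs ys
  numerator-ω² {n} {d} {L} t zs ys unit ≡.refl = begin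
    f (w * L) * f (ω * w * L) * Z₁
      ≈⟨ trans (*-congʳ (*-congˡ (f-cong (solve 2 (λ w L → :ω :* (:ω :* (:ω :* w)) :* L := w :* L) refl (pow ω n) L)))) (*-assoc _ _ _) ⟩
    f (w * L) * (f (pow ω n * L) * Z₁)
      ≈⟨ *-congˡ (freeze-first n t zs ys ≡.refl unit) ⟩
    f (w * L) * (κ * (ω * t) * ∏ˡ (λ z → ω * (ω * ω * t + - (ω * z))) zs * B * (f (pow ω (suc n) * L) * Z′))
      ≈⟨ *-congˡ (*-congʳ (*-congʳ (*-congˡ (∏ˡ-scale (- (ω * ω)) zs λ z →
           solve 2 (λ t z → :ω :* (:ω :* :ω :* t :- :ω :* z) := :- (:ω :* :ω) :* (z :- :ω :* t)) refl t z)))) ⟩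
    f (w * L) * (κ * (ω * t) * (q * A) * B * (f (pow ω (suc n) * L) * Z′))
      ≈⟨ solve 7 (λ g h k q A B Z → g :* (k :* (q :* A) :* B :* (h :* Z)) := k :* (q :* (B :* A)) :* (h :* g :* Z)) refl _ _ _ _ _ _ _ ⟩
    κ * (ω * t) * (q * (B * A)) * (f (pow ω (suc n) * L) * f (w * L) * Z′)
      ≈⟨ *-congʳ (*-congˡ (*-congˡ (sym (∏ˡ-++ _ (toList ys) zs)))) ⟩
    κ * (ω * t) * (q * ∏ˡ (λ v → v + - (ω * t)) (toList ys ++ zs)) * numerator d L zs ys ∎
    where
    w = pow ω (suc (suc n))
    q = pow (- (ω * ω)) n
    A = ∏ˡ (λ v → v + - (ω * t)) zs
    B = ∏ˡ (λ v → v + - (ω * t)) (toList ys)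
    Z₁ = partition d L ⊞ⁿ (t ∷ zs) (ω * ω * t ∷ ys)
    Z′ = partition d L ⊞ⁿ zs ys

  -- With n + 1 rows and largest Vandermonde exponent 2n + 1, the first product has degree at most
  -- 3n + 2. The largest exponents are 3n + 1 in D₁ and 3n + 2 in D₂, and ∏y adds one to that of D₁.
  Poly-defectAt : ∀ {n} d L zs (ys : Vec Carrier n) → length zs ≡ suc n →
    Poly (n ℕ.* 3 ℕ.+ 2) (λ y → defectAt d L zs (y ∷ ys) (y ∷ toList ys ++ zs))
  Poly-defectAt {n} d L zs ys e = Poly-+
    (Poly-≤ (ℕₚ.≤-reflexive degree)
      (Poly-mul (Poly-* _ (Poly-partition ⊞ⁿ zs ys)) (Poly-alternant (range (double (suc n))) (toList ys ++ zs) (All.map ℕ.s≤s⁻¹ (range-bounded (double (suc n)))))))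
    (Poly-‿- (Poly-* (scalar (suc n)) (Poly-+
      (Poly-+ (Poly-≤ 1≤2 (Poly-* _ D₁-poly)) (Poly-* _ (Poly-alternant (triples 0 2 (suc n)) (toList ys ++ zs) (triples-bounded n ℕ.z≤n))))
      (Poly-≤ (ℕₚ.≤-reflexive (≡.sym (ℕₚ.+-suc (n ℕ.* 3) 1)))
        (Poly-mul (Poly-* (pow ω (suc n) * pow ω (suc n) * (L * L)) (Poly-ext (λ y → *-comm y _) (Poly-* (product (toList ys)) Poly-id))) D₁-poly)))))
    where
    1≤2 : n ℕ.* 3 ℕ.+ 1 ℕ.≤ n ℕ.* 3 ℕ.+ 2
    1≤2 = ℕₚ.+-monoʳ-≤ (n ℕ.* 3) (ℕ.s≤s ℕ.z≤n)
    D₁-poly = Poly-alternant (triples 0 1 (suc n)) (toList ys ++ zs) (triples-bounded n ℕ.z≤n)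
    degree : length zs ℕ.+ suc (double n) ≡ n ℕ.* 3 ℕ.+ 2
    degree = ≡.trans (≡.cong₂ (λ a b → a ℕ.+ suc b) e (double≡ n))
      (ℕS.solve 1 (λ n → ℕS.con 1 ℕS.:+ n ℕS.:+ (ℕS.con 1 ℕS.:+ (n ℕS.:+ n)) ℕS.:= n ℕS.:* ℕS.con 3 ℕS.:+ ℕS.con 2) ≡.refl n)

  defect-repeated : ∀ {n} d L zs (ys : Vec Carrier n) {y ps} → y ∈ ps → defectAt d L zs ys (y ∷ ps) ≈ 0#
  defect-repeated {n} d L zs ys {y} {ps} y∈ps = begin
    defectAt d L zs ys (y ∷ ps)
      ≈⟨ defect-cong n L refl refl (vanish (range (double n))) (vanish (triples 0 1 n)) (vanish (triples 0 2 n)) ⟩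
    defect n L (numerator d L zs ys) (product zs) (product (toList ys)) (0# * 0#) (0# * 0#) (0# * 0#)
      ≈⟨ defect-* n L (numerator d L zs ys) (product zs) (product (toList ys)) 0# 0# 0# 0# ⟩
    0# * defect n L (numerator d L zs ys) (product zs) (product (toList ys)) 0# 0# 0#
      ≈⟨ zeroˡ _ ⟩
    0# ∎
    where
    vanish : ∀ ks → alternant ks (y ∷ ps) ≈ 0# * 0#
    vanish ks = trans (det-member monomial ks y∈ps) (sym (zeroˡ 0#))

  -- As a polynomial in the first of the ys of degree 3 n − 1, the defect has 3 n zeros.
  determinant-identity : ∀ n {d L} zs (ys : Vec Carrier n) → δ L * d ≈ 1# → length zs ≡ n →
    Generic (toList ys ++ zs) → defectAt d L zs ys (toList ys ++ zs) ≈ 0#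
  -- For size 0 the formula is (1 - ωL)(1 - ω²L) = 1 + L + L².
  determinant-identity zero {L = L} [] [] unit _ _ = solve 1 (λ L →
    (:1 :- :ω :* :1 :* L) :* (:1 :- :ω :* (:ω :* :1) :* L) :* :1 :* :1
      :- :1 :* (:1 :* :1 :* :1 :+ :1 :* L :* :1 :+ :1 :* :1 :* (L :* L) :* :1 :* :1) := :0) refl L
  determinant-identity (suc n) {d} {L} zs@(z₁ ∷ zs₁) (y ∷ ys) unit e generic =
    Poly-vanishes roots (Poly-defectAt d L zs ys e) enough distinct zeros y
    where
    rest = toList ys ++ zs
    -- These are (2n + 1) + (n + 1) + 1 = 3n + 3 nodes, one more than the degree bound. A single
    -- node ω² z₁ suffices, and `z₁` already stands in the first row.
    roots = rest ++ map (ω *_) zs ++ ω * ω * z₁ ∷ []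
    generic′ : Generic rest
    generic′ = Generic-remove [] generic
    generic-zs : Generic zs
    generic-zs = Generic-++ʳ (toList ys) generic′
    e₁ = ℕₚ.suc-injective e

    enough : n ℕ.* 3 ℕ.+ 2 ℕ.< length roots
    enough = ℕₚ.≤-reflexive (≡.sym (≡.trans (Listₚ.length-++ rest)
      (≡.trans (≡.cong₂ ℕ._+_ (≡.trans (Listₚ.length-++ (toList ys)) (≡.cong₂ ℕ._+_ (Vecₚ.length-toList ys) e))
        (≡.trans (Listₚ.length-++ (map (ω *_) zs)) (≡.cong (ℕ._+ 1) (≡.trans (Listₚ.length-map (ω *_) zs) e))))
        (ℕS.solve 1 (λ n → n ℕS.:+ (ℕS.con 1 ℕS.:+ n) ℕS.:+ (ℕS.con 1 ℕS.:+ n ℕS.:+ ℕS.con 1)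
           ℕS.:= ℕS.con 1 ℕS.:+ (n ℕS.:* ℕS.con 3 ℕS.:+ ℕS.con 2)) ≡.refl n))))

    distinct : AllPairs _≉_ roots
    distinct = AllPairsₚ.++⁺ (AllPairs.map distinct⇒≉ (proj₁ generic′))
      (AllPairsₚ.++⁺ (AllPairsₚ.map⁺ (AllPairs.map (λ h q → distinct⇒≉ h (cancel q)) (proj₁ generic-zs))) ([] ∷ [])
        (Allₚ.map⁺ (All.map (λ h → (λ q → All.head h (trans (sym (ω*ω*ω* _)) (trans (*-congˡ q) (solve 1 (λ z → :ω :* :ω :* (:ω :* :ω :* z) := :ω :* z) refl z₁)))) ∷ []) (Generic⇒≉ω* generic-zs))))
      (All.tabulate λ {u} u∈rest → Allₚ.++⁺
        (Allₚ.map⁺ (All.tabulate λ {v} v∈zs → All.lookup (All.lookup (Generic⇒≉ω* generic′) u∈rest) (∈-++⁺ʳ (toList ys) v∈zs)))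
        ((λ q → All.lookup (All.lookup (Generic⇒≉ω* generic′) (∈-++⁺ʳ (toList ys) (here ≡.refl))) u∈rest
            (trans (sym (ω*ω*ω*′ z₁)) (*-congˡ (sym q)))) ∷ []))
      where
      cancel : ∀ {u v} → ω * u ≈ ω * v → u ≈ v
      cancel q = trans (sym (ω*ω*ω* _)) (trans (*-congˡ q) (ω*ω*ω* _))

    zero-at-ω : ∀ {z} → z ∈ zs → defectAt d L zs (ω * z ∷ ys) (ω * z ∷ rest) ≈ 0#
    zero-at-ω {z} z∈zs with as , bs , eq ← ∈-∃++ z∈zs =
      ≡.subst (λ zs → defectAt d L zs (ω * z ∷ ys) (ω * z ∷ toList ys ++ zs) ≈ 0#) (≡.sym eq)
        (defect-at d L (ω * L) as z bs (ω * z) (ω * ω * z) ys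
          (λ v → solve 2 (λ z v → (v :- z) :* (v :- :ω :* z) :* (v :- :ω :* :ω :* z) := v :* (v :* (v :* :1)) :- z :* (z :* (z :* :1))) refl z v)
          (cube-ω z)
          (solve 2 (λ z L → :ω :* z :* (:ω :* z :- z) :* (:ω :* L) := :- (L :* (:ω :* z :* (:ω :* z) :- z :* z))) refl z L)
          (solve 2 (λ z L → :ω :* z :* (:ω :* z :- z) :* (:ω :* L :* (:ω :* L)) := :ω :* :ω :* (L :* L) :* (:ω :* z) :* (:ω :* z :- z)) refl z L)
          (numerator-ω as z bs ys unit (≡.trans (Listₚ.length-++ as) len) (Allₚ.++⁻ʳ as all-bs))
          (determinant-identity n (as ++ bs) ys (δ-shift-unit ⊞ unit) (≡.trans (Listₚ.length-++ as) len)
            (≡.subst Generic (Listₚ.++-assoc (toList ys) as bs) (Generic-remove (toList ys ++ as)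
              (≡.subst Generic (≡.trans (≡.cong (toList ys ++_) eq) (≡.sym (Listₚ.++-assoc (toList ys) as (z ∷ bs)))) generic′)))))
      where
      len : length as ℕ.+ length bs ≡ n
      len = ℕₚ.suc-injective (≡.trans (≡.sym (ℕₚ.+-suc (length as) (length bs)))
        (≡.trans (≡.sym (Listₚ.length-++ as)) (≡.trans (≡.sym (≡.cong length eq)) e)))
      all-bs : All (λ b → b ≉ ω * z) (as ++ bs)
      all-bs = All-remove as (≡.subst (All (λ b → b ≉ ω * z)) eq (All.map (λ h → All.lookup h z∈zs) (Generic⇒≉ω* generic-zs)))

    zero-at-ω² : defectAt d L zs (ω * ω * z₁ ∷ ys) (ω * ω * z₁ ∷ rest) ≈ 0#
    zero-at-ω² = defect-at d L L [] z₁ zs₁ (ω * ω * z₁) (ω * z₁) ys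
      (λ v → solve 2 (λ z v → (v :- z) :* (v :- :ω :* :ω :* z) :* (v :- :ω :* z) := v :* (v :* (v :* :1)) :- z :* (z :* (z :* :1))) refl z₁ v)
      (solve 1 (λ z → :ω :* :ω :* z :* (:ω :* :ω :* z :* (:ω :* :ω :* z :* :1)) := z :* (z :* (z :* :1))) refl z₁)
      (solve 2 (λ z L → :ω :* z :* (:ω :* :ω :* z :- z) :* L := :- (L :* (:ω :* :ω :* z :* (:ω :* :ω :* z) :- z :* z))) refl z₁ L)
      (solve 2 (λ z L → :ω :* z :* (:ω :* :ω :* z :- z) :* (L :* L) := :ω :* :ω :* (L :* L) :* (:ω :* :ω :* z) :* (:ω :* :ω :* z :- z)) refl z₁ L)
      (numerator-ω² z₁ zs₁ ys unit e₁)
      (determinant-identity n zs₁ ys unit e₁ (Generic-remove (toList ys) generic′))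

    zeros : All (λ y → defectAt d L zs (y ∷ ys) (y ∷ rest) ≈ 0#) roots
    zeros = Allₚ.++⁺ (All.tabulate λ {y} y∈ → defect-repeated d L zs (y ∷ ys) y∈)
      (Allₚ.++⁺ (Allₚ.map⁺ (All.tabulate zero-at-ω)) (zero-at-ω² ∷ []))

-- Factorial products behind the enumeration formulas.

module FactorialProducts where

  open import Data.Nat using (_+_; _*_; _^_)
  open import Data.Nat.Properties
  open import Relation.Binary.PropositionalEquality
  open ℕS using (solve; con; _:+_; _:*_; _:=_)
  open ≡-Reasoning

  ∏ℕ : ℕ → (ℕ → ℕ) → ℕ
  ∏ℕ zero    g = 1
  ∏ℕ (suc n) g = g 0 * ∏ℕ n (g ∘ suc)

  ∏ℕ-last : ∀ n g → ∏ℕ (suc n) g ≡ ∏ℕ n g * g n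
  ∏ℕ-last zero    g = *-comm (g 0) 1
  ∏ℕ-last (suc n) g = trans (cong (g 0 *_) (∏ℕ-last n (g ∘ suc))) (sym (*-assoc (g 0) _ _))

  ∏ℕ-cong : ∀ n {g h} → (∀ k → g k ≡ h k) → ∏ℕ n g ≡ ∏ℕ n h
  ∏ℕ-cong zero    p = refl
  ∏ℕ-cong (suc n) p = cong₂ _*_ (p 0) (∏ℕ-cong n (p ∘ suc))

  ∏ℕ-! : ∀ n → ∏ℕ n suc ≡ n !
  ∏ℕ-! zero    = refl
  ∏ℕ-! (suc n) = trans (∏ℕ-last n suc) (trans (*-comm _ (suc n)) (cong (suc n *_) (∏ℕ-! n)))

  ∏ℕ-nonZero : ∀ n g → (∀ k → NonZero (g k)) → NonZero (∏ℕ n g)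
  ∏ℕ-nonZero zero    g h = _
  ∏ℕ-nonZero (suc n) g h = m*n≢0 (g 0) _ {{h 0}} {{∏ℕ-nonZero n (g ∘ suc) (h ∘ suc)}}

  -- 3^(n choose 2), the power of 3 by which the ratios of Vandermonde products differ from Aₙ and
  -- Cₙ.
  threes : ℕ → ℕ
  threes zero    = 1
  threes (suc n) = 3 ^ n * threes n

  -- The index is k = j - 1. Cₙ counts the cyclically symmetric plane partitions in an n-cube, hence
  -- `csp`.
  asmNumerator cspNumerator commonDenominator : ℕ → ℕ
  asmNumerator n = ∏ℕ n λ k → (1 + k * 3) !
  cspNumerator n = ∏ℕ n λ k → (2 + k * 3) * (k * 3) !
  commonDenominator n = ∏ℕ n λ k → (n + k) !

  -- The factor n! extends (n+1)! ⋯ (2n+1)! downwards to n! ⋯ (2n+1)!, which has two more factors at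
  -- the top than n! ⋯ (2n-1)!.
  commonDenominator-suc : ∀ n → n ! * commonDenominator (suc n) ≡ commonDenominator n * ((n + n) ! * (suc (n + n)) !)
  commonDenominator-suc n = begin
    n ! * ∏ℕ (suc n) (λ k → (suc n + k) !)
      ≡⟨ cong₂ _*_ (cong _! (sym (+-identityʳ n))) (∏ℕ-cong (suc n) λ k → cong _! (sym (+-suc n k))) ⟩
    ∏ℕ (suc (suc n)) (λ k → (n + k) !)
      ≡⟨ ∏ℕ-last (suc n) (λ k → (n + k) !) ⟩
    ∏ℕ (suc n) (λ k → (n + k) !) * (n + suc n) !
      ≡⟨ cong₂ _*_ (∏ℕ-last n (λ k → (n + k) !)) (cong _! (+-suc n n)) ⟩
    commonDenominator n * (n + n) ! * (suc (n + n)) !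
      ≡⟨ *-assoc (commonDenominator n) _ _ ⟩
    commonDenominator n * ((n + n) ! * (suc (n + n)) !) ∎

  -- The Vandermonde products ∏ (k′ − k) over k < k′ in {0, …, 2n − 1},
  -- {0, 1, 3, 4, …, 3n − 3, 3n − 2} and {0, 2, 3, 5, …, 3n − 3, 3n − 1}.
  vandermonde₀ vandermonde₁ vandermonde₂ : ℕ → ℕ
  vandermonde₀ zero    = 1
  vandermonde₀ (suc n) = (suc (n + n)) ! * (n + n) ! * vandermonde₀ n
  vandermonde₁ zero    = 1
  vandermonde₁ (suc n) = (1 + n * 3) ! * (3 ^ n * n !) * vandermonde₁ n
  vandermonde₂ zero    = 1
  vandermonde₂ (suc n) = (2 + n * 3) * (n * 3) ! * (3 ^ n * n !) * vandermonde₂ n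

  private
    -- The common induction step: `x` is the new factor of the numerator, and 3ⁿ n! is the other
    -- factor gained by the Vandermonde product.
    ratio-suc : ∀ n v x num → v * commonDenominator n ≡ threes n * num * vandermonde₀ n →
      x * (3 ^ n * n !) * v * commonDenominator (suc n) ≡ threes (suc n) * (num * x) * vandermonde₀ (suc n)
    ratio-suc n v x num IH = begin
      x * (3 ^ n * n !) * v * commonDenominator (suc n)
        ≡⟨ solve 5 (λ x t p v d → x :* (t :* p) :* v :* d := x :* t :* v :* (p :* d)) refl x (3 ^ n) (n !) v _ ⟩
      x * 3 ^ n * v * (n ! * commonDenominator (suc n))
        ≡⟨ cong (x * 3 ^ n * v *_) (commonDenominator-suc n) ⟩
      x * 3 ^ n * v * (commonDenominator n * ((n + n) ! * (suc (n + n)) !))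
        ≡⟨ solve 6 (λ x t v d p q → x :* t :* v :* (d :* (p :* q)) := x :* t :* (q :* p) :* (v :* d)) refl x (3 ^ n) v _ ((n + n) !) ((suc (n + n)) !) ⟩
      x * 3 ^ n * ((suc (n + n)) ! * (n + n) !) * (v * commonDenominator n)
        ≡⟨ cong (x * 3 ^ n * ((suc (n + n)) ! * (n + n) !) *_) IH ⟩
      x * 3 ^ n * ((suc (n + n)) ! * (n + n) !) * (threes n * num * vandermonde₀ n)
        ≡⟨ solve 6 (λ x t p s u w → x :* t :* p :* (s :* u :* w) := t :* s :* (u :* x) :* (p :* w)) refl x (3 ^ n) ((suc (n + n)) ! * (n + n) !) (threes n) num (vandermonde₀ n) ⟩
      threes (suc n) * (num * x) * vandermonde₀ (suc n) ∎

  vandermonde₁-ratio : ∀ n → vandermonde₁ n * commonDenominator n ≡ threes n * asmNumerator n * vandermonde₀ n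
  vandermonde₁-ratio zero    = refl
  vandermonde₁-ratio (suc n) = trans
    (ratio-suc n (vandermonde₁ n) ((1 + n * 3) !) (asmNumerator n) (vandermonde₁-ratio n))
    (cong (λ m → threes (suc n) * m * vandermonde₀ (suc n)) (sym (∏ℕ-last n (λ k → (1 + k * 3) !))))

  vandermonde₂-ratio : ∀ n → vandermonde₂ n * commonDenominator n ≡ threes n * cspNumerator n * vandermonde₀ n
  vandermonde₂-ratio zero    = refl
  vandermonde₂-ratio (suc n) = trans
    (ratio-suc n (vandermonde₂ n) ((2 + n * 3) * (n * 3) !) (cspNumerator n) (vandermonde₂-ratio n))
    (cong (λ m → threes (suc n) * m * vandermonde₀ (suc n)) (sym (∏ℕ-last n (λ k → (2 + k * 3) * (k * 3) !))))

  -- The differences of the exponents 3k + 3 and 3k + 4 to 0 and to 1; in the second case, of 3k + 3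
  -- and 3k + 5 to 0 and to 2.
  differences₁ differences₂ : ℕ → ℕ
  differences₁ k = (3 + k * 3) * (4 + k * 3) * ((2 + k * 3) * (3 + k * 3))
  differences₂ k = (3 + k * 3) * (5 + k * 3) * ((1 + k * 3) * (3 + k * 3))

  ∏-differences₁ : ∀ n → ∏ℕ n differences₁ ≡ (1 + n * 3) ! * (3 ^ n * n !)
  ∏-differences₁ zero    = refl
  ∏-differences₁ (suc n) = trans (∏ℕ-last n differences₁) (trans (cong (_* differences₁ n) (∏-differences₁ n))
    (solve 4 (λ n p t q → (con 1 :+ n :* con 3) :* p :* (t :* q)
        :* ((con 3 :+ n :* con 3) :* (con 4 :+ n :* con 3) :* ((con 2 :+ n :* con 3) :* (con 3 :+ n :* con 3)))
      := (con 4 :+ n :* con 3) :* ((con 3 :+ n :* con 3) :* ((con 2 :+ n :* con 3) :* ((con 1 :+ n :* con 3) :* p)))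
        :* (con 3 :* t :* ((con 1 :+ n) :* q))) refl n ((n * 3) !) (3 ^ n) (n !)))

  -- The extra 2 is the difference of the first two exponents 0 and 2.
  ∏-differences₂ : ∀ n → 2 * ∏ℕ n differences₂ ≡ (2 + n * 3) * (n * 3) ! * (3 ^ n * n !)
  ∏-differences₂ zero    = refl
  ∏-differences₂ (suc n) = trans (cong (2 *_) (∏ℕ-last n differences₂)) (trans (sym (*-assoc 2 (∏ℕ n differences₂) (differences₂ n))) (trans (cong (_* differences₂ n) (∏-differences₂ n))
    (solve 4 (λ n p t q → (con 2 :+ n :* con 3) :* p :* (t :* q)
        :* ((con 3 :+ n :* con 3) :* (con 5 :+ n :* con 3) :* ((con 1 :+ n :* con 3) :* (con 3 :+ n :* con 3)))
      := (con 5 :+ n :* con 3) :* ((con 3 :+ n :* con 3) :* ((con 2 :+ n :* con 3) :* ((con 1 :+ n :* con 3) :* p)))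
        :* (con 3 :* t :* ((con 1 :+ n) :* q))) refl n ((n * 3) !) (3 ^ n) (n !))))

-- Vandermonde products of the exponents in terms of Aₙ and Cₙ.

module Enumeration {c ℓ} (F : Field c ℓ) (ω : Field.Carrier F)
  (ω-root : FieldLemmas.PrimitiveCubeRoot F ω) (char0 : FieldLemmas.CharacteristicZero F) where

  open FieldLemmas F
  open EisensteinSolver F ω ω-root
  open Determinants F ω ω-root
  open Alternants F ω ω-root
  open Determinant F ω ω-root using (double; double≡)
  open FactorialProducts

  fromℕ′-≉0 : ∀ m → NonZero m → fromℕ′ m ≉ 0#
  fromℕ′-≉0 (suc m) _ = char0 m

  pairs : ℕ → ℕ
  pairs zero    = zero
  pairs (suc n) = n ℕ.+ pairs n

  -- A Vandermonde product depends only on differences. The hypothesis in this form covers both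
  -- translations of the exponents and the extraction of powers of q - 1.
  vandermonde-scale : ∀ s (g h : ℕ → Carrier) ks → (∀ j k → g k + - g j ≈ s * (h k + - h j)) →
    vandermonde (map g ks) ≈ pow s (pairs (length ks)) * vandermonde (map h ks)
  vandermonde-scale s g h []       p = sym (*-identityˡ 1#)
  vandermonde-scale s g h (j ∷ ks) p = begin
    ∏ˡ (λ w → w + - g j) (map g ks) * vandermonde (map g ks)
      ≈⟨ *-cong (factors ks) (vandermonde-scale s g h ks p) ⟩
    pow s n * ∏ˡ (λ w → w + - h j) (map h ks) * (pow s (pairs n) * vandermonde (map h ks))
      ≈⟨ solve 4 (λ a p b v → a :* p :* (b :* v) := a :* b :* (p :* v)) refl _ _ _ _ ⟩
    pow s n * pow s (pairs n) * (∏ˡ (λ w → w + - h j) (map h ks) * vandermonde (map h ks))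
      ≈⟨ *-congʳ (sym (pow-+ s n (pairs n))) ⟩
    pow s (n ℕ.+ pairs n) * (∏ˡ (λ w → w + - h j) (map h ks) * vandermonde (map h ks)) ∎
    where
    n = length ks
    factors : ∀ ks → ∏ˡ (λ w → w + - g j) (map g ks) ≈ pow s (length ks) * ∏ˡ (λ w → w + - h j) (map h ks)
    factors []       = sym (*-identityˡ 1#)
    factors (k ∷ ks) = trans (*-cong (p j k) (factors ks))
      (solve 4 (λ s x p q → s :* x :* (p :* q) := s :* p :* (x :* q)) refl _ _ _ _)

  pow-1 : ∀ n → pow 1# n ≈ 1#
  pow-1 zero    = refl
  pow-1 (suc n) = trans (*-identityˡ _) (pow-1 n)

  vandermonde-cong : ∀ (g h : ℕ → Carrier) ks → (∀ j k → g k + - g j ≈ h k + - h j) →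
    vandermonde (map g ks) ≈ vandermonde (map h ks)
  vandermonde-cong g h ks p = trans
    (vandermonde-scale 1# g h ks (λ j k → trans (p j k) (sym (*-identityˡ _))))
    (trans (*-congʳ (pow-1 (pairs (length ks)))) (*-identityˡ _))

  vandermondeℕ : List ℕ → Carrier
  vandermondeℕ ks = vandermonde (map fromℕ′ ks)

  ∏ᵏ : (ℕ → ℕ) → List ℕ → ℕ
  ∏ᵏ g []       = 1
  ∏ᵏ g (k ∷ ks) = g k ℕ.* ∏ᵏ g ks

  ∏ᵏ-map : ∀ g h ks → ∏ᵏ g (map h ks) ≡ ∏ᵏ (g ∘ h) ks
  ∏ᵏ-map g h []       = ≡.refl
  ∏ᵏ-map g h (k ∷ ks) = ≡.cong (g (h k) ℕ.*_) (∏ᵏ-map g h ks)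

  ∏ᵏ-* : ∀ g h ks → ∏ᵏ g ks ℕ.* ∏ᵏ h ks ≡ ∏ᵏ (λ k → g k ℕ.* h k) ks
  ∏ᵏ-* g h []       = ≡.refl
  ∏ᵏ-* g h (k ∷ ks) = ≡.trans
    (ℕS.solve 4 (λ a b p q → a ℕS.:* p ℕS.:* (b ℕS.:* q) ℕS.:= a ℕS.:* b ℕS.:* (p ℕS.:* q)) ≡.refl (g k) (h k) (∏ᵏ g ks) (∏ᵏ h ks))
    (≡.cong (g k ℕ.* h k ℕ.*_) (∏ᵏ-* g h ks))

  ∏ᵏ-range : ∀ g n → ∏ᵏ g (range n) ≡ ∏ℕ n g
  ∏ᵏ-range g zero    = ≡.refl
  ∏ᵏ-range g (suc n) = ≡.cong (g 0 ℕ.*_) (≡.trans (∏ᵏ-map g suc (range n)) (∏ᵏ-range (g ∘ suc) n))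

  ∏ᵏ-triples : ∀ g j n → ∏ᵏ g (triples 0 j n) ≡ ∏ℕ n (λ m → g (m ℕ.* 3) ℕ.* g (j ℕ.+ m ℕ.* 3))
  ∏ᵏ-triples g j zero    = ≡.refl
  ∏ᵏ-triples g j (suc n) = ≡.trans (≡.sym (ℕₚ.*-assoc (g 0) (g j) _))
    (≡.cong₂ ℕ._*_ (≡.cong (λ i → g 0 ℕ.* g i) (≡.sym (ℕₚ.+-identityʳ j)))
      (≡.trans (∏ᵏ-map g (3 ℕ.+_) (triples 0 j n)) (≡.trans (∏ᵏ-triples (g ∘ (3 ℕ.+_)) j n)
        (∏ℕ-cong n λ m → ≡.cong (λ i → g (3 ℕ.+ m ℕ.* 3) ℕ.* g i)
          (ℕS.solve 2 (λ j m → ℕS.con 3 ℕS.:+ (j ℕS.:+ m ℕS.:* ℕS.con 3) ℕS.:= j ℕS.:+ (ℕS.con 3 ℕS.:+ m ℕS.:* ℕS.con 3)) ≡.refl j m)))))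

  fromℕ′-difference : ∀ i m → fromℕ′ (i ℕ.+ m) + - fromℕ′ i ≈ fromℕ′ m
  fromℕ′-difference i m = trans (+-congʳ (fromℕ′-+ i m)) (solve 2 (λ i m → i :+ m :- i := m) refl _ _)

  ∏ˡ-differences : ∀ i e ks → ∏ˡ (λ w → w + - fromℕ′ i) (map fromℕ′ (map ((i ℕ.+ e) ℕ.+_) ks)) ≈ fromℕ′ (∏ᵏ (e ℕ.+_) ks)
  ∏ˡ-differences i e []       = sym (+-identityʳ 1#)
  ∏ˡ-differences i e (k ∷ ks) = trans
    (*-cong (trans (reflexive (≡.cong (λ m → fromℕ′ m + - fromℕ′ i) (ℕₚ.+-assoc i e k))) (fromℕ′-difference i (e ℕ.+ k)))
            (∏ˡ-differences i e ks))
    (sym (fromℕ′-* (e ℕ.+ k) _))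

  vandermondeℕ-shift : ∀ e ks → vandermondeℕ (map (e ℕ.+_) ks) ≈ vandermondeℕ ks
  vandermondeℕ-shift e ks = trans (reflexive (≡.cong vandermonde (≡.sym (Listₚ.map-∘ ks))))
    (vandermonde-cong (fromℕ′ ∘ (e ℕ.+_)) fromℕ′ ks λ j k → trans
      (+-cong (fromℕ′-+ e k) (-‿cong (fromℕ′-+ e j)))
      (solve 3 (λ e j k → e :+ k :- (e :+ j) := k :- j) refl _ _ _))

  vandermondeℕ-range-suc : ∀ n → vandermondeℕ (range (suc n)) ≈ fromℕ′ (n !) * vandermondeℕ (range n)
  vandermondeℕ-range-suc n = *-cong
    (trans (∏ˡ-differences 0 1 (range n)) (reflexive (≡.cong fromℕ′ (≡.trans (∏ᵏ-range suc n) (∏ℕ-! n)))))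
    (vandermondeℕ-shift 1 (range n))

  vandermondeℕ-range : ∀ n → vandermondeℕ (range (double n)) ≈ fromℕ′ (vandermonde₀ n)
  vandermondeℕ-range zero    = sym (+-identityʳ 1#)
  vandermondeℕ-range (suc n) = begin
    vandermondeℕ (range (suc (suc (double n))))
      ≈⟨ trans (vandermondeℕ-range-suc (suc (double n))) (*-congˡ (vandermondeℕ-range-suc (double n))) ⟩
    fromℕ′ (suc (double n) !) * (fromℕ′ (double n !) * vandermondeℕ (range (double n)))
      ≈⟨ *-congˡ (*-congˡ (vandermondeℕ-range n)) ⟩
    fromℕ′ (suc (double n) !) * (fromℕ′ (double n !) * fromℕ′ (vandermonde₀ n))
      ≡⟨ ≡.cong (λ m → fromℕ′ (suc m !) * (fromℕ′ (m !) * fromℕ′ (vandermonde₀ n))) (double≡ n) ⟩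
    fromℕ′ (suc (n ℕ.+ n) !) * (fromℕ′ ((n ℕ.+ n) !) * fromℕ′ (vandermonde₀ n))
      ≈⟨ trans (sym (*-assoc _ _ _)) (trans (*-congʳ (sym (fromℕ′-* (suc (n ℕ.+ n) !) _))) (sym (fromℕ′-* (suc (n ℕ.+ n) ! ℕ.* (n ℕ.+ n) !) _))) ⟩
    fromℕ′ (vandermonde₀ (suc n)) ∎

  -- Split off the exponents 0 and j. Those remaining are 3 + k, at distance 3 + k from 0 and e + k
  -- from j, and translation by 3 leaves their own product unchanged.
  vandermondeℕ-triples-suc : ∀ j e n → j ℕ.+ e ≡ 3 →
    vandermondeℕ (triples 0 j (suc n))
    ≈ fromℕ′ (j ℕ.* ∏ᵏ (λ k → (3 ℕ.+ k) ℕ.* (e ℕ.+ k)) (triples 0 j n)) * vandermondeℕ (triples 0 j n)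
  vandermondeℕ-triples-suc j e n j+e≡3 = begin
    (fromℕ′ j + - 0#) * ∏ˡ (λ w → w + - 0#) (map fromℕ′ (map (3 ℕ.+_) ks))
      * (∏ˡ (λ w → w + - fromℕ′ j) (map fromℕ′ (map (3 ℕ.+_) ks)) * vandermondeℕ (map (3 ℕ.+_) ks))
      ≈⟨ *-cong (*-cong (fromℕ′-difference 0 j) (∏ˡ-differences 0 3 ks))
                (*-cong (trans (reflexive (≡.cong (λ m → ∏ˡ (λ w → w + - fromℕ′ j) (map fromℕ′ (map (m ℕ.+_) ks))) (≡.sym j+e≡3))) (∏ˡ-differences j e ks))
                        (vandermondeℕ-shift 3 ks)) ⟩
    fromℕ′ j * fromℕ′ (∏ᵏ (3 ℕ.+_) ks) * (fromℕ′ (∏ᵏ (e ℕ.+_) ks) * vandermondeℕ ks)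
      ≈⟨ solve 4 (λ j p q v → j :* p :* (q :* v) := j :* (p :* q) :* v) refl _ _ _ _ ⟩
    fromℕ′ j * (fromℕ′ (∏ᵏ (3 ℕ.+_) ks) * fromℕ′ (∏ᵏ (e ℕ.+_) ks)) * vandermondeℕ ks
      ≈⟨ *-congʳ (trans (*-congˡ (sym (fromℕ′-* (∏ᵏ (3 ℕ.+_) ks) _))) (sym (fromℕ′-* j _))) ⟩
    fromℕ′ (j ℕ.* (∏ᵏ (3 ℕ.+_) ks ℕ.* ∏ᵏ (e ℕ.+_) ks)) * vandermondeℕ ks
      ≡⟨ ≡.cong (λ m → fromℕ′ (j ℕ.* m) * vandermondeℕ ks) (∏ᵏ-* (3 ℕ.+_) (e ℕ.+_) ks) ⟩
    fromℕ′ (j ℕ.* ∏ᵏ (λ k → (3 ℕ.+ k) ℕ.* (e ℕ.+ k)) ks) * vandermondeℕ ks ∎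
    where ks = triples 0 j n

  vandermondeℕ-triples₁ : ∀ n → vandermondeℕ (triples 0 1 n) ≈ fromℕ′ (vandermonde₁ n)
  vandermondeℕ-triples₁ zero    = sym (+-identityʳ 1#)
  vandermondeℕ-triples₁ (suc n) = trans (vandermondeℕ-triples-suc 1 2 n ≡.refl) (trans
    (*-cong (reflexive (≡.cong fromℕ′ (≡.trans (ℕₚ.*-identityˡ _) (≡.trans (∏ᵏ-triples _ 1 n)
      (≡.trans (∏ℕ-cong n λ m → ℕS.solve 4 (λ a b c d → a ℕS.:* b ℕS.:* (c ℕS.:* d) ℕS.:= a ℕS.:* c ℕS.:* (b ℕS.:* d)) ≡.refl
        (3 ℕ.+ m ℕ.* 3) (2 ℕ.+ m ℕ.* 3) (4 ℕ.+ m ℕ.* 3) (3 ℕ.+ m ℕ.* 3)) (∏-differences₁ n)))))) (vandermondeℕ-triples₁ n))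
    (sym (fromℕ′-* ((1 ℕ.+ n ℕ.* 3) ! ℕ.* (3 ℕ.^ n ℕ.* n !)) _)))

  vandermondeℕ-triples₂ : ∀ n → vandermondeℕ (triples 0 2 n) ≈ fromℕ′ (vandermonde₂ n)
  vandermondeℕ-triples₂ zero    = sym (+-identityʳ 1#)
  vandermondeℕ-triples₂ (suc n) = trans (vandermondeℕ-triples-suc 2 1 n ≡.refl) (trans
    (*-cong (reflexive (≡.cong fromℕ′ (≡.trans (≡.cong (2 ℕ.*_) (≡.trans (∏ᵏ-triples _ 2 n)
      (∏ℕ-cong n λ m → ℕS.solve 4 (λ a b c d → a ℕS.:* b ℕS.:* (c ℕS.:* d) ℕS.:= a ℕS.:* c ℕS.:* (b ℕS.:* d)) ≡.refl
        (3 ℕ.+ m ℕ.* 3) (1 ℕ.+ m ℕ.* 3) (5 ℕ.+ m ℕ.* 3) (3 ℕ.+ m ℕ.* 3)))) (∏-differences₂ n)))) (vandermondeℕ-triples₂ n))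
    (sym (fromℕ′-* ((2 ℕ.+ n ℕ.* 3) ℕ.* (n ℕ.* 3) ! ℕ.* (3 ℕ.^ n ℕ.* n !)) _)))

  ∏-quotient : ∀ n (g : Fin n → Carrier) (num den : ℕ → ℕ) → (∀ k → NonZero (den k)) →
    (∀ i → g i ≈ fromℕ′ (num (toℕ i)) / fromℕ′ (den (toℕ i))) → ∏ n g * fromℕ′ (∏ℕ n den) ≈ fromℕ′ (∏ℕ n num)
  ∏-quotient zero    g num den nz p = *-identityˡ _
  ∏-quotient (suc n) g num den nz p = begin
    g zero * ∏ n (g ∘ suc) * fromℕ′ (den 0 ℕ.* ∏ℕ n (den ∘ suc))
      ≈⟨ *-cong (*-congʳ (p zero)) (fromℕ′-* (den 0) _) ⟩
    fromℕ′ (num 0) * fromℕ′ (den 0) ⁻¹ * ∏ n (g ∘ suc) * (fromℕ′ (den 0) * fromℕ′ (∏ℕ n (den ∘ suc)))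
      ≈⟨ solve 5 (λ a i q b e → a :* i :* q :* (b :* e) := a :* (b :* i) :* (q :* e)) refl _ _ _ _ _ ⟩
    fromℕ′ (num 0) * (fromℕ′ (den 0) * fromℕ′ (den 0) ⁻¹) * (∏ n (g ∘ suc) * fromℕ′ (∏ℕ n (den ∘ suc)))
      ≈⟨ *-cong (trans (*-congˡ (⁻¹-inverse (fromℕ′-≉0 _ (nz 0)))) (*-identityʳ _))
                (∏-quotient n (g ∘ suc) (num ∘ suc) (den ∘ suc) (nz ∘ suc) (p ∘ suc)) ⟩
    fromℕ′ (num 0) * fromℕ′ (∏ℕ n (num ∘ suc))
      ≈⟨ sym (fromℕ′-* (num 0) _) ⟩
    fromℕ′ (num 0 ℕ.* ∏ℕ n (num ∘ suc)) ∎

  private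
    3*suc : ∀ k → 3 ℕ.* suc k ≡ 3 ℕ.+ k ℕ.* 3
    3*suc k = ℕₚ.*-comm 3 (suc k)

    n+suc∸1 : ∀ n k → n ℕ.+ suc k ∸ 1 ≡ n ℕ.+ k
    n+suc∸1 n k = ≡.cong (_∸ 1) (ℕₚ.+-suc n k)

    factorial-nonZero : ∀ k → NonZero (k !)
    factorial-nonZero k = ℕₚ._!≢0 k

  Aₙ-quotient : ∀ n → Aₙ n * fromℕ′ (commonDenominator n) ≈ fromℕ′ (asmNumerator n)
  Aₙ-quotient n = ∏-quotient n _ (λ k → (1 ℕ.+ k ℕ.* 3) !) (λ k → (n ℕ.+ k) !) (λ k → factorial-nonZero (n ℕ.+ k)) λ i →
    reflexive (≡.cong₂ (λ a b → fromℕ′ ((a ∸ 2) !) / fromℕ′ (b !)) (3*suc (toℕ i)) (n+suc∸1 n (toℕ i)))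

  Cₙ-quotient : ∀ n → Cₙ n * fromℕ′ (commonDenominator n) ≈ fromℕ′ (cspNumerator n)
  Cₙ-quotient n = ∏-quotient n _ (λ k → (2 ℕ.+ k ℕ.* 3) ℕ.* (k ℕ.* 3) !) (λ k → (n ℕ.+ k) !) (λ k → factorial-nonZero (n ℕ.+ k)) λ i →
    trans (reflexive (≡.cong₂ (λ a b → fromℕ′ (a ∸ 1) * fromℕ′ ((a ∸ 3) !) / fromℕ′ (b !)) (3*suc (toℕ i)) (n+suc∸1 n (toℕ i))))
      (*-congʳ (sym (fromℕ′-* (2 ℕ.+ toℕ i ℕ.* 3) ((toℕ i ℕ.* 3) !))))

  quotient-cancel : ∀ n {q} v num → q * fromℕ′ (commonDenominator n) ≈ fromℕ′ num →
    v ℕ.* commonDenominator n ≡ threes n ℕ.* num ℕ.* vandermonde₀ n →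
    fromℕ′ v ≈ fromℕ′ (threes n) * q * fromℕ′ (vandermonde₀ n)
  quotient-cancel n {q} v num quotient ratio = *-cancelˡ-nz
    (fromℕ′-≉0 (commonDenominator n) (∏ℕ-nonZero n (λ k → (n ℕ.+ k) !) (λ k → factorial-nonZero (n ℕ.+ k)))) (begin
      D * fromℕ′ v                                           ≈⟨ trans (*-comm _ _) (sym (fromℕ′-* v _)) ⟩
      fromℕ′ (v ℕ.* commonDenominator n)                     ≡⟨ ≡.cong fromℕ′ ratio ⟩
      fromℕ′ (threes n ℕ.* num ℕ.* vandermonde₀ n)           ≈⟨ trans (fromℕ′-* (threes n ℕ.* num) _) (*-congʳ (fromℕ′-* (threes n) num)) ⟩
      fromℕ′ (threes n) * fromℕ′ num * fromℕ′ (vandermonde₀ n) ≈⟨ *-congʳ (*-congˡ (sym quotient)) ⟩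
      fromℕ′ (threes n) * (q * D) * fromℕ′ (vandermonde₀ n)  ≈⟨ solve 4 (λ t q d v → t :* (q :* d) :* v := d :* (t :* q :* v)) refl _ _ _ _ ⟩
      D * (fromℕ′ (threes n) * q * fromℕ′ (vandermonde₀ n))  ∎)
    where D = fromℕ′ (commonDenominator n)

  vandermonde₁-Aₙ : ∀ n → vandermondeℕ (triples 0 1 n) ≈ fromℕ′ (threes n) * Aₙ n * vandermondeℕ (range (double n))
  vandermonde₁-Aₙ n = trans (vandermondeℕ-triples₁ n)
    (trans (quotient-cancel n (vandermonde₁ n) (asmNumerator n) (Aₙ-quotient n) (vandermonde₁-ratio n)) (*-congˡ (sym (vandermondeℕ-range n))))

  vandermonde₂-Cₙ : ∀ n → vandermondeℕ (triples 0 2 n) ≈ fromℕ′ (threes n) * Cₙ n * vandermondeℕ (range (double n))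
  vandermonde₂-Cₙ n = trans (vandermondeℕ-triples₂ n)
    (trans (quotient-cancel n (vandermonde₂ n) (cspNumerator n) (Cₙ-quotient n) (vandermonde₂-ratio n)) (*-congˡ (sym (vandermondeℕ-range n))))

  vandermondeℕ-range-≉0 : ∀ n → vandermondeℕ (range (double n)) ≉ 0#
  vandermondeℕ-range-≉0 n h = fromℕ′-≉0 (vandermonde₀ n) (nonZero n) (trans (sym (vandermondeℕ-range n)) h)
    where
    nonZero : ∀ n → NonZero (vandermonde₀ n)
    nonZero zero    = _
    nonZero (suc n) = ℕₚ.m*n≢0 _ _ {{ℕₚ.m*n≢0 _ _ {{factorial-nonZero (suc (n ℕ.+ n))}} {{factorial-nonZero (n ℕ.+ n)}}}} {{nonZero n}}

-- From geometric points to the homogeneous point.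

module HomogeneousLimit {c ℓ} (F : Field c ℓ) (ω : Field.Carrier F)
  (ω-root : FieldLemmas.PrimitiveCubeRoot F ω) (char0 : FieldLemmas.CharacteristicZero F) where

  open FieldLemmas F
  open EisensteinSolver F ω ω-root
  open Weights F ω ω-root
  open Transfer F ω ω-root
  open Freezing F ω ω-root
  open Determinants F ω ω-root
  open Alternants F ω ω-root
  open PolynomialFunctions F ω ω-root
  open Determinant F ω ω-root
  open DeterminantIdentity F ω ω-root char0
  open Enumeration F ω ω-root char0
  open FactorialProducts using (threes)

  fromℕ′-≉ : ∀ {m n} → m ℕ.< n → fromℕ′ m ≉ fromℕ′ n
  fromℕ′-≉ {m} {n} m<n h with k , ≡.refl ← ℕₚ.m≤n⇒∃[o]m+o≡n m<n = char0 k (trans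
    (sym (fromℕ′-difference m (suc k))) (x≈y⇒x-y≈0 (trans (reflexive (≡.cong fromℕ′ (ℕₚ.+-suc m k))) (sym h))))

  pow-fromℕ′ : ∀ m k → pow (fromℕ′ m) k ≈ fromℕ′ (m ℕ.^ k)
  pow-fromℕ′ m zero    = sym (+-identityʳ 1#)
  pow-fromℕ′ m (suc k) = trans (*-congˡ (pow-fromℕ′ m k)) (sym (fromℕ′-* m _))

  range-increasing : ∀ n → AllPairs ℕ._<_ (range n)
  range-increasing zero    = []
  range-increasing (suc n) = Allₚ.map⁺ (All.universal (λ _ → ℕ.s≤s ℕ.z≤n) (range n))
    ∷ AllPairsₚ.map⁺ (AllPairs.map ℕ.s≤s (range-increasing n))

  -- For an integer q ≥ 2 the cubes of the points are the integers (q³)ⁱ, which increase strictly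
  -- with i and stay distinct in characteristic zero.
  geometric-generic : ∀ m ks → AllPairs ℕ._<_ ks → Generic (map (pow (fromℕ′ (2 ℕ.+ m))) ks)
  geometric-generic m ks increasing =
      AllPairsₚ.map⁺ (AllPairs.map (λ {i} {j} i<j h → fromℕ′-≉ (ℕₚ.^-monoʳ-< ((2 ℕ.+ m) ℕ.^ 3) 1<M i<j)
        (trans (sym (cube i)) (trans h (cube j)))) increasing)
    , Allₚ.map⁺ (All.universal (λ k h → fromℕ′-≉0 ((2 ℕ.+ m) ℕ.^ k) (ℕₚ.m^n≢0 (2 ℕ.+ m) k) (trans (sym (pow-fromℕ′ (2 ℕ.+ m) k)) h)) ks)
    where
    1<M : 1 ℕ.< (2 ℕ.+ m) ℕ.^ 3
    1<M = ℕₚ.^-monoʳ-< (2 ℕ.+ m) (ℕ.s≤s (ℕ.s≤s ℕ.z≤n)) {0} {3} (ℕ.s≤s ℕ.z≤n)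
    cube : ∀ i → pow (pow (fromℕ′ (2 ℕ.+ m)) i) 3 ≈ fromℕ′ (((2 ℕ.+ m) ℕ.^ 3) ℕ.^ i)
    cube i = trans (pow-pow _ i 3) (trans (pow-cong i (pow-fromℕ′ (2 ℕ.+ m) 3)) (pow-fromℕ′ _ i))

  -- The q-integer (qᵏ - 1) / (q - 1), written without division so that it makes sense at q = 1.
  bracket : Carrier → ℕ → Carrier
  bracket q zero    = 0#
  bracket q (suc k) = 1# + q * bracket q k

  pow-bracket : ∀ q k → pow q k ≈ 1# + (q + - 1#) * bracket q k
  pow-bracket q zero    = solve 1 (λ q → :1 := :1 :+ (q :- :1) :* :0) refl q
  pow-bracket q (suc k) = trans (*-congˡ (pow-bracket q k))
    (solve 2 (λ q b → q :* (:1 :+ (q :- :1) :* b) := :1 :+ (q :- :1) :* (:1 :+ q :* b)) refl q _)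

  vandermonde-bracket : ∀ q ks → vandermonde (map (pow q) ks) ≈ pow (q + - 1#) (pairs (length ks)) * vandermonde (map (bracket q) ks)
  vandermonde-bracket q ks = vandermonde-scale (q + - 1#) (pow q) (bracket q) ks λ j k →
    trans (+-cong (pow-bracket q k) (-‿cong (pow-bracket q j)))
      (solve 3 (λ s a b → :1 :+ s :* a :- (:1 :+ s :* b) := s :* (a :- b)) refl _ _ _)

  length-range : ∀ n → length (range n) ≡ n
  length-range zero    = ≡.refl
  length-range (suc n) = ≡.cong suc (≡.trans (Listₚ.length-map suc (range n)) (length-range n))

  length-triples : ∀ i j n → length (triples i j n) ≡ double n
  length-triples i j zero    = ≡.refl
  length-triples i j (suc n) = ≡.cong (λ m → suc (suc m)) (≡.trans (Listₚ.length-map (3 ℕ.+_) (triples i j n)) (length-triples i j n))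

  alternant-bracket : ∀ q ks n → length ks ≡ n →
    alternant ks (map (pow q) (range n)) ≈ pow (q + - 1#) (pairs n) * vandermonde (map (bracket q) ks)
  alternant-bracket q ks _ ≡.refl = trans (alternant-geometric q ks) (vandermonde-bracket q ks)

  rangeᵛ : ∀ n → Vec ℕ n
  rangeᵛ zero    = []
  rangeᵛ (suc n) = 0 ∷ Vec.map suc (rangeᵛ n)

  toList-rangeᵛ : ∀ n → toList (rangeᵛ n) ≡ range n
  toList-rangeᵛ zero    = ≡.refl
  toList-rangeᵛ (suc n) = ≡.cong (0 ∷_) (≡.trans (Vecₚ.toList-map suc (rangeᵛ n)) (≡.cong (map suc) (toList-rangeᵛ n)))

  range-+ : ∀ m n → range (m ℕ.+ n) ≡ range m ++ map (m ℕ.+_) (range n)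
  range-+ zero    n = ≡.sym (Listₚ.map-id (range n))
  range-+ (suc m) n = ≡.cong (0 ∷_) (≡.trans (≡.cong (map suc) (range-+ m n))
    (≡.trans (Listₚ.map-++ suc (range m) _) (≡.cong (map suc (range m) ++_) (≡.sym (Listₚ.map-∘ (range n))))))

  -- The y take the exponents 0, ..., n - 1 and the z the exponents n, ..., 2n - 1; listed in this
  -- order all points form one geometric sequence.
  upper : ℕ → List ℕ
  upper n = map (n ℕ.+_) (range n)

  geometric-points : ∀ q n → toList (Vec.map (pow q) (rangeᵛ n)) ++ map (pow q) (upper n) ≡ map (pow q) (range (double n))
  geometric-points q n = ≡.trans
    (≡.cong (_++ map (pow q) (upper n)) (≡.trans (Vecₚ.toList-map (pow q) (rangeᵛ n)) (≡.cong (map (pow q)) (toList-rangeᵛ n))))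
    (≡.trans (≡.sym (Listₚ.map-++ (pow q) (range n) (upper n)))
      (≡.cong (map (pow q)) (≡.trans (≡.sym (range-+ n n)) (≡.cong range (≡.sym (double≡ n))))))

  -- The degree in q is immaterial: the zeros will be all integers from 2 on.
  IsPoly : (Carrier → Carrier) → Set _
  IsPoly g = ∃ λ n → Poly n g

  isPoly-const : ∀ x → IsPoly (λ _ → x)
  isPoly-const x = 0 , Poly-const x

  isPoly-id : IsPoly (λ x → x)
  isPoly-id = 1 , Poly-id

  isPoly-+ : ∀ {g h} → IsPoly g → IsPoly h → IsPoly (λ x → g x + h x)
  isPoly-+ (m , p) (n , q) = m ℕ.+ n , Poly-+ (Poly-≤ (ℕₚ.m≤m+n m n) p) (Poly-≤ (ℕₚ.m≤n+m n m) q)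

  isPoly-* : ∀ {g h} → IsPoly g → IsPoly h → IsPoly (λ x → g x * h x)
  isPoly-* (m , p) (n , q) = m ℕ.+ n , Poly-mul p q

  isPoly-‿- : ∀ {g} → IsPoly g → IsPoly (λ x → - g x)
  isPoly-‿- (m , p) = m , Poly-‿- p

  isPoly-pow : ∀ k → IsPoly (λ x → pow x k)
  isPoly-pow k = k , Poly-pow k ℕₚ.≤-refl

  isPoly-∑ˢ : ∀ {g : Carrier → Spin → Carrier} → (∀ s → IsPoly (λ x → g x s)) → IsPoly (λ x → ∑ˢ (g x))
  isPoly-∑ˢ p with n , q ← isPoly-+ (p ⊞) (p ⊟) = n , Poly-ext (λ x → ∑ˢ-def _) q

  isPoly-∑ᵛ : ∀ k {g : Carrier → Vec Spin k → Carrier} → (∀ σ → IsPoly (λ x → g x σ)) → IsPoly (λ x → ∑ᵛ k (g x))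
  isPoly-∑ᵛ zero    p = p []
  isPoly-∑ᵛ (suc k) p = isPoly-∑ˢ λ s → isPoly-∑ᵛ k λ σ → p (s ∷ σ)

  isPoly-∏ˡ : ∀ {A : Set} (g : Carrier → A → Carrier) (h : Carrier → Carrier → Carrier) →
    (∀ a → IsPoly (λ x → h x (g x a))) → ∀ as → IsPoly (λ x → ∏ˡ (h x) (map (g x) as))
  isPoly-∏ˡ g h p []       = isPoly-const 1#
  isPoly-∏ˡ g h p (x ∷ as) = isPoly-* (p x) (isPoly-∏ˡ g h p as)

  isPoly-vandermonde : ∀ {A : Set} (g : Carrier → A → Carrier) → (∀ a → IsPoly (λ x → g x a)) →
    ∀ as → IsPoly (λ x → vandermonde (map (g x) as))
  isPoly-vandermonde g p []       = isPoly-const 1#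
  isPoly-vandermonde g p (y ∷ as) = isPoly-* (isPoly-∏ˡ g (λ x w → w + - g x y) (λ b → isPoly-+ (p b) (isPoly-‿- (p y))) as) (isPoly-vandermonde g p as)

  isPoly-bracket : ∀ k → IsPoly (λ x → bracket x k)
  isPoly-bracket zero    = isPoly-const 0#
  isPoly-bracket (suc k) = isPoly-+ (isPoly-const 1#) (isPoly-* isPoly-id (isPoly-bracket k))

  isPoly-row : ∀ {n d L} l (σ τ : Vec Spin n) i (js : Vec ℕ n) → IsPoly (λ x → row d L l σ τ (pow x i) (Vec.map (pow x) js))
  isPoly-row l []      []      i []       = isPoly-const _
  isPoly-row {d = d} {L} l (t ∷ σ) (b ∷ τ) i (j ∷ js) = isPoly-∑ˢ λ r → isPoly-*
    (i ℕ.+ j , Poly-vertexWeight {L = L} (vertex t r b l) (Poly-pow i (ℕₚ.m≤m+n i j)) (Poly-pow j (ℕₚ.m≤n+m j i)))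
    (isPoly-row {L = shift L t} r σ τ i js)

  isPoly-partition : ∀ {n d L} (σ : Vec Spin n) is js → IsPoly (λ x → partition d L σ (map (pow x) is) (Vec.map (pow x) js))
  isPoly-partition     σ []       js = isPoly-const _
  isPoly-partition {n} {d} {L} σ (i ∷ is) js = isPoly-∑ᵛ n
    {λ x τ → row d L ⊞ σ τ (pow x i) (Vec.map (pow x) js) * partition d (ω * L) τ (map (pow x) is) (Vec.map (pow x) js)}
    λ τ → isPoly-* (isPoly-row ⊞ σ τ i js) (isPoly-partition τ is js)

  isPoly-vanishes : ∀ {g} → IsPoly g → (∀ m → g (fromℕ′ (2 ℕ.+ m)) ≈ 0#) → ∀ x → g x ≈ 0#
  isPoly-vanishes (n , p) h = Poly-vanishes (map (λ m → fromℕ′ (2 ℕ.+ m)) (range (suc n))) p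
    (ℕₚ.≤-reflexive (≡.sym (≡.trans (Listₚ.length-map _ (range (suc n))) (length-range (suc n)))))
    (AllPairsₚ.map⁺ (AllPairs.map (λ m<n → fromℕ′-≉ (ℕ.s≤s (ℕ.s≤s m<n))) (range-increasing (suc n))))
    (Allₚ.map⁺ (All.universal h (range (suc n))))

  -- The defect at the geometric points after removal of the factor (q - 1)^(2n choose 2) common to
  -- the three alternants. Unlike the original it carries information at q = 1.
  geometricDefect : ∀ n (d L q : Carrier) → Carrier
  geometricDefect n d L q = defect n L
    (numerator d L (map (pow q) (upper n)) (Vec.map (pow q) (rangeᵛ n)))
    (product (map (pow q) (upper n))) (product (map (pow q) (range n)))
    (vandermonde (map (bracket q) (range (double n))))
    (vandermonde (map (bracket q) (triples 0 1 n)))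
    (vandermonde (map (bracket q) (triples 0 2 n)))

  isPoly-geometricDefect : ∀ n d L → IsPoly (geometricDefect n d L)
  isPoly-geometricDefect n d L = isPoly-+
    (isPoly-* (isPoly-* (isPoly-const _) (isPoly-partition {L = L} ⊞ⁿ (upper n) (rangeᵛ n))) (brackets (range (double n))))
    (isPoly-‿- (isPoly-* (isPoly-const _) (isPoly-+ (isPoly-+
      (isPoly-* (isPoly-* (isPoly-const _) (products (upper n))) (brackets (triples 0 1 n)))
      (isPoly-* (isPoly-const _) (brackets (triples 0 2 n))))
      (isPoly-* (isPoly-* (isPoly-const _) (products (range n))) (brackets (triples 0 1 n))))))
    where
    brackets : ∀ ks → IsPoly (λ q → vandermonde (map (bracket q) ks))
    brackets = isPoly-vandermonde bracket isPoly-bracket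
    products : ∀ ks → IsPoly (λ q → product (map (pow q) ks))
    products = isPoly-∏ˡ pow (λ _ w → w) isPoly-pow

  -- For q = 2, 3, … the powers of q are generic points, and the powers of q − 1 cancel.
  geometricDefect-ℕ : ∀ n {d L} → δ L * d ≈ 1# → ∀ m → geometricDefect n d L (fromℕ′ (2 ℕ.+ m)) ≈ 0#
  geometricDefect-ℕ n {d} {L} unit m = *-zero-cancelˡ s≉0 (begin
    s * geometricDefect n d L q
      ≈⟨ sym (defect-* n L N ∏z ∏y (v (range (double n))) (v (triples 0 1 n)) (v (triples 0 2 n)) s) ⟩
    defect n L N ∏z ∏y (s * v (range (double n))) (s * v (triples 0 1 n)) (s * v (triples 0 2 n))
      ≈⟨ defect-cong n L refl refl (sym (scaled (range (double n)) (length-range (double n))))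
           (sym (scaled (triples 0 1 n) (length-triples 0 1 n))) (sym (scaled (triples 0 2 n) (length-triples 0 2 n))) ⟩
    defect n L N ∏z ∏y (V n ps) (D₁ n ps) (D₂ n ps)
      ≡⟨ ≡.cong₂ (λ ps ks → defect n L N ∏z (product ks) (V n ps) (D₁ n ps) (D₂ n ps)) (≡.sym (geometric-points q n)) (≡.sym ys≡) ⟩
    defectAt d L zs ys (toList ys ++ zs)
      ≈⟨ determinant-identity n zs ys unit (≡.trans (Listₚ.length-map (pow q) (upper n)) (≡.trans (Listₚ.length-map (n ℕ.+_) (range n)) (length-range n)))
           (≡.subst Generic (≡.sym (geometric-points q n)) (geometric-generic m (range (double n)) (range-increasing (double n)))) ⟩
    0# ∎)
    where
    q = fromℕ′ (2 ℕ.+ m)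
    zs = map (pow q) (upper n)
    ys = Vec.map (pow q) (rangeᵛ n)
    N = numerator d L zs ys
    ∏z = product zs
    ∏y = product (map (pow q) (range n))
    ps = map (pow q) (range (double n))
    s = pow (q + - 1#) (pairs (double n))
    v = λ ks → vandermonde (map (bracket q) ks)
    ys≡ : toList ys ≡ map (pow q) (range n)
    ys≡ = ≡.trans (Vecₚ.toList-map (pow q) (rangeᵛ n)) (≡.cong (map (pow q)) (toList-rangeᵛ n))
    scaled : ∀ ks → length ks ≡ double n → alternant ks ps ≈ s * v ks
    scaled ks e = alternant-bracket q ks (double n) e
    q-1≈ : q + - 1# ≈ fromℕ′ (suc m)
    q-1≈ = solve 1 (λ m → :1 :+ (:1 :+ m) :- :1 := :1 :+ m) refl (fromℕ′ m)
    s≉0 : s ≉ 0#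
    s≉0 h = fromℕ′-≉0 (suc m ℕ.^ pairs (double n)) (ℕₚ.m^n≢0 (suc m) (pairs (double n)))
      (trans (sym (pow-fromℕ′ (suc m) (pairs (double n)))) (trans (sym (pow-cong (pairs (double n)) q-1≈)) h))

  geometricDefect≈0 : ∀ n {d L} → δ L * d ≈ 1# → ∀ q → geometricDefect n d L q ≈ 0#
  geometricDefect≈0 n {d} {L} unit = isPoly-vanishes (isPoly-geometricDefect n d L) (geometricDefect-ℕ n unit)

  bracket-1 : ∀ k → bracket 1# k ≈ fromℕ′ k
  bracket-1 zero    = refl
  bracket-1 (suc k) = +-congˡ (trans (*-identityˡ _) (bracket-1 k))

  product-1 : ∀ ks → product (map (pow 1#) ks) ≈ 1#
  product-1 []       = refl
  product-1 (k ∷ ks) = trans (*-cong (pow-1 k) (product-1 ks)) (*-identityˡ 1#)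

  ones : ∀ zs (ks : List ℕ) → length zs ≡ length ks → All (_≈ 1#) zs → Pointwise _≈_ zs (map (pow 1#) ks)
  ones []       []       _ _        = []
  ones (z ∷ zs) (k ∷ ks) e (h ∷ hs) = trans h (sym (pow-1 k)) ∷ ones zs ks (ℕₚ.suc-injective e) hs

  onesᵛ : ∀ {n} (ys : Vec Carrier n) (ks : Vec ℕ n) → All (_≈ 1#) (toList ys) → Pointwiseᵛ _≈_ ys (Vec.map (pow 1#) ks)
  onesᵛ []       []       _        = []
  onesᵛ (y ∷ ys) (k ∷ ks) (h ∷ hs) = trans h (sym (pow-1 k)) ∷ onesᵛ ys ks hs

  -- At q = 1 every point is 1 and the q-integers become integers, so the three alternants are
  -- replaced by the Vandermonde products of their exponents.
  homogeneous : ∀ n {d L} zs (ys : Vec Carrier n) → δ L * d ≈ 1# → length zs ≡ n →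
    All (_≈ 1#) zs → All (_≈ 1#) (toList ys) →
    numerator d L zs ys ≈ scalar n * fromℕ′ (threes n)
      * (Aₙ n * (pow ω n + pow ω n * pow ω n * (L * L)) + pow (- 1#) n * Cₙ n * L)
  homogeneous n {d} {L} zs ys unit e zs≈1 ys≈1 = *-cancelˡ-nz (vandermondeℕ-range-≉0 n) (begin
    W * numerator d L zs ys
      ≈⟨ *-comm _ _ ⟩
    numerator d L zs ys * W
      ≈⟨ *-cong (*-congˡ (partition-cong ⊞ⁿ (ones zs (upper n) (≡.trans e (≡.sym (≡.trans (Listₚ.length-map (n ℕ.+_) (range n)) (length-range n)))) zs≈1)
                   (onesᵛ ys (rangeᵛ n) ys≈1)))
                (sym (b (range (double n)))) ⟩
    numerator d L (map (pow 1#) (upper n)) (Vec.map (pow 1#) (rangeᵛ n)) * vandermonde (map (bracket 1#) (range (double n)))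
      ≈⟨ x-y≈0⇒x≈y (geometricDefect≈0 n unit 1#) ⟩
    combination n L (product (map (pow 1#) (upper n))) (product (map (pow 1#) (range n)))
      (vandermonde (map (bracket 1#) (triples 0 1 n))) (vandermonde (map (bracket 1#) (triples 0 2 n)))
      ≈⟨ *-congˡ (+-cong (+-cong (*-cong (*-congˡ (product-1 (upper n))) b₁) (*-congˡ b₂)) (*-cong (*-congˡ (product-1 (range n))) b₁)) ⟩
    scalar n * (w * 1# * (t * Aₙ n * W) + m * L * (t * Cₙ n * W) + w * w * (L * L) * 1# * (t * Aₙ n * W))
      ≈⟨ solve 8 (λ p w t A W m L Γ → p :* (w :* :1 :* (t :* A :* W) :+ m :* L :* (t :* Γ :* W) :+ w :* w :* (L :* L) :* :1 :* (t :* A :* W))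
           := W :* (p :* t :* (A :* (w :+ w :* w :* (L :* L)) :+ m :* Γ :* L))) refl (scalar n) w t (Aₙ n) W m L (Cₙ n) ⟩
    W * (scalar n * t * (Aₙ n * (w + w * w * (L * L)) + m * Cₙ n * L)) ∎)
    where
    W = vandermondeℕ (range (double n))
    w = pow ω n
    t = fromℕ′ (threes n)
    m = pow (- 1#) n
    b : ∀ ks → vandermonde (map (bracket 1#) ks) ≈ vandermondeℕ ks
    b ks = vandermonde-cong (bracket 1#) fromℕ′ ks λ j k → +-cong (bracket-1 k) (-‿cong (bracket-1 j))
    b₁ = trans (b (triples 0 1 n)) (vandermonde₁-Aₙ n)
    b₂ = trans (b (triples 0 2 n)) (vandermonde₂-Cₙ n)

-- Height matrices as sequences of ±1 paths.

stepℤ : Spin → ℤ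
stepℤ ⊞ = + 1
stepℤ ⊟ = -[1+ 0 ]

tailPath : ∀ {n} → ℤ → Vec Spin n → Vec ℤ n
tailPath h []      = []
tailPath h (s ∷ σ) = h ℤ.+ stepℤ s ∷ tailPath (h ℤ.+ stepℤ s) σ

path : ∀ {n} → ℤ → Vec Spin n → Vec ℤ (suc n)
path h σ = h ∷ tailPath h σ

IsTail : ∀ {n} → ℤ → Vec ℤ n → Set
IsTail h []      = ⊤
IsTail h (x ∷ v) = Σ[ s ∈ Spin ] x ≡ h ℤ.+ stepℤ s × IsTail x v

IsRow : ∀ {n} → ℤ → Vec ℤ (suc n) → Set
IsRow h (x ∷ v) = x ≡ h × IsTail x v

-- Only the left column and the horizontal steps are recorded. They parametrise a matrix by
-- independent spins row by row; the remaining conditions on a state are left to the vanishing of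
-- weights and boundary indicators.
IsRows : ∀ {n m} → ℕ → Vec (Vec ℤ (suc n)) m → Set
IsRows i []       = ⊤
IsRows i (v ∷ vs) = IsRow (+ i) v × IsRows (suc i) vs

paths : ∀ {n m} → ℕ → Vec (Vec Spin n) m → Vec (Vec ℤ (suc n)) m
paths i []       = []
paths i (σ ∷ σs) = path (+ i) σ ∷ paths (suc i) σs

∈-box : ∀ n x → ∣ x ∣ ℕ.≤ 2 ℕ.* n → x ∈ box n
∈-box n x h = ≡.subst (_∈ box n) shifted (∈-map⁺ (λ k → + k ℤ.- + (2 ℕ.* n)) (∈-upTo⁺ bound))
  where
  m = 2 ℕ.* n
  nonneg : + ∣ x ℤ.+ + m ∣ ≡ x ℤ.+ + m
  nonneg = ℤₚ.0≤i⇒+∣i∣≡i (≡.subst (ℤ._≤ x ℤ.+ + m) (ℤₚ.+-inverseˡ (+ m))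
    (ℤₚ.+-monoˡ-≤ (+ m) (≡.subst (ℤ.- + m ℤ.≤_) (ℤₚ.neg-involutive x) (ℤₚ.neg-mono-≤ -x≤m))))
    where
    -x≤m : ℤ.- x ℤ.≤ + m
    -x≤m = ℤₚ.≤-trans (ℤₚ.≤-trans (i≤∣i∣ (ℤ.- x)) (ℤₚ.≤-reflexive (≡.cong +_ (ℤₚ.∣-i∣≡∣i∣ x)))) (ℤ.+≤+ h)
      where
      i≤∣i∣ : ∀ i → i ℤ.≤ + ∣ i ∣
      i≤∣i∣ (+ _)    = ℤₚ.≤-refl
      i≤∣i∣ -[1+ _ ] = ℤ.-≤+
  shifted : + ∣ x ℤ.+ + m ∣ ℤ.- + m ≡ x
  shifted = ≡.trans (≡.cong (ℤ._- + m) nonneg)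
    (≡.trans (ℤₚ.+-assoc x (+ m) (ℤ.- + m)) (≡.trans (≡.cong (λ i → x ℤ.+ i) (ℤₚ.+-inverseʳ (+ m))) (ℤₚ.+-identityʳ x)))
  bound : ∣ x ℤ.+ + m ∣ ℕ.< suc (4 ℕ.* n)
  bound = ℕ.s≤s (ℕₚ.≤-trans (ℤₚ.∣i+j∣≤∣i∣+∣j∣ x (+ m)) (ℕₚ.≤-trans (ℕₚ.+-monoˡ-≤ m h)
    (ℕₚ.≤-reflexive (≡.sym (ℕₚ.*-distribʳ-+ n 2 2)))))

box-unique : ∀ n → Unique (box n)
box-unique n = Uniqueₚ.map⁺ (λ {i} {j} h → ℤₚ.+-injective (ℤ-cancelʳ (ℤ.- + (2 ℕ.* n)) (+ i) (+ j) h)) (Uniqueₚ.upTo⁺ (suc (4 ℕ.* n)))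

-- Sums over all matrices in the box as sums over paths.

module PathSums {c ℓ} (F : Field c ℓ) (ω : Field.Carrier F)
  (ω-root : FieldLemmas.PrimitiveCubeRoot F ω) where

  open FieldLemmas F
  open Weights F ω ω-root
  open Transfer F ω ω-root

  private
    variable
      ℓ₁ ℓ₂ : Level
      A : Set ℓ₁
      B : Set ℓ₂

  ∑ᴸ : List A → (A → Carrier) → Carrier
  ∑ᴸ xs g = sumL (map g xs)

  ∑ᴸ-cong : ∀ (xs : List A) {g h : A → Carrier} → (∀ x → g x ≈ h x) → ∑ᴸ xs g ≈ ∑ᴸ xs h
  ∑ᴸ-cong []       p = refl
  ∑ᴸ-cong (x ∷ xs) p = +-cong (p x) (∑ᴸ-cong xs p)

  ∑ᴸ-0 : ∀ (xs : List A) {g : A → Carrier} → (∀ x → g x ≈ 0#) → ∑ᴸ xs g ≈ 0#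
  ∑ᴸ-0 []       p = refl
  ∑ᴸ-0 (x ∷ xs) p = trans (+-cong (p x) (∑ᴸ-0 xs p)) (+-identityˡ 0#)

  ∑ᴸ-+ : ∀ (xs : List A) (g h : A → Carrier) → ∑ᴸ xs (λ x → g x + h x) ≈ ∑ᴸ xs g + ∑ᴸ xs h
  ∑ᴸ-+ []       g h = sym (+-identityˡ 0#)
  ∑ᴸ-+ (x ∷ xs) g h = trans (+-congˡ (∑ᴸ-+ xs g h)) (begin
    g x + h x + (p + q)    ≈⟨ +-assoc _ _ _ ⟩
    g x + (h x + (p + q))  ≈⟨ +-congˡ (trans (sym (+-assoc _ _ _)) (trans (+-congʳ (+-comm _ _)) (+-assoc _ _ _))) ⟩
    g x + (p + (h x + q))  ≈⟨ sym (+-assoc _ _ _) ⟩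
    g x + p + (h x + q)    ∎)
    where
    p = ∑ᴸ xs g
    q = ∑ᴸ xs h

  ∑ᴸ-++ : ∀ (xs ys : List A) (g : A → Carrier) → ∑ᴸ (xs ++ ys) g ≈ ∑ᴸ xs g + ∑ᴸ ys g
  ∑ᴸ-++ []       ys g = sym (+-identityˡ _)
  ∑ᴸ-++ (x ∷ xs) ys g = trans (+-congˡ (∑ᴸ-++ xs ys g)) (sym (+-assoc _ _ _))

  ∑ᴸ-concatMap : ∀ (f : A → List B) xs (g : B → Carrier) → ∑ᴸ (concatMap f xs) g ≈ ∑ᴸ xs (λ x → ∑ᴸ (f x) g)
  ∑ᴸ-concatMap f []       g = refl
  ∑ᴸ-concatMap f (x ∷ xs) g = trans (∑ᴸ-++ (f x) (concatMap f xs) g) (+-congˡ (∑ᴸ-concatMap f xs g))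

  ∑ᴸ-vecs : ∀ (xs : List A) k (g : Vec A (suc k) → Carrier) →
    ∑ᴸ (vecs xs (suc k)) g ≈ ∑ᴸ xs (λ x → ∑ᴸ (vecs xs k) (g ∘ (x ∷_)))
  ∑ᴸ-vecs xs k g = trans (∑ᴸ-concatMap (λ x → map (x ∷_) (vecs xs k)) xs g)
    (∑ᴸ-cong xs λ x → reflexive (≡.cong sumL (≡.sym (Listₚ.map-∘ (vecs xs k)))))

  ∑ᴸ-filter : ∀ {ℓ₃} {P : Pred A ℓ₃} (P? : Decidable P) (g : A → Carrier) xs →
    ∑ᴸ (filter P? xs) g ≈ ∑ᴸ xs (λ x → if does (P? x) then g x else 0#)
  ∑ᴸ-filter P? g []       = refl
  ∑ᴸ-filter P? g (x ∷ xs) with P? x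
  ... | yes _ = +-congˡ (∑ᴸ-filter P? g xs)
  ... | no  _ = trans (∑ᴸ-filter P? g xs) (sym (+-identityˡ _))

  ∑ᴸ-single : ∀ {xs : List A} {g : A → Carrier} {x} → Unique xs → x ∈ xs → (∀ y → y ≢ x → g y ≈ 0#) → ∑ᴸ xs g ≈ g x
  ∑ᴸ-single {g = g} (x∉ ∷ _) (here ≡.refl) h = trans (+-congˡ (rest x∉)) (+-identityʳ _)
    where
    rest : ∀ {xs} → All (_ ≢_) xs → ∑ᴸ xs g ≈ 0#
    rest []       = refl
    rest (p ∷ ps) = trans (+-cong (h _ (p ∘ ≡.sym)) (rest ps)) (+-identityˡ 0#)
  ∑ᴸ-single (x∉ ∷ unique) (there x∈xs) h =
    trans (+-cong (h _ (All.lookup x∉ x∈xs)) (∑ᴸ-single unique x∈xs h)) (+-identityˡ _)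

  ∑ᴸ-pair : ∀ {xs : List ℤ} {g : ℤ → Carrier} {x y} → Unique xs → x ∈ xs → y ∈ xs → x ≢ y →
    (∀ u → u ≢ x → u ≢ y → g u ≈ 0#) → ∑ᴸ xs g ≈ g x + g y
  ∑ᴸ-pair {xs} {g} {x} {y} unique x∈ y∈ x≢y h = begin
    ∑ᴸ xs g                                  ≈⟨ ∑ᴸ-cong xs split ⟩
    ∑ᴸ xs (λ u → at u + off u)               ≈⟨ ∑ᴸ-+ xs at off ⟩
    ∑ᴸ xs at + ∑ᴸ xs off                     ≈⟨ +-cong (∑ᴸ-single unique x∈ at-0) (∑ᴸ-single unique y∈ off-0) ⟩
    at x + off y                             ≈⟨ +-cong at-x off-y ⟩
    g x + g y                                ∎
    where
    at off : ℤ → Carrier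
    at u = if does (u ℤ.≟ x) then g u else 0#
    off u = if does (u ℤ.≟ x) then 0# else g u
    split : ∀ u → g u ≈ at u + off u
    split u with u ℤ.≟ x
    ... | yes _ = sym (+-identityʳ _)
    ... | no  _ = sym (+-identityˡ _)
    at-0 : ∀ u → u ≢ x → at u ≈ 0#
    at-0 u u≢x with u ℤ.≟ x
    ... | yes u≡x = contradiction u≡x u≢x
    ... | no  _   = refl
    off-0 : ∀ u → u ≢ y → off u ≈ 0#
    off-0 u u≢y with u ℤ.≟ x
    ... | yes _   = refl
    ... | no  u≢x = h u u≢x u≢y
    at-x : at x ≈ g x
    at-x with x ℤ.≟ x
    ... | yes _   = refl
    ... | no  x≢x = contradiction ≡.refl x≢x
    off-y : off y ≈ g y
    off-y with y ℤ.≟ x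
    ... | yes y≡x = contradiction (≡.sym y≡x) x≢y
    ... | no  _   = refl

  step-bound : ∀ {m k} h s → ∣ h ∣ ℕ.+ suc k ℕ.≤ m → ∣ h ℤ.+ stepℤ s ∣ ℕ.+ k ℕ.≤ m
  step-bound {m} {k} h s p = ℕₚ.≤-trans (ℕₚ.+-monoˡ-≤ k (ℤₚ.∣i+j∣≤∣i∣+∣j∣ h (stepℤ s)))
    (≡.subst (ℕ._≤ m) (≡.trans (≡.cong (∣ h ∣ ℕ.+_) (≡.cong (ℕ._+ k) (unit s))) (≡.sym (ℕₚ.+-assoc ∣ h ∣ ∣ stepℤ s ∣ k))) p)
    where
    unit : ∀ s → 1 ≡ ∣ stepℤ s ∣
    unit ⊞ = ≡.refl
    unit ⊟ = ≡.refl

  -- The bound on ∣h∣ + k keeps the k remaining steps inside `box n`, so every path occurs in the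
  -- enumeration, and exactly once as `box n` has no repetitions.
  ∑ᴸ-tails : ∀ n k h (g : Vec ℤ k → Carrier) → ∣ h ∣ ℕ.+ k ℕ.≤ 2 ℕ.* n → (∀ v → ¬ IsTail h v → g v ≈ 0#) →
    ∑ᴸ (vecs (box n) k) g ≈ ∑ᵛ k (λ σ → g (tailPath h σ))
  ∑ᴸ-tails n zero    h g _ _ = +-identityʳ _
  ∑ᴸ-tails n (suc k) h g p q = begin
    ∑ᴸ (vecs (box n) (suc k)) g
      ≈⟨ ∑ᴸ-vecs (box n) k g ⟩
    ∑ᴸ (box n) (λ x → ∑ᴸ (vecs (box n) k) (g ∘ (x ∷_)))
      ≈⟨ ∑ᴸ-pair (box-unique n) (in-box ⊞) (in-box ⊟) (λ e → distinct (ℤ-cancelˡ h (stepℤ ⊞) (stepℤ ⊟) e))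
           (λ u u≢⊞ u≢⊟ → ∑ᴸ-0 (vecs (box n) k) λ v → q (u ∷ v) λ { (⊞ , e , _) → u≢⊞ e ; (⊟ , e , _) → u≢⊟ e }) ⟩
    ∑ᴸ (vecs (box n) k) (g ∘ (h ℤ.+ stepℤ ⊞ ∷_)) + ∑ᴸ (vecs (box n) k) (g ∘ (h ℤ.+ stepℤ ⊟ ∷_))
      ≈⟨ sym (∑ˢ-def _) ⟩
    ∑ˢ (λ s → ∑ᴸ (vecs (box n) k) (g ∘ (h ℤ.+ stepℤ s ∷_)))
      ≈⟨ ∑ˢ-cong (λ s → ∑ᴸ-tails n k (h ℤ.+ stepℤ s) (g ∘ (h ℤ.+ stepℤ s ∷_)) (step-bound h s p) λ v ¬tail → q _ λ { (_ , _ , tail) → ¬tail tail }) ⟩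
    ∑ˢ (λ s → ∑ᵛ k (λ σ → g (tailPath h (s ∷ σ)))) ∎
    where
    in-box : ∀ s → h ℤ.+ stepℤ s ∈ box n
    in-box s = ∈-box n _ (ℕₚ.≤-trans (ℕₚ.m≤m+n _ k) (step-bound h s p))
    distinct : stepℤ ⊞ ≢ stepℤ ⊟
    distinct ()

  ∑ᴸ-rows : ∀ n h (g : Vec ℤ (suc n) → Carrier) → ∣ h ∣ ℕ.≤ n → (∀ v → ¬ IsRow h v → g v ≈ 0#) →
    ∑ᴸ (vecs (box n) (suc n)) g ≈ ∑ᵛ n (λ σ → g (path h σ))
  ∑ᴸ-rows n h g p q = begin
    ∑ᴸ (vecs (box n) (suc n)) g
      ≈⟨ ∑ᴸ-vecs (box n) n g ⟩
    ∑ᴸ (box n) (λ x → ∑ᴸ (vecs (box n) n) (g ∘ (x ∷_)))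
      ≈⟨ ∑ᴸ-single (box-unique n) (∈-box n h (ℕₚ.≤-trans p (ℕₚ.m≤m+n n _)))
           (λ x x≢h → ∑ᴸ-0 (vecs (box n) n) λ v → q (x ∷ v) λ { (e , _) → x≢h e }) ⟩
    ∑ᴸ (vecs (box n) n) (g ∘ (h ∷_))
      ≈⟨ ∑ᴸ-tails n n h (g ∘ (h ∷_)) (ℕₚ.≤-trans (ℕₚ.+-monoˡ-≤ n p) (ℕₚ.≤-reflexive (≡.cong (n ℕ.+_) (≡.sym (ℕₚ.+-identityʳ n)))))
           (λ v ¬tail → q (h ∷ v) λ { (_ , tail) → ¬tail tail }) ⟩
    ∑ᵛ n (λ σ → g (path h σ)) ∎

  ∑ᵛᵛ : ∀ n m → (Vec (Vec Spin n) m → Carrier) → Carrier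
  ∑ᵛᵛ n zero    g = g []
  ∑ᵛᵛ n (suc m) g = ∑ᵛ n λ σ → ∑ᵛᵛ n m λ σs → g (σ ∷ σs)

  ∑ᴸ-matrices : ∀ n m i (g : Vec (Vec ℤ (suc n)) m → Carrier) → i ℕ.+ m ℕ.≤ suc n → (∀ v → ¬ IsRows i v → g v ≈ 0#) →
    ∑ᴸ (vecs (vecs (box n) (suc n)) m) g ≈ ∑ᵛᵛ n m (λ σs → g (paths i σs))
  ∑ᴸ-matrices n zero    i g _ _ = +-identityʳ _
  ∑ᴸ-matrices n (suc m) i g p q = begin
    ∑ᴸ (vecs rows (suc m)) g
      ≈⟨ ∑ᴸ-vecs rows m g ⟩
    ∑ᴸ rows (λ v → ∑ᴸ (vecs rows m) (g ∘ (v ∷_)))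
      ≈⟨ ∑ᴸ-rows n (+ i) _ (ℕₚ.≤-pred (ℕₚ.≤-trans (ℕₚ.m≤m+n (suc i) m) p′))
           (λ v ¬row → ∑ᴸ-0 (vecs rows m) λ vs → q (v ∷ vs) λ { (row , _) → ¬row row }) ⟩
    ∑ᵛ n (λ σ → ∑ᴸ (vecs rows m) (g ∘ (path (+ i) σ ∷_)))
      ≈⟨ ∑ᵛ-cong n (λ σ → ∑ᴸ-matrices n m (suc i) (g ∘ (path (+ i) σ ∷_)) p′ λ vs ¬rows → q _ λ { (_ , isRows) → ¬rows isRows }) ⟩
    ∑ᵛ n (λ σ → ∑ᵛᵛ n m λ σs → g (path (+ i) σ ∷ paths (suc i) σs)) ∎
    where
    rows = vecs (box n) (suc n)
    p′ : suc i ℕ.+ m ℕ.≤ suc n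
    p′ = ℕₚ.≤-trans (ℕₚ.≤-reflexive (≡.sym (ℕₚ.+-suc i m))) p

-- The weights R in polynomial form.

module VertexWeights {c ℓ} (F : Field c ℓ) (ω : Field.Carrier F)
  (ω-root : FieldLemmas.PrimitiveCubeRoot F ω) where

  open FieldLemmas F
  open EisensteinSolver F ω ω-root
  open Weights F ω ω-root
  open Freezing F ω ω-root

  ≉0-factorˡ : ∀ {x y z} → x * y ≈ z → z ≉ 0# → x ≉ 0#
  ≉0-factorˡ xy≈z z≉0 x≈0 = z≉0 (trans (sym xy≈z) (trans (*-congʳ x≈0) (zeroˡ _)))

  inverse-unique′ : ∀ {x y} → x * y ≈ 1# → x ⁻¹ ≈ y
  inverse-unique′ {x} {y} xy≈1 = *-cancelˡ-nz x≉0 (trans (⁻¹-inverse x≉0) (sym xy≈1))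
    where x≉0 = ≉0-factorˡ xy≈1 (λ 1≈0 → 0≉1 (sym 1≈0))

  /-≈ : ∀ {x y z} → y ≉ 0# → x ≈ z * y → x / y ≈ z
  /-≈ {x} {y} {z} y≉0 h = trans (*-congʳ h) (trans (*-assoc _ _ _) (trans (*-congˡ (⁻¹-inverse y≉0)) (*-identityʳ z)))

  br-inverse : ∀ {t t′} → t * t′ ≈ 1# → br t ≈ t′ * (1# + - (t * t))
  br-inverse h = *-congʳ (inverse-unique′ h)

  module _ {s s′ ξ ξ′ υ υ′ T T′ d L : Carrier} (κ≉0 : κ ≉ 0#)
    (ss′ : s * s′ ≈ 1#) (ξξ′ : ξ * ξ′ ≈ 1#) (υυ′ : υ * υ′ ≈ 1#) (TT′ : T * T′ ≈ 1#)
    (ss : s * s ≈ ω) (TT : T * T ≈ L) (unit : δ L * d ≈ 1#) where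

    private
      x y z g : Carrier
      x = ξ * ξ
      y = υ * υ
      z = ω * ω * (ξ * ξ)
      g = f (ω * L) * f (ω * ω * L) * d

      υ⁻¹ : υ ⁻¹ ≈ υ′
      υ⁻¹ = inverse-unique′ υυ′

      -- From here on every inverse is named, and u u′ = 1 is substituted for all pairs.
      br-s : br s ≈ s′ * κ
      br-s = trans (br-inverse ss′) (*-congˡ (+-congˡ (-‿cong ss)))

      br-s≉0 : br s ≉ 0#
      br-s≉0 h = *-nz (≉0-factorˡ (trans (*-comm s′ s) ss′) (λ 1≈0 → 0≉1 (sym 1≈0))) κ≉0 (trans (sym br-s) h)

      fg≈1 : f L * g ≈ 1#
      fg≈1 = trans (solve 4 (λ a b c d → a :* (b :* c :* d) := a :* b :* c :* d) refl (f L) (f (ω * L)) (f (ω * ω * L)) d) unit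

      br-T : br T ≈ T′ * f L
      br-T = trans (br-inverse TT′) (*-congˡ (+-congˡ (-‿cong TT)))

      T′≉0 : T′ ≉ 0#
      T′≉0 = ≉0-factorˡ (trans (*-comm T′ T) TT′) (λ 1≈0 → 0≉1 (sym 1≈0))

      br-T≉0 : br T ≉ 0#
      br-T≉0 h = *-nz T′≉0 (≉0-factorˡ fg≈1 (λ 1≈0 → 0≉1 (sym 1≈0))) (trans (sym br-T) h)

      pair : ∀ {u u′ v v′} → u * u′ ≈ 1# → v * v′ ≈ 1# → u * v * (u′ * v′) ≈ 1#
      pair {u} {u′} {v} {v′} p q = trans (solve 4 (λ a a′ b b′ → a :* b :* (a′ :* b′) := a :* a′ :* (b :* b′)) refl u u′ v v′)
        (trans (*-cong p q) (*-identityˡ 1#))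

      U U′ : Carrier
      U = ξ * υ ⁻¹
      U′ = ξ′ * υ

      UU′ : U * U′ ≈ 1#
      UU′ = pair ξξ′ (trans (*-comm _ _) (trans (*-congˡ υ⁻¹) υυ′))

      Uυ : U * υ ≈ ξ
      Uυ = trans (*-assoc _ _ _) (trans (*-congˡ (trans (*-congʳ υ⁻¹) (trans (*-comm _ _) υυ′))) (*-identityʳ ξ))

      U′ξ : U′ * ξ ≈ υ
      U′ξ = trans (solve 3 (λ a b c → a :* b :* c := c :* a :* b) refl ξ′ υ ξ) (trans (*-congʳ ξξ′) (*-identityˡ υ))

      -- Since U = ξ / υ, the prefactor turns U⁻¹ into υ² / (ξ υ) times ξ υ and U into ξ²: the half
      -- powers disappear and a polynomial in x and y remains.
      clear : ∀ m → ξ * υ * (U′ * (1# + - (U * U * m))) ≈ y + - (x * m)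
      clear m = begin
        ξ * υ * (U′ * (1# + - (U * U * m)))
          ≈⟨ solve 5 (λ ξ υ u′ u m → ξ :* υ :* (u′ :* (:1 :- u :* u :* m)) := υ :* (u′ :* ξ) :- (u′ :* ξ) :* (u :* υ) :* u :* m) refl ξ υ U′ U m ⟩
        υ * (U′ * ξ) + - (U′ * ξ * (U * υ) * U * m)
          ≈⟨ +-cong (*-congˡ U′ξ) (-‿cong (*-congʳ (*-congʳ (*-cong U′ξ Uυ)))) ⟩
        υ * υ + - (υ * ξ * U * m)
          ≈⟨ +-congˡ (-‿cong (trans (solve 4 (λ υ ξ u m → υ :* ξ :* u :* m := (u :* υ) :* ξ :* m) refl υ ξ U m) (*-congʳ (*-congʳ Uυ)))) ⟩
        υ * υ + - (ξ * ξ * m) ∎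

      weight-a : κ * (ξ * υ) * (br (U * s) / br s) ≈ (y + - (ω * ω * z)) * (δ L * d)
      weight-a = trans (sym (*-assoc _ _ _)) (/-≈ br-s≉0 (begin
        κ * (ξ * υ) * br (U * s)
          ≈⟨ *-congˡ (trans (br-inverse (pair UU′ ss′)) (*-congˡ (+-congˡ (-‿cong
               (trans (solve 2 (λ u s → u :* s :* (u :* s) := u :* u :* (s :* s)) refl U s) (*-congˡ ss)))))) ⟩
        κ * (ξ * υ) * (U′ * s′ * (1# + - (U * U * ω)))
          ≈⟨ solve 5 (λ k p u s e → k :* p :* (u :* s :* e) := p :* (u :* e) :* (s :* k)) refl κ (ξ * υ) U′ s′ _ ⟩
        ξ * υ * (U′ * (1# + - (U * U * ω))) * (s′ * κ)
          ≈⟨ *-cong (trans (clear ω) (solve 2 (λ x y → y :- x :* :ω := y :- :ω :* :ω :* (:ω :* :ω :* x)) refl x y)) (sym br-s) ⟩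
        (y + - (ω * ω * z)) * br s
          ≈⟨ *-congʳ (sym (trans (*-congˡ unit) (*-identityʳ _))) ⟩
        (y + - (ω * ω * z)) * (δ L * d) * br s ∎))

      br-U : ξ * υ * br U ≈ y + - x
      br-U = trans (*-congˡ (trans (br-inverse UU′) (*-congˡ (+-congˡ (-‿cong (sym (*-identityʳ _)))))))
        (trans (clear 1#) (+-congˡ (-‿cong (*-identityʳ _))))

      -- Used with r = s for `b⁺` and r = s⁻¹ for `b⁻`. The factor r′ s is then 1 or ω, the origin
      -- of the additional ω in `b⁻`.
      weight-b : ∀ r r′ m → r * r′ ≈ 1# → T * r * (T * r) ≈ m → κ * (ξ * υ) * (br U * br (T * r) / (br s * br T)) ≈ (y + - x) * (r′ * s) * f m * g
      weight-b r r′ m rr′ h = trans (sym (*-assoc _ _ _)) (/-≈ (*-nz br-s≉0 br-T≉0) (begin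
        κ * (ξ * υ) * (br U * br (T * r))
          ≈⟨ *-congˡ (*-congˡ (trans (br-inverse (pair TT′ rr′)) (*-congˡ (+-congˡ (-‿cong h))))) ⟩
        κ * (ξ * υ) * (br U * (T′ * r′ * f m))
          ≈⟨ solve 5 (λ k p b t e → k :* p :* (b :* (t :* e)) := p :* b :* (:1 :* e :* k :* t)) refl κ (ξ * υ) (br U) (T′ * r′) (f m) ⟩
        ξ * υ * br U * (1# * f m * κ * (T′ * r′))
          ≈⟨ *-cong br-U (*-congʳ (*-congʳ (*-congʳ (sym (trans (*-cong ss′ fg≈1) (*-identityˡ 1#)))))) ⟩
        (y + - x) * (s * s′ * (f L * g) * f m * κ * (T′ * r′))
          ≈⟨ solve 9 (λ e s s′ l g m k t r → e :* (s :* s′ :* (l :* g) :* m :* k :* (t :* r)) := e :* (r :* s) :* m :* g :* (s′ :* k :* (t :* l)))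
               refl (y + - x) s s′ (f L) g (f m) κ T′ r′ ⟩
        (y + - x) * (r′ * s) * f m * g * (s′ * κ * (T′ * f L))
          ≈⟨ *-congˡ (sym (*-cong br-s br-T)) ⟩
        (y + - x) * (r′ * s) * f m * g * (br s * br T) ∎))

      -- Used with u = U for `c⁺` and u = U⁻¹ for `c⁻`; `e` is the bracket of λ ± u cleared of half
      -- powers.
      weight-c : ∀ u u′ m e → u * u′ ≈ 1# → u * u ≈ m → ξ * υ * u′ * (1# + - (L * m)) ≈ e → κ * (ξ * υ) * (br (T * u) / br T) ≈ κ * e * g
      weight-c u u′ m e uu′ uu h = trans (sym (*-assoc _ _ _)) (/-≈ br-T≉0 (begin
        κ * (ξ * υ) * br (T * u)
          ≈⟨ *-congˡ (trans (br-inverse (pair TT′ uu′)) (*-congˡ (+-congˡ (-‿cong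
               (trans (solve 2 (λ t u → t :* u :* (t :* u) := t :* t :* (u :* u)) refl T u) (*-cong TT uu)))))) ⟩
        κ * (ξ * υ) * (T′ * u′ * (1# + - (L * m)))
          ≈⟨ solve 5 (λ k p t u e → k :* p :* (t :* u :* e) := k :* (p :* u :* e) :* :1 :* t) refl κ (ξ * υ) T′ u′ (1# + - (L * m)) ⟩
        κ * (ξ * υ * u′ * (1# + - (L * m))) * 1# * T′
          ≈⟨ *-congʳ (*-cong (*-congˡ h) (sym fg≈1)) ⟩
        κ * e * (f L * g) * T′
          ≈⟨ solve 4 (λ a l g t → a :* (l :* g) :* t := a :* g :* (t :* l)) refl (κ * e) (f L) g T′ ⟩
        κ * e * g * (T′ * f L)
          ≈⟨ *-congˡ (sym br-T) ⟩
        κ * e * g * br T ∎))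

      s⁻¹ : s ⁻¹ ≈ s′
      s⁻¹ = inverse-unique′ ss′

      s′s′ : s′ * s′ ≈ ω * ω
      s′s′ = begin
        s′ * s′                        ≈⟨ solve 1 (λ a → a := a :* (:ω :* :ω :* :ω)) refl _ ⟩
        s′ * s′ * (ω * ω * ω)          ≈⟨ *-congˡ (*-congˡ (sym ss)) ⟩
        s′ * s′ * (ω * ω * (s * s))    ≈⟨ solve 2 (λ s s′ → s′ :* s′ :* (:ω :* :ω :* (s :* s)) := s :* s′ :* (s :* s′) :* (:ω :* :ω)) refl s s′ ⟩
        s * s′ * (s * s′) * (ω * ω)    ≈⟨ *-congʳ (trans (*-cong ss′ ss′) (*-identityˡ 1#)) ⟩
        1# * (ω * ω)                   ≈⟨ *-identityˡ _ ⟩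
        ω * ω                          ∎

      square : ∀ r q → r * r ≈ q → T * r * (T * r) ≈ q * L
      square r q h = trans (solve 2 (λ t r → t :* r :* (t :* r) := r :* r :* (t :* t)) refl T r) (*-cong h TT)

    R-weight : ∀ t r b l →
      κ * (ξ * υ) * R (stepℤ t) (stepℤ r) (stepℤ b) (stepℤ l) T (ξ * υ ⁻¹) s ≈ weight d L t r b l z y
    R-weight ⊞ ⊞ ⊞ ⊞ = weight-a
    R-weight ⊟ ⊟ ⊟ ⊟ = weight-a
    R-weight ⊞ ⊟ ⊞ ⊟ = trans (weight-b s s′ (ω * L) ss′ (square s ω ss))
      (*-congʳ (*-congʳ (trans (*-congˡ (trans (*-comm s′ s) ss′)) (solve 2 (λ x y → (y :- x) :* :1 := y :- :ω :* (:ω :* :ω :* x)) refl x y))))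
    R-weight ⊟ ⊞ ⊟ ⊞ = trans (weight-b (s ⁻¹) s (ω * ω * L) (trans (*-congʳ s⁻¹) (trans (*-comm s′ s) ss′))
        (square (s ⁻¹) (ω * ω) (trans (*-cong s⁻¹ s⁻¹) s′s′)))
      (*-congʳ (*-congʳ (trans (*-congˡ ss) (solve 2 (λ x y → (y :- x) :* :ω := :ω :* (y :- :ω :* (:ω :* :ω :* x))) refl x y))))
    R-weight ⊟ ⊞ ⊞ ⊟ = weight-c U U′ (U * U) _ UU′ refl (begin
      ξ * υ * U′ * (1# + - (L * (U * U)))   ≈⟨ solve 4 (λ p u′ L u → p :* u′ :* (:1 :- L :* u) := p :* (u′ :* (:1 :- u :* L))) refl (ξ * υ) U′ L (U * U) ⟩
      ξ * υ * (U′ * (1# + - (U * U * L)))   ≈⟨ clear L ⟩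
      y + - (x * L)                         ≈⟨ solve 3 (λ x y L → y :- x :* L := y :- L :* :ω :* (:ω :* :ω :* x)) refl x y L ⟩
      y + - (L * ω * z)                     ∎)
    R-weight ⊞ ⊟ ⊟ ⊞ = weight-c (U ⁻¹) U (U′ * U′) _ (trans (*-comm _ _) (⁻¹-inverse U≉0)) (*-cong U⁻¹ U⁻¹) (begin
      ξ * υ * U * (1# + - (L * (U′ * U′)))
        ≈⟨ solve 5 (λ ξ υ u L u′ → ξ :* υ :* u :* (:1 :- L :* (u′ :* u′)) := ξ :* (u :* υ) :- L :* ((u :* u′) :* (u′ :* ξ) :* υ)) refl ξ υ U L U′ ⟩
      ξ * (U * υ) + - (L * (U * U′ * (U′ * ξ) * υ))
        ≈⟨ +-cong (*-congˡ Uυ) (-‿cong (*-congˡ (*-congʳ (trans (*-cong UU′ U′ξ) (*-identityˡ υ))))) ⟩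
      ξ * ξ + - (L * (υ * υ))
        ≈⟨ solve 3 (λ x y L → x :- L :* y := :ω :* (:ω :* :ω :* x) :- L :* y) refl x y L ⟩
      ω * z + - (L * y) ∎)
      where
      U≉0 = ≉0-factorˡ UU′ (λ 1≈0 → 0≉1 (sym 1≈0))
      U⁻¹ = inverse-unique′ UU′
    R-weight ⊞ ⊞ ⊞ ⊟ = zeroʳ _
    R-weight ⊞ ⊞ ⊟ ⊞ = zeroʳ _
    R-weight ⊞ ⊞ ⊟ ⊟ = zeroʳ _
    R-weight ⊞ ⊟ ⊞ ⊞ = zeroʳ _
    R-weight ⊞ ⊟ ⊟ ⊟ = zeroʳ _
    R-weight ⊟ ⊞ ⊞ ⊞ = zeroʳ _
    R-weight ⊟ ⊞ ⊟ ⊟ = zeroʳ _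
    R-weight ⊟ ⊟ ⊞ ⊞ = zeroʳ _
    R-weight ⊟ ⊟ ⊞ ⊟ = zeroʳ _
    R-weight ⊟ ⊟ ⊟ ⊞ = zeroʳ _

-- Characterisation of states among families of paths.

module Paths where

  difference : ∀ h s → (h ℤ.+ stepℤ s) ℤ.- h ≡ stepℤ s
  difference h s = ℤS.solve 2 (λ h s → h ℤS.:+ s ℤS.:- h ℤS.:= s) ≡.refl h (stepℤ s)

  ∣step∣ : ∀ h s → ∣ h ℤ.- (h ℤ.+ stepℤ s) ∣ ≡ 1
  ∣step∣ h s = ≡.trans (≡.cong ∣_∣ (ℤS.solve 2 (λ h s → h ℤS.:- (h ℤS.:+ s) ℤS.:= ℤS.:- s) ≡.refl h (stepℤ s))) (unit s)
    where
    unit : ∀ s → ∣ ℤ.- stepℤ s ∣ ≡ 1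
    unit ⊞ = ≡.refl
    unit ⊟ = ≡.refl

  step-of : ∀ x y → ∣ x ℤ.- y ∣ ≡ 1 → Σ[ s ∈ Spin ] y ≡ x ℤ.+ stepℤ s
  step-of x y h = go (x ℤ.- y) h ≡.refl
    where
    rearrange : ∀ i → x ℤ.- y ≡ i → y ≡ x ℤ.+ ℤ.- i
    rearrange i e = ≡.trans (ℤS.solve 2 (λ x y → y ℤS.:= x ℤS.:+ ℤS.:- (x ℤS.:- y)) ≡.refl x y) (≡.cong (λ i → x ℤ.+ ℤ.- i) e)
    go : ∀ i → ∣ i ∣ ≡ 1 → x ℤ.- y ≡ i → Σ[ s ∈ Spin ] y ≡ x ℤ.+ stepℤ s
    go (+ 1)    _ e = ⊟ , rearrange (+ 1) e
    go -[1+ 0 ] _ e = ⊞ , rearrange -[1+ 0 ] e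

  step-injective : ∀ h s t → h ℤ.+ stepℤ s ≡ h ℤ.+ stepℤ t → s ≡ t
  step-injective h s t e = go s t (ℤ-cancelˡ h (stepℤ s) (stepℤ t) e)
    where
    go : ∀ s t → stepℤ s ≡ stepℤ t → s ≡ t
    go ⊞ ⊞ _ = ≡.refl
    go ⊟ ⊟ _ = ≡.refl

  path-adjacent : ∀ {n} h (σ : Vec Spin n) j → ∣ lookup (path h σ) (inject₁ j) ℤ.- lookup (path h σ) (suc j) ∣ ≡ 1
  path-adjacent h (s ∷ σ) zero    = ∣step∣ h s
  path-adjacent h (s ∷ σ) (suc j) = path-adjacent (h ℤ.+ stepℤ s) σ j

  adjacent⇒IsTail : ∀ {n} x (v : Vec ℤ n) → (∀ j → ∣ lookup (x ∷ v) (inject₁ j) ℤ.- lookup (x ∷ v) (suc j) ∣ ≡ 1) → IsTail x v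
  adjacent⇒IsTail x []      h = tt
  adjacent⇒IsTail x (y ∷ v) h with s , e ← step-of x y (h zero) = s , e , adjacent⇒IsTail y v (h ∘ suc)

  adjacent⇒IsRows : ∀ {n m} i (M : Vec (Vec ℤ (suc n)) m) →
    (∀ k j → ∣ lookup (lookup M k) (inject₁ j) ℤ.- lookup (lookup M k) (suc j) ∣ ≡ 1) →
    (∀ k → lookup (lookup M k) zero ≡ + (i ℕ.+ toℕ k)) → IsRows i M
  adjacent⇒IsRows i []            h c = tt
  adjacent⇒IsRows i ((x ∷ v) ∷ M) h c = (≡.trans (c zero) (≡.cong +_ (ℕₚ.+-identityʳ i)) , adjacent⇒IsTail x v (h zero))
    , adjacent⇒IsRows (suc i) M (h ∘ suc) (λ k → ≡.trans (c (suc k)) (≡.cong +_ (ℕₚ.+-suc i (toℕ k))))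

  IsState⇒IsRows : ∀ n (M : Mat n) → IsState n M → IsRows 0 M
  IsState⇒IsRows n M (horizontal , _ , _ , left , _) = adjacent⇒IsRows 0 M horizontal left

  -- The last vertical step is ⊟, as on the right boundary of a state.
  Vertical : ∀ {n} → Vec ℤ (suc n) → Vec ℤ (suc n) → Set
  Vertical {n} u v = (∀ j → ∣ lookup u j ℤ.- lookup v j ∣ ≡ 1) × lookup u (fromℕ n) ≡ + 1 ℤ.+ lookup v (fromℕ n)

  AllVertical : ∀ {n m} → Vec (Vec ℤ (suc n)) (suc m) → Set
  AllVertical {m = m} M = ∀ (i : Fin m) → Vertical (lookup M (inject₁ i)) (lookup M (suc i))

  path-⊞ⁿ : ∀ n i (k : Fin (suc n)) → lookup (path (+ i) (Vec.replicate n ⊞)) k ≡ + (i ℕ.+ toℕ k)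
  path-⊞ⁿ n       i zero    = ≡.cong +_ (≡.sym (ℕₚ.+-identityʳ i))
  path-⊞ⁿ (suc n) i (suc k) = ≡.trans (≡.cong (λ m → lookup (path (+ m) (Vec.replicate n ⊞)) k) (ℕₚ.+-comm i 1))
    (≡.trans (path-⊞ⁿ n (suc i) k) (≡.cong +_ (≡.sym (ℕₚ.+-suc i (toℕ k)))))

  path⇒⊞ⁿ : ∀ n i (σ : Vec Spin n) → (∀ k → lookup (path (+ i) σ) k ≡ + (i ℕ.+ toℕ k)) → σ ≡ Vec.replicate n ⊞
  path⇒⊞ⁿ zero    i []      h = ≡.refl
  path⇒⊞ⁿ (suc n) i (s ∷ σ) h with ≡.refl ← step-injective (+ i) s ⊞ (h (suc zero)) =
    ≡.cong (⊞ ∷_) (path⇒⊞ⁿ n (suc i) σ λ k → ≡.trans (≡.cong (λ m → lookup (path (+ m) σ) k) (ℕₚ.+-comm 1 i))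
      (≡.trans (h (suc k)) (≡.cong +_ (ℕₚ.+-suc i (toℕ k)))))

  path-⊟ⁿ : ∀ n (k : Fin (suc n)) → lookup (path (+ n) (Vec.replicate n ⊟)) k ≡ + (n ∸ toℕ k)
  path-⊟ⁿ n       zero    = ≡.refl
  path-⊟ⁿ (suc n) (suc k) = path-⊟ⁿ n k

  path⇒⊟ⁿ : ∀ n (σ : Vec Spin n) → (∀ k → lookup (path (+ n) σ) k ≡ + (n ∸ toℕ k)) → σ ≡ Vec.replicate n ⊟
  path⇒⊟ⁿ zero    []      h = ≡.refl
  path⇒⊟ⁿ (suc n) (s ∷ σ) h with ≡.refl ← step-injective (+ suc n) s ⊟ (h (suc zero)) =
    ≡.cong (⊟ ∷_) (path⇒⊟ⁿ n σ (h ∘ suc))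

  left-column : ∀ {n m} i (σs : Vec (Vec Spin n) m) k → lookup (lookup (paths i σs) k) zero ≡ + (i ℕ.+ toℕ k)
  left-column i (σ ∷ σs) zero    = ≡.cong +_ (≡.sym (ℕₚ.+-identityʳ i))
  left-column i (σ ∷ σs) (suc k) = ≡.trans (left-column (suc i) σs k) (≡.cong +_ (≡.sym (ℕₚ.+-suc i (toℕ k))))

  paths-adjacent : ∀ {n m} i (σs : Vec (Vec Spin n) m) k j →
    ∣ lookup (lookup (paths i σs) k) (inject₁ j) ℤ.- lookup (lookup (paths i σs) k) (suc j) ∣ ≡ 1
  paths-adjacent i (σ ∷ σs) zero    j = path-adjacent (+ i) σ j
  paths-adjacent i (σ ∷ σs) (suc k) j = paths-adjacent (suc i) σs k j

  finalSpins : ∀ {n m} → Vec Spin n → Vec (Vec Spin n) m → Vec Spin n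
  finalSpins σ []       = σ
  finalSpins σ (τ ∷ τs) = finalSpins τ τs

  last-row : ∀ {n m} i (σ : Vec Spin n) (σs : Vec (Vec Spin n) m) →
    lookup (paths i (σ ∷ σs)) (fromℕ m) ≡ path (+ (i ℕ.+ m)) (finalSpins σ σs)
  last-row i σ []       = ≡.cong (λ j → path (+ j) σ) (≡.sym (ℕₚ.+-identityʳ i))
  last-row {m = suc m} i σ (τ ∷ τs) = ≡.trans (last-row (suc i) τ τs) (≡.cong (λ j → path (+ j) (finalSpins τ τs)) (≡.sym (ℕₚ.+-suc i m)))

  right-column : ∀ {n m} (M : Vec (Vec ℤ (suc n)) (suc m)) k₀ → m ℕ.≤ k₀ → AllVertical M →
    lookup (lookup M zero) (fromℕ n) ≡ + k₀ → ∀ k → lookup (lookup M k) (fromℕ n) ≡ + (k₀ ∸ toℕ k)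
  right-column M k₀ _ vertical h zero = h
  right-column {m = suc m} (u ∷ v ∷ M) (suc k₀) (ℕ.s≤s m≤k₀) vertical h (suc k) =
    right-column (v ∷ M) k₀ m≤k₀ (vertical ∘ suc)
      (ℤ-cancelˡ (+ 1) _ (+ k₀) (≡.trans (≡.sym (proj₂ (vertical zero))) h)) k

  IsState⇒AllVertical : ∀ n (M : Mat n) → IsState n M → AllVertical M
  IsState⇒AllVertical n M (_ , vertical , _ , _ , _ , right) i = vertical i ,
    ≡.trans (right (inject₁ i)) (≡.trans (≡.cong +_ (drop i)) (≡.cong (λ x → + 1 ℤ.+ x) (≡.sym (right (suc i)))))
    where
    drop : ∀ {n} (i : Fin n) → n ∸ toℕ (inject₁ i) ≡ suc (n ∸ suc (toℕ i))
    drop zero    = ≡.refl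
    drop (suc i) = drop i

  -- The right column comes for free: its top entry is n because the first row is all ⊞, and
  -- `Vertical` makes it descend by one in every row.
  AllVertical⇒IsState : ∀ n (σs : Vec (Vec Spin n) n) → AllVertical (paths 0 (Vec.replicate n ⊞ ∷ σs)) →
    finalSpins (Vec.replicate n ⊞) σs ≡ Vec.replicate n ⊟ → IsState n (paths 0 (Vec.replicate n ⊞ ∷ σs))
  AllVertical⇒IsState n σs vertical final =
      paths-adjacent 0 (σ ∷ σs)
    , (λ i → proj₁ (vertical i))
    , path-⊞ⁿ n 0
    , left-column 0 (σ ∷ σs)
    , (λ k → ≡.trans (≡.cong (λ v → lookup v k) (≡.trans (last-row 0 σ σs) (≡.cong (path (+ n)) final))) (path-⊟ⁿ n k))
    , right-column (paths 0 (σ ∷ σs)) n ℕₚ.≤-refl vertical (≡.trans (path-⊞ⁿ n 0 (fromℕ n)) (≡.cong +_ (toℕ-fromℕ n)))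
    where
    σ = Vec.replicate n ⊞

  IsState⇒boundary : ∀ n σ (σs : Vec (Vec Spin n) n) → IsState n (paths 0 (σ ∷ σs)) →
    σ ≡ Vec.replicate n ⊞ × finalSpins σ σs ≡ Vec.replicate n ⊟
  IsState⇒boundary n σ σs (_ , _ , top , _ , bottom , _) = path⇒⊞ⁿ n 0 σ top
    , path⇒⊟ⁿ n (finalSpins σ σs) λ k → ≡.trans (≡.cong (λ v → lookup v k) (≡.sym (last-row 0 σ σs))) (bottom k)

-- Products of block weights and products of rows.

module StateSum {c ℓ} (F : Field c ℓ) (ω : Field.Carrier F)
  (ω-root : FieldLemmas.PrimitiveCubeRoot F ω) where

  open FieldLemmas F
  open EisensteinSolver F ω ω-root
  open Weights F ω ω-root
  open Transfer F ω ω-root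
  open RowExchange F ω ω-root
  open Freezing F ω ω-root
  open PathSums F ω ω-root
  open VertexWeights F ω ω-root
  open Paths

  1≉0 : 1# ≉ 0#
  1≉0 h = 0≉1 (sym h)

  ω≉0 : ω ≉ 0#
  ω≉0 = ≉0-factorˡ (trans (sym (*-assoc ω ω ω)) ω³≈1) 1≉0

  ω*-injective : ∀ {x y} → ω * x ≈ ω * y → x ≈ y
  ω*-injective = *-cancelˡ-nz ω≉0

  ∏-* : ∀ n (g h : Fin n → Carrier) → ∏ n (λ i → g i * h i) ≈ ∏ n g * ∏ n h
  ∏-* zero    g h = sym (*-identityˡ 1#)
  ∏-* (suc n) g h = trans (*-congˡ (∏-* n (g ∘ suc) (h ∘ suc)))
    (solve 4 (λ g h p q → g :* h :* (p :* q) := g :* p :* (h :* q)) refl _ _ _ _)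

  ∑ᵛᵛ-cong : ∀ {n} m {g h : Vec (Vec Spin n) m → Carrier} → (∀ σs → g σs ≈ h σs) → ∑ᵛᵛ n m g ≈ ∑ᵛᵛ n m h
  ∑ᵛᵛ-cong     zero    p = p []
  ∑ᵛᵛ-cong {n} (suc m) p = ∑ᵛ-cong n λ σ → ∑ᵛᵛ-cong m λ σs → p (σ ∷ σs)

  *-∑ᵛᵛ : ∀ {n} m x (g : Vec (Vec Spin n) m → Carrier) → x * ∑ᵛᵛ n m g ≈ ∑ᵛᵛ n m (λ σs → x * g σs)
  *-∑ᵛᵛ     zero    x g = refl
  *-∑ᵛᵛ {n} (suc m) x g = trans (*-∑ᵛ n x _) (∑ᵛ-cong n λ σ → *-∑ᵛᵛ m x _)

  module _ {s : Carrier} (s*s : s * s ≈ ω) where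

    s≉0 : s ≉ 0#
    s≉0 s≈0 = ω≉0 (trans (sym s*s) (trans (*-congʳ s≈0) (zeroˡ s)))

    zpow-suc : ∀ h → zpow s (h ℤ.+ + 1) ≈ s * zpow s h
    zpow-suc (+ n)          = reflexive (≡.cong (pow s) (ℕₚ.+-comm n 1))
    zpow-suc -[1+ zero ]    = sym (trans (*-congˡ (⁻¹-cong (*-identityʳ s))) (⁻¹-inverse s≉0))
    zpow-suc -[1+ suc n ] = *-cancelˡ-nz p≉0 (trans (⁻¹-inverse p≉0) (sym (begin
      p * (s * (s * p) ⁻¹)   ≈⟨ solve 3 (λ p s q → p :* (s :* q) := s :* p :* q) refl p s _ ⟩
      s * p * (s * p) ⁻¹     ≈⟨ ⁻¹-inverse (*-nz s≉0 p≉0) ⟩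
      1#                     ∎)))
      where
      p = pow s (suc n)
      pow≉0 : ∀ n → pow s n ≉ 0#
      pow≉0 zero    = 1≉0
      pow≉0 (suc n) = *-nz s≉0 (pow≉0 n)
      p≉0 = pow≉0 (suc n)

    -- q^(λ + h) as a function of the height h.
    level : Carrier → ℤ → Carrier
    level T h = T * zpow s h * (T * zpow s h)

    level-suc : ∀ T h → level T (h ℤ.+ + 1) ≈ ω * level T h
    level-suc T h = begin
      T * zpow s (h ℤ.+ + 1) * (T * zpow s (h ℤ.+ + 1))
        ≈⟨ *-cong (*-congˡ (zpow-suc h)) (*-congˡ (zpow-suc h)) ⟩
      T * (s * zpow s h) * (T * (s * zpow s h))
        ≈⟨ solve 3 (λ t s z → t :* (s :* z) :* (t :* (s :* z)) := s :* s :* (t :* z :* (t :* z))) refl T s (zpow s h) ⟩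
      s * s * level T h
        ≈⟨ *-congʳ s*s ⟩
      ω * level T h ∎

    level-shift : ∀ T h t {L} → level T h ≈ L → level T (h ℤ.+ stepℤ t) ≈ shift L t
    level-shift T h ⊞ e = trans (level-suc T h) (*-congˡ e)
    level-shift T h ⊟ {L} e = ω*-injective (begin
      ω * level T (h ℤ.+ -[1+ 0 ])         ≈⟨ sym (level-suc T (h ℤ.+ -[1+ 0 ])) ⟩
      level T (h ℤ.+ -[1+ 0 ] ℤ.+ + 1)     ≡⟨ ≡.cong (level T) (ℤS.solve 1 (λ h → h ℤS.:+ ℤS.con -[1+ 0 ] ℤS.:+ ℤS.con (+ 1) ℤS.:= h) ≡.refl h) ⟩
      level T h                            ≈⟨ e ⟩
      L                                    ≈⟨ solve 1 (λ L → L := :ω :* (:ω :* :ω :* L)) refl L ⟩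
      ω * (ω * ω * L)                      ∎)

    shift≉0 : ∀ {L} t → L ≉ 0# → shift L t ≉ 0#
    shift≉0 ⊞ L≉0 = *-nz ω≉0 L≉0
    shift≉0 ⊟ L≉0 = *-nz (*-nz ω≉0 ω≉0) L≉0

    module _ (T d : Carrier) (κ≉0 : κ ≉ 0#) where

      blockR : (ha hb hc hd : ℤ) (ξ υ : Carrier) → Carrier
      blockR ha hb hc hd ξ υ = R (hb ℤ.- ha) (hd ℤ.- hb) (hd ℤ.- hc) (hc ℤ.- ha) (T * zpow s ha) (ξ * υ ⁻¹) s

      scaledRow : ∀ {n} (u v : Vec ℤ (suc n)) (ξ : Carrier) (υ : Fin n → Carrier) → Carrier
      scaledRow {n} u v ξ υ = ∏ n λ j → κ * (ξ * υ j)
        * blockR (lookup u (inject₁ j)) (lookup u (suc j)) (lookup v (inject₁ j)) (lookup v (suc j)) ξ (υ j)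

      squares : ∀ {n} → (Fin n → Carrier) → Vec Carrier n
      squares υ = Vec.tabulate λ j → υ j * υ j

      blockR-weight : ∀ h h′ t r b l ξ υ {L} → h′ ≡ h ℤ.+ stepℤ l → stepℤ t ℤ.+ stepℤ r ≡ stepℤ l ℤ.+ stepℤ b →
        level T h ≈ L → L ≉ 0# → δ L * d ≈ 1# → ξ ≉ 0# → υ ≉ 0# →
        κ * (ξ * υ) * blockR h (h ℤ.+ stepℤ t) h′ (h′ ℤ.+ stepℤ b) ξ υ ≈ weight d L t r b l (ω * ω * (ξ * ξ)) (υ * υ)
      blockR-weight h h′ t r b l ξ υ {L} ≡.refl e level≈ L≉0 unit ξ≉0 υ≉0 = trans
        (*-congˡ (reflexive (≡.trans
          (≡.cong₂ (λ x y → R x y ((h′ ℤ.+ stepℤ b) ℤ.- h′) (h′ ℤ.- h) Tₕ (ξ * υ ⁻¹) s) (difference h t) right-step)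
          (≡.cong₂ (λ x y → R (stepℤ t) (stepℤ r) x y Tₕ (ξ * υ ⁻¹) s) (difference h′ b) (difference h l)))))
        (R-weight κ≉0 (⁻¹-inverse s≉0) (⁻¹-inverse ξ≉0) (⁻¹-inverse υ≉0) (⁻¹-inverse Tₕ≉0) s*s level≈ unit t r b l)
        where
        Tₕ = T * zpow s h
        Tₕ≉0 : Tₕ ≉ 0#
        Tₕ≉0 = ≉0-factorˡ level≈ L≉0
        right-step : (h ℤ.+ stepℤ l ℤ.+ stepℤ b) ℤ.- (h ℤ.+ stepℤ t) ≡ stepℤ r
        right-step = ≡.trans (ℤS.solve 4 (λ h l b t → h ℤS.:+ l ℤS.:+ b ℤS.:- (h ℤS.:+ t) ℤS.:= l ℤS.:+ b ℤS.:- t) ≡.refl h (stepℤ l) (stepℤ b) (stepℤ t))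
          (≡.trans (≡.cong (ℤ._- stepℤ t) (≡.sym e)) (ℤS.solve 2 (λ t r → t ℤS.:+ r ℤS.:- t ℤS.:= r) ≡.refl (stepℤ t) (stepℤ r)))

      -- The right spin of a block is determined by the other three, so each sum in `row` has at
      -- most one nonzero term. Either the heights of the two rows fit, and `row` is the product of
      -- the block weights, or they do not, and `row` vanishes.
      RowCase : ∀ {n} (h h′ : ℤ) (l : Spin) (σ τ : Vec Spin n) (ξ : Carrier) (υ : Fin n → Carrier) (L : Carrier) → Set ℓ
      RowCase h h′ l σ τ ξ υ L =
          (Vertical (path h σ) (path h′ τ) × scaledRow (path h σ) (path h′ τ) ξ υ ≈ row d L l σ τ (ω * ω * (ξ * ξ)) (squares υ))
        ⊎ (¬ Vertical (path h σ) (path h′ τ) × row d L l σ τ (ω * ω * (ξ * ξ)) (squares υ) ≈ 0#)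

      rowCase : ∀ {n} h h′ l (σ τ : Vec Spin n) ξ (υ : Fin n → Carrier) {L} → h′ ≡ h ℤ.+ stepℤ l →
        level T h ≈ L → L ≉ 0# → δ L * d ≈ 1# → ξ ≉ 0# → (∀ j → υ j ≉ 0#) → RowCase h h′ l σ τ ξ υ L
      rowCase h _ ⊟ [] [] ξ υ ≡.refl _ _ _ _ _ = inj₁ (((λ { zero → ∣step∣ h ⊟ })
        , ℤS.solve 1 (λ h → h ℤS.:= ℤS.con (+ 1) ℤS.:+ (h ℤS.:+ ℤS.con -[1+ 0 ])) ≡.refl h) , refl)
      rowCase h _ ⊞ [] [] ξ υ ≡.refl _ _ _ _ _ = inj₂ ((λ (_ , e) → absurd (ℤ-cancelˡ h (+ 0) (+ 2)
        (≡.trans (ℤₚ.+-identityʳ h) (≡.trans e (ℤS.solve 1 (λ h → ℤS.con (+ 1) ℤS.:+ (h ℤS.:+ ℤS.con (+ 1)) ℤS.:= h ℤS.:+ ℤS.con (+ 2)) ≡.refl h))))) , refl)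
        where
        absurd : ¬ (+ 0 ≡ + 2)
        absurd ()
      rowCase {suc n} h h′ l (t ∷ σ) (b ∷ τ) ξ υ {L} ≡.refl level≈ L≉0 unit ξ≉0 υ≉0 = go l t b ≡.refl ≡.refl ≡.refl
        where
        z = ω * ω * (ξ * ξ)
        ys = squares (υ ∘ suc)
        Goal = RowCase h h′ l (t ∷ σ) (b ∷ τ) ξ υ L
        possible : ∀ r → stepℤ t ℤ.+ stepℤ r ≡ stepℤ l ℤ.+ stepℤ b →
          row d L l (t ∷ σ) (b ∷ τ) z (squares υ) ≈ weight d L t r b l z (υ zero * υ zero) * row d (shift L t) r σ τ z ys → Goal
        possible r e row≈ = [ (λ ((adjacent , last) , scaled≈) → inj₁ (((λ { zero → ∣step∣ h l ; (suc j) → adjacent j }) , last)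
              , trans (*-cong (blockR-weight h h′ t r b l ξ (υ zero) ≡.refl e level≈ L≉0 unit ξ≉0 (υ≉0 zero)) scaled≈) (sym row≈)))
          , (λ (¬vertical , row≈0) → inj₂ ((λ (adjacent , last) → ¬vertical (adjacent ∘ suc , last))
              , trans row≈ (trans (*-congˡ row≈0) (zeroʳ _)))) ]′
          (rowCase (h ℤ.+ stepℤ t) (h′ ℤ.+ stepℤ b) r σ τ ξ (υ ∘ suc)
            (≡.trans (ℤₚ.+-assoc h (stepℤ l) (stepℤ b)) (≡.trans (≡.cong (λ x → h ℤ.+ x) (≡.sym e)) (≡.sym (ℤₚ.+-assoc h (stepℤ t) (stepℤ r)))))
            (level-shift T h t level≈) (shift≉0 t L≉0) (δ-shift-unit t unit) ξ≉0 (υ≉0 ∘ suc))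
        -- The heights h + t and h + l + b in the second column differ by 3, which no single
        -- vertical step can bridge.
        impossible : ∀ i → ∣ i ∣ ≡ 3 → stepℤ t ℤ.- (stepℤ l ℤ.+ stepℤ b) ≡ i →
          row d L l (t ∷ σ) (b ∷ τ) z (squares υ) ≈ 0# → Goal
        impossible i ∣i∣≡3 e row≈0 = inj₂ ((λ (adjacent , _) → absurd (≡.trans (≡.sym (adjacent (suc zero)))
          (≡.trans (≡.cong ∣_∣ (≡.trans (ℤS.solve 4 (λ h l b t → h ℤS.:+ t ℤS.:- (h ℤS.:+ l ℤS.:+ b) ℤS.:= t ℤS.:- (l ℤS.:+ b)) ≡.refl h (stepℤ l) (stepℤ b) (stepℤ t)) e)) ∣i∣≡3)))
          , row≈0)
          where
          absurd : ¬ (1 ≡ 3)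
          absurd ()
        go : ∀ l′ t′ b′ → l ≡ l′ → t ≡ t′ → b ≡ b′ → Goal
        go ⊞ ⊞ ⊞ ≡.refl ≡.refl ≡.refl = possible ⊞ ≡.refl (∑ˢ-⊞ (zeroˡ _))
        go ⊞ ⊞ ⊟ ≡.refl ≡.refl ≡.refl = possible ⊟ ≡.refl (∑ˢ-⊟ (zeroˡ _))
        go ⊞ ⊟ ⊞ ≡.refl ≡.refl ≡.refl = impossible -[1+ 2 ] ≡.refl ≡.refl (∑ˢ-0 λ { ⊞ → zeroˡ _ ; ⊟ → zeroˡ _ })
        go ⊞ ⊟ ⊟ ≡.refl ≡.refl ≡.refl = possible ⊞ ≡.refl (∑ˢ-⊞ (zeroˡ _))
        go ⊟ ⊞ ⊞ ≡.refl ≡.refl ≡.refl = possible ⊟ ≡.refl (∑ˢ-⊟ (zeroˡ _))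
        go ⊟ ⊞ ⊟ ≡.refl ≡.refl ≡.refl = impossible (+ 3) ≡.refl ≡.refl (∑ˢ-0 λ { ⊞ → zeroˡ _ ; ⊟ → zeroˡ _ })
        go ⊟ ⊟ ⊞ ≡.refl ≡.refl ≡.refl = possible ⊞ ≡.refl (∑ˢ-⊞ (zeroˡ _))
        go ⊟ ⊟ ⊟ ≡.refl ≡.refl ≡.refl = possible ⊟ ≡.refl (∑ˢ-⊟ (zeroˡ _))

      scaledWeight : ∀ {n m} (M : Vec (Vec ℤ (suc n)) (suc m)) (ξ : Fin m → Carrier) (υ : Fin n → Carrier) → Carrier
      scaledWeight {m = m} M ξ υ = ∏ m λ i → scaledRow (lookup M (inject₁ i)) (lookup M (suc i)) (ξ i) υ

      rows : ∀ {n m} (L : Carrier) (σ : Vec Spin n) (σs : Vec (Vec Spin n) m) (ξ : Fin m → Carrier) (ys : Vec Carrier n) → Carrier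
      rows L σ []       ξ ys = 1#
      rows L σ (τ ∷ τs) ξ ys = row d L ⊞ σ τ (ω * ω * (ξ zero * ξ zero)) ys * rows (ω * L) τ τs (ξ ∘ suc) ys

      matrixCase : ∀ {n m} i (σ : Vec Spin n) (σs : Vec (Vec Spin n) m) ξ υ {L} →
        level T (+ i) ≈ L → L ≉ 0# → δ L * d ≈ 1# → (∀ i → ξ i ≉ 0#) → (∀ j → υ j ≉ 0#) →
          (AllVertical (paths i (σ ∷ σs)) × scaledWeight (paths i (σ ∷ σs)) ξ υ ≈ rows L σ σs ξ (squares υ))
        ⊎ (¬ AllVertical (paths i (σ ∷ σs)) × rows L σ σs ξ (squares υ) ≈ 0#)
      matrixCase i σ []       ξ υ _ _ _ _ _ = inj₁ ((λ ()) , refl)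
      matrixCase i σ (τ ∷ τs) ξ υ {L} level≈ L≉0 unit ξ≉0 υ≉0 =
        [ (λ (vertical , row≈) →
            [ (λ (verticals , rows≈) → inj₁ ((λ { zero → vertical ; (suc k) → verticals k }) , *-cong row≈ rows≈))
            , (λ (¬vertical , rows≈0) → inj₂ ((λ v → ¬vertical (v ∘ suc)) , trans (*-congˡ rows≈0) (zeroʳ _))) ]′
            (matrixCase (suc i) τ τs (ξ ∘ suc) υ
              (trans (reflexive (≡.cong (λ j → level T (+ j)) (ℕₚ.+-comm 1 i))) (level-shift T (+ i) ⊞ level≈))
              (shift≉0 ⊞ L≉0) (δ-shift-unit ⊞ unit) (ξ≉0 ∘ suc) υ≉0))
        , (λ (¬vertical , row≈0) → inj₂ ((λ v → ¬vertical (v zero)) , trans (*-congʳ row≈0) (zeroˡ _))) ]′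
        (rowCase (+ i) (+ suc i) ⊞ σ τ (ξ zero) υ (≡.cong +_ (ℕₚ.+-comm 1 i)) level≈ L≉0 unit (ξ≉0 zero) υ≉0)

      partition-rows : ∀ {n m} L (σ : Vec Spin n) (ξ : Fin m → Carrier) ys →
        partition d L σ (List.tabulate (λ i → ω * ω * (ξ i * ξ i))) ys
        ≈ ∑ᵛᵛ n m (λ σs → rows L σ σs ξ ys * [ finalSpins σ σs all⊟])
      partition-rows {m = zero}      L σ ξ ys = sym (*-identityˡ _)
      partition-rows {n} {suc m} L σ ξ ys = ∑ᵛ-cong n λ τ → trans
        (*-congˡ (partition-rows (ω * L) τ (ξ ∘ suc) ys))
        (trans (*-∑ᵛᵛ m _ _) (∑ᵛᵛ-cong m λ τs → sym (*-assoc _ _ _)))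

-- The state sum Z as the partition function of the polynomial weights.

module PartitionFunction {c ℓ} (F : Field c ℓ) (ω : Field.Carrier F)
  (ω-root : FieldLemmas.PrimitiveCubeRoot F ω) where

  open FieldLemmas F
  open Weights F ω ω-root
  open Transfer F ω ω-root
  open Freezing F ω ω-root
  open PathSums F ω ω-root
  open StateSum F ω ω-root
  open Paths

  [_=⊞] : Spin → Carrier
  [ ⊞ =⊞] = 1#
  [ ⊟ =⊞] = 0#

  [_all⊞] : ∀ {n} → Vec Spin n → Carrier
  [ []    all⊞] = 1#
  [ s ∷ σ all⊞] = [ s =⊞] * [ σ all⊞]

  ∑ᵛ-all⊞ : ∀ n (g : Vec Spin n → Carrier) → ∑ᵛ n (λ σ → [ σ all⊞] * g σ) ≈ g ⊞ⁿ
  ∑ᵛ-all⊞ zero    g = *-identityˡ _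
  ∑ᵛ-all⊞ (suc n) g = trans
    (∑ˢ-⊞ (∑ᵛ-0 n λ σ → trans (*-congʳ (zeroˡ _)) (zeroˡ _)))
    (trans (∑ᵛ-cong n λ σ → *-congʳ (*-identityˡ _)) (∑ᵛ-all⊞ n (g ∘ (⊞ ∷_))))

  all⊞-case : ∀ {n} (σ : Vec Spin n) → (σ ≡ ⊞ⁿ × [ σ all⊞] ≈ 1#) ⊎ (σ ≢ ⊞ⁿ × [ σ all⊞] ≈ 0#)
  all⊞-case []      = inj₁ (≡.refl , refl)
  all⊞-case (⊟ ∷ σ) = inj₂ ((λ ()) , zeroˡ _)
  all⊞-case (⊞ ∷ σ) = [ (λ (e , p) → inj₁ (≡.cong (⊞ ∷_) e , trans (*-identityˡ _) p))
                      , (λ (e , p) → inj₂ ((λ { ≡.refl → e ≡.refl }) , trans (*-identityˡ _) p)) ]′ (all⊞-case σ)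

  all⊟-case : ∀ {n} (σ : Vec Spin n) → (σ ≡ ⊟ⁿ × [ σ all⊟] ≈ 1#) ⊎ (σ ≢ ⊟ⁿ × [ σ all⊟] ≈ 0#)
  all⊟-case []      = inj₁ (≡.refl , refl)
  all⊟-case (⊞ ∷ σ) = inj₂ ((λ ()) , zeroˡ _)
  all⊟-case (⊟ ∷ σ) = [ (λ (e , p) → inj₁ (≡.cong (⊟ ∷_) e , trans (*-identityˡ _) p))
                      , (λ (e , p) → inj₂ ((λ { ≡.refl → e ≡.refl }) , trans (*-identityˡ _) p)) ]′ (all⊟-case σ)

  *-∑ᴸ : ∀ {a} {A : Set a} (xs : List A) x (g : A → Carrier) → x * ∑ᴸ xs g ≈ ∑ᴸ xs (λ y → x * g y)
  *-∑ᴸ []       x g = zeroʳ x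
  *-∑ᴸ (y ∷ xs) x g = trans (distribˡ _ _ _) (+-congˡ (*-∑ᴸ xs x g))

  if-dec : ∀ {p} {P : Set p} {x y} (P? : Dec P) → (P → x ≈ y) → (¬ P → 0# ≈ y) → (if does P? then x else 0#) ≈ y
  if-dec (yes p) h k = h p
  if-dec (no ¬p) h k = k ¬p

  if-no : ∀ {p} {P : Set p} {x} (P? : Dec P) → ¬ P → (if does P? then x else 0#) ≈ 0#
  if-no P? ¬p = if-dec P? (λ p → contradiction p ¬p) (λ _ → refl)

  module _ {s T d : Carrier} (s*s : s * s ≈ ω) (κ≉0 : κ ≉ 0#) {Λ : Carrier} (T*T : T * T ≈ Λ)
    (Λ≉0 : Λ ≉ 0#) (unit : δ Λ * d ≈ 1#) {n : ℕ} (ξ υ : Fin n → Carrier)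
    (ξ≉0 : ∀ i → ξ i ≉ 0#) (υ≉0 : ∀ j → υ j ≉ 0#) where

    scale : Carrier
    scale = ∏ n λ i → ∏ n λ j → κ * (ξ i * υ j)

    scale-stateWeight : ∀ M → scale * stateWeight M ξ υ T s ≈ scaledWeight s*s T d κ≉0 M ξ υ
    scale-stateWeight M = trans (sym (∏-* n _ _)) (∏-cong n λ i → sym (∏-* n _ _))

    ys : Vec Carrier n
    ys = squares s*s T d κ≉0 υ

    zs : List Carrier
    zs = List.tabulate λ i → ω * ω * (ξ i * ξ i)

    -- Extension by zero turns the sum over the filtered list of states into a sum over all matrices
    -- with entries in the box, which can be carried out row by row.
    summand : Mat n → Carrier
    summand M = if does (isState? n M) then scale * stateWeight M ξ υ T s else 0#

    level-0 : level s*s T (+ 0) ≈ Λ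
    level-0 = trans (*-cong (*-identityʳ T) (*-identityʳ T)) T*T

    summand-outside : ∀ M → ¬ IsRows 0 M → summand M ≈ 0#
    summand-outside M ¬rows = if-no (isState? n M) (¬rows ∘ IsState⇒IsRows n M)

    -- A family of paths is a state exactly when its first row is all ⊞, its last row all ⊟ and the
    -- vertical steps fit. Failure of one of the three makes one of the three factors on the right
    -- vanish.
    summand-paths : ∀ σ (σs : Vec (Vec Spin n) n) →
      summand (paths 0 (σ ∷ σs)) ≈ [ σ all⊞] * (rows s*s T d κ≉0 Λ σ σs ξ ys * [ finalSpins σ σs all⊟])
    summand-paths σ σs = if-dec (isState? n M) state nonstate
      where
      M = paths 0 (σ ∷ σs)
      W = rows s*s T d κ≉0 Λ σ σs ξ ys
      E = [ finalSpins σ σs all⊟]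
      cases = matrixCase s*s T d κ≉0 0 σ σs ξ υ level-0 Λ≉0 unit ξ≉0 υ≉0
      zero₁ : ∀ {x y} → x ≈ 0# → 0# ≈ x * y
      zero₁ h = sym (trans (*-congʳ h) (zeroˡ _))
      zero₂ : ∀ {x y} → y ≈ 0# → 0# ≈ x * y
      zero₂ h = sym (trans (*-congˡ h) (zeroʳ _))
      state : IsState n M → scale * stateWeight M ξ υ T s ≈ [ σ all⊞] * (W * E)
      state st =
        [ (λ (_ , weight≈) → trans (scale-stateWeight M) (trans weight≈ (sym (trans
            (*-cong (top≈ (all⊞-case σ)) (*-congˡ (bottom≈ (all⊟-case (finalSpins σ σs)))))
            (trans (*-identityˡ _) (*-identityʳ _))))))
        , (λ (¬vertical , _) → contradiction (IsState⇒AllVertical n M st) ¬vertical) ]′ cases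
        where
        boundary = IsState⇒boundary n σ σs st
        top≈ : (σ ≡ ⊞ⁿ × [ σ all⊞] ≈ 1#) ⊎ (σ ≢ ⊞ⁿ × [ σ all⊞] ≈ 0#) → [ σ all⊞] ≈ 1#
        top≈ (inj₁ (_ , h)) = h
        top≈ (inj₂ (≢ , _)) = contradiction (proj₁ boundary) ≢
        bottom≈ : (finalSpins σ σs ≡ ⊟ⁿ × E ≈ 1#) ⊎ (finalSpins σ σs ≢ ⊟ⁿ × E ≈ 0#) → E ≈ 1#
        bottom≈ (inj₁ (_ , h)) = h
        bottom≈ (inj₂ (≢ , _)) = contradiction (proj₂ boundary) ≢
      nonstate : ¬ IsState n M → 0# ≈ [ σ all⊞] * (W * E)
      nonstate ¬st =
        [ (λ (σ≡ , _) → [ (λ (vertical , _) →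
              [ (λ (final , _) → contradiction (build σ σ≡ vertical final) ¬st)
              , (λ (_ , h) → zero₂ (sym (zero₂ h))) ]′ (all⊟-case (finalSpins σ σs)))
            , (λ (_ , h) → zero₂ (sym (zero₁ h))) ]′ cases)
        , (λ (_ , h) → zero₁ h) ]′ (all⊞-case σ)
        where
        build : ∀ σ → σ ≡ ⊞ⁿ → AllVertical (paths 0 (σ ∷ σs)) → finalSpins σ σs ≡ ⊟ⁿ → IsState n (paths 0 (σ ∷ σs))
        build _ ≡.refl = AllVertical⇒IsState n σs

    Z-partition : scale * Z n ξ υ T s ≈ partition d Λ ⊞ⁿ zs ys
    Z-partition = begin
      scale * ∑ᴸ (states n) (λ M → stateWeight M ξ υ T s)
        ≈⟨ *-∑ᴸ (states n) scale _ ⟩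
      ∑ᴸ (states n) (λ M → scale * stateWeight M ξ υ T s)
        ≈⟨ ∑ᴸ-filter (isState? n) _ (vecs (vecs (box n) (suc n)) (suc n)) ⟩
      ∑ᴸ (vecs (vecs (box n) (suc n)) (suc n)) summand
        ≈⟨ ∑ᴸ-matrices n (suc n) 0 summand ℕₚ.≤-refl summand-outside ⟩
      ∑ᵛ n (λ σ → ∑ᵛᵛ n n λ σs → summand (paths 0 (σ ∷ σs)))
        ≈⟨ ∑ᵛ-cong n (λ σ → trans (∑ᵛᵛ-cong n (summand-paths σ)) (sym (*-∑ᵛᵛ n _ _))) ⟩
      ∑ᵛ n (λ σ → [ σ all⊞] * ∑ᵛᵛ n n (λ σs → rows s*s T d κ≉0 Λ σ σs ξ ys * [ finalSpins σ σs all⊟]))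
        ≈⟨ ∑ᵛ-all⊞ n _ ⟩
      ∑ᵛᵛ n n (λ σs → rows s*s T d κ≉0 Λ ⊞ⁿ σs ξ ys * [ finalSpins ⊞ⁿ σs all⊟])
        ≈⟨ sym (partition-rows s*s T d κ≉0 Λ ⊞ⁿ ξ ys) ⟩
      partition d Λ ⊞ⁿ zs ys ∎

-- Normalisation constants and the final evaluation.

module Evaluation {c ℓ} (F : Field c ℓ) (ω : Field.Carrier F)
  (ω-root : FieldLemmas.PrimitiveCubeRoot F ω) (char0 : FieldLemmas.CharacteristicZero F) where

  open FieldLemmas F
  open EisensteinSolver F ω ω-root
  open Weights F ω ω-root
  open Transfer F ω ω-root
  open Freezing F ω ω-root
  open Determinants F ω ω-root using (pow-+; pow-cong)
  open Alternants F ω ω-root using (pow-pow)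
  open Determinant F ω ω-root using (numerator; scalar)
  open DeterminantIdentity F ω ω-root char0 using (κ≉0)
  open Enumeration F ω ω-root char0 using (pow-1)
  open HomogeneousLimit F ω ω-root char0 using (homogeneous; pow-fromℕ′)
  open StateSum F ω ω-root using (∏-*; 1≉0; ω≉0)
  open VertexWeights F ω ω-root using (≉0-factorˡ)
  open PartitionFunction F ω ω-root
  open FactorialProducts using (threes)

  pow-* : ∀ x y n → pow (x * y) n ≈ pow x n * pow y n
  pow-* x y zero    = sym (*-identityˡ 1#)
  pow-* x y (suc n) = trans (*-congˡ (pow-* x y n))
    (solve 4 (λ x y p q → x :* y :* (p :* q) := x :* p :* (y :* q)) refl x y _ _)

  pow-^ : ∀ x m n → pow (pow x m) n ≈ pow x (n ℕ.* m)
  pow-^ x m zero    = refl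
  pow-^ x m (suc n) = trans (*-congˡ (pow-^ x m n)) (sym (pow-+ x m (n ℕ.* m)))

  pow≉0 : ∀ {x} n → x ≉ 0# → pow x n ≉ 0#
  pow≉0 zero    x≉0 = 1≉0
  pow≉0 (suc n) x≉0 = *-nz x≉0 (pow≉0 n x≉0)

  ∏-const : ∀ n x → ∏ n (λ _ → x) ≈ pow x n
  ∏-const zero    x = refl
  ∏-const (suc n) x = *-congˡ (∏-const n x)

  ∏-pow : ∀ n k (g : Fin n → Carrier) → ∏ n (λ i → pow (g i) k) ≈ pow (∏ n g) k
  ∏-pow zero    k g = sym (pow-1 k)
  ∏-pow (suc n) k g = trans (*-congˡ (∏-pow n k (g ∘ suc))) (sym (pow-* _ _ k))

  -- Apart from a power of κ, the factors ξ υ that clear the half powers multiply to precisely the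
  -- normalisation of `Ztilde`.
  ∏∏-scale : ∀ n (ξ υ : Fin n → Carrier) →
    ∏ n (λ i → ∏ n (λ j → κ * (ξ i * υ j))) ≈ pow κ (n ℕ.* n) * (∏ n (λ i → pow (ξ i) n) * ∏ n (λ j → pow (υ j) n))
  ∏∏-scale n ξ υ = begin
    ∏ n (λ i → ∏ n (λ j → κ * (ξ i * υ j)))
      ≈⟨ ∏-cong n (λ i → trans (∏-* n _ _) (*-cong (∏-const n κ) (trans (∏-* n _ υ) (*-congʳ (∏-const n (ξ i)))))) ⟩
    ∏ n (λ i → pow κ n * (pow (ξ i) n * ∏ n υ))
      ≈⟨ trans (∏-* n _ _) (*-cong (∏-const n (pow κ n)) (∏-* n _ _)) ⟩
    pow (pow κ n) n * (∏ n (λ i → pow (ξ i) n) * ∏ n (λ _ → ∏ n υ))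
      ≈⟨ *-cong (pow-^ κ n n) (*-congˡ (trans (∏-const n (∏ n υ)) (sym (∏-pow n n υ)))) ⟩
    pow κ (n ℕ.* n) * (∏ n (λ i → pow (ξ i) n) * ∏ n (λ j → pow (υ j) n)) ∎

  pow-triangle : ∀ n → pow ω (suc n C 2) ≈ pow ω n * pow ω (n C 2)
  pow-triangle n = trans (reflexive (≡.cong (pow ω) (≡.trans (≡.sym (nCk+nC[k+1]≡[n+1]C[k+1] n 1)) (≡.cong (ℕ._+ n C 2) (nC1≡n n)))))
    (pow-+ ω n (n C 2))

  -- By κ² = − 3 ω.
  scalar-threes : ∀ n → scalar n * fromℕ′ (threes n) ≈ pow κ (n ℕ.* n) * pow ω (n C 2)
  scalar-threes zero    = *-congˡ (+-identityʳ 1#)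
  scalar-threes (suc n) = begin
    κ * pow (- (ω * ω)) n * scalar n * fromℕ′ (3 ℕ.^ n ℕ.* threes n)
      ≈⟨ *-congˡ (trans (fromℕ′-* (3 ℕ.^ n) (threes n)) (*-congʳ (sym (pow-fromℕ′ 3 n)))) ⟩
    κ * pow (- (ω * ω)) n * scalar n * (pow (fromℕ′ 3) n * fromℕ′ (threes n))
      ≈⟨ solve 5 (λ k p s t u → k :* p :* s :* (t :* u) := k :* (p :* t) :* (s :* u)) refl κ _ (scalar n) _ _ ⟩
    κ * (pow (- (ω * ω)) n * pow (fromℕ′ 3) n) * (scalar n * fromℕ′ (threes n))
      ≈⟨ *-cong (*-congˡ (trans (sym (pow-* _ _ n)) (trans (pow-cong n cube) (trans (pow-* _ ω n) (*-congʳ (pow-* κ κ n)))))) (scalar-threes n) ⟩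
    κ * (pow κ n * pow κ n * pow ω n) * (pow κ (n ℕ.* n) * pow ω (n C 2))
      ≈⟨ solve 5 (λ k p w q t → k :* (p :* p :* w) :* (q :* t) := k :* (p :* (p :* q)) :* (w :* t)) refl κ (pow κ n) (pow ω n) _ _ ⟩
    κ * (pow κ n * (pow κ n * pow κ (n ℕ.* n))) * (pow ω n * pow ω (n C 2))
      ≈⟨ *-cong (*-congˡ (sym (trans (pow-+ κ n (n ℕ.+ n ℕ.* n)) (*-congˡ (pow-+ κ n (n ℕ.* n)))))) (sym (pow-triangle n)) ⟩
    pow κ (suc (n ℕ.+ (n ℕ.+ n ℕ.* n))) * pow ω (suc n C 2)
      ≡⟨ ≡.cong (λ m → pow κ m * pow ω (suc n C 2)) (ℕS.solve 1 (λ n → ℕS.con 1 ℕS.:+ (n ℕS.:+ (n ℕS.:+ n ℕS.:* n))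
           ℕS.:= (ℕS.con 1 ℕS.:+ n) ℕS.:* (ℕS.con 1 ℕS.:+ n)) ≡.refl n) ⟩
    pow κ (suc n ℕ.* suc n) * pow ω (suc n C 2) ∎
    where
    cube : - (ω * ω) * fromℕ′ 3 ≈ κ * κ * ω
    cube = solve 1 (λ _ → :- (:ω :* :ω) :* (:1 :+ (:1 :+ (:1 :+ :0))) := (:1 :- :ω) :* (:1 :- :ω) :* :ω) refl 0#

  module _ {s T Λ : Carrier} (s*s : s * s ≈ ω) (T*T : T * T ≈ Λ) (Λ≉0 : Λ ≉ 0#)
    (generic : ∀ (k : ℕ) → ¬ (Λ * pow ω k ≈ 1#)) (n : ℕ) (ξ υ : Fin n → Carrier)
    (ξ*ξ : ∀ i → ξ i * ξ i ≈ ω) (υ*υ : ∀ j → υ j * υ j ≈ 1#) where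

    factor≉0 : ∀ k {x} → x ≈ Λ * pow ω k → 1# + - x ≉ 0#
    factor≉0 k x≈ h = generic k (trans (sym x≈) (sym (x-y≈0⇒x≈y h)))

    δΛ≉0 : δ Λ ≉ 0#
    δΛ≉0 = *-nz (*-nz (factor≉0 0 (sym (*-identityʳ Λ)))
      (factor≉0 1 (solve 1 (λ L → :ω :* L := L :* (:ω :* :1)) refl Λ)))
      (factor≉0 2 (solve 1 (λ L → :ω :* :ω :* L := L :* (:ω :* (:ω :* :1))) refl Λ))

    unit : δ Λ * δ Λ ⁻¹ ≈ 1#
    unit = ⁻¹-inverse δΛ≉0

    ξ≉0 : ∀ i → ξ i ≉ 0#
    ξ≉0 i = ≉0-factorˡ (ξ*ξ i) ω≉0

    υ≉0 : ∀ j → υ j ≉ 0#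
    υ≉0 j = ≉0-factorˡ (υ*υ j) 1≉0

    points : List Carrier
    points = zs s*s κ≉0 T*T Λ≉0 unit ξ υ ξ≉0 υ≉0

    pointsᵛ : Vec Carrier n
    pointsᵛ = ys s*s κ≉0 T*T Λ≉0 unit ξ υ ξ≉0 υ≉0

    -- As x = ω z, the value x = ω of the theorem is z = ω² ω = 1, the homogeneous point.
    points≈1 : All (_≈ 1#) points
    points≈1 = Allₚ.tabulate⁺ λ i → trans (*-congˡ (ξ*ξ i)) ω³≈1

    pointsᵛ≈1 : All (_≈ 1#) (toList pointsᵛ)
    pointsᵛ≈1 = all-tabulate n (λ j → υ j * υ j) υ*υ
      where
      all-tabulate : ∀ n (g : Fin n → Carrier) → (∀ j → g j ≈ 1#) → All (_≈ 1#) (toList (Vec.tabulate g))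
      all-tabulate zero    g h = []
      all-tabulate (suc n) g h = h zero ∷ all-tabulate n (g ∘ suc) (h ∘ suc)

    private
      w m K tri α γ : Carrier
      w = pow ω n
      m = pow (- 1#) n
      K = pow κ (n ℕ.* n)
      tri = pow ω (n C 2)
      α = Aₙ n
      γ = Cₙ n

    factor : ℕ → Carrier
    factor k = 1# + - (Λ * pow ω (n ℕ.+ k))

    scaled-Ztilde : K * Ztilde n ξ υ T s ≈ partition (δ Λ ⁻¹) Λ ⊞ⁿ points pointsᵛ
    scaled-Ztilde = trans (trans (sym (*-assoc _ _ _)) (*-congʳ (sym (∏∏-scale n ξ υ))))
      (Z-partition s*s κ≉0 T*T Λ≉0 unit ξ υ ξ≉0 υ≉0)

    denominator≉0 : factor 1 * factor 2 ≉ 0#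
    denominator≉0 = *-nz (factor≉0 (n ℕ.+ 1) refl) (factor≉0 (n ℕ.+ 2) refl)

    numerator≈ : factor 1 * factor 2 * (K * Ztilde n ξ υ T s) ≈ numerator (δ Λ ⁻¹) Λ points pointsᵛ
    numerator≈ = *-cong (*-cong (factor≈ 1) (factor≈ 2)) scaled-Ztilde
      where
      factor≈ : ∀ k → factor k ≈ f (pow ω (k ℕ.+ n) * Λ)
      factor≈ k = f-cong (trans (*-comm _ _) (*-congʳ (reflexive (≡.cong (pow ω) (ℕₚ.+-comm n k)))))

    w³≈1 : w * w * w ≈ 1#
    w³≈1 = trans (solve 1 (λ w → w :* w :* w := w :* (w :* (w :* :1))) refl w)
      (trans (pow-pow ω n 3) (trans (pow-cong n (trans (solve 1 (λ _ → :ω :* (:ω :* (:ω :* :1)) := :1) refl 0#) refl)) (pow-1 n)))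

    evaluation : Ztilde n ξ υ T s ≈ pow ω (suc n C 2) / (factor 1 * factor 2)
      * (α * (1# + w * (Λ * Λ)) + m * γ * pow ω (2 ℕ.* n) * Λ)
    evaluation = *-cancelˡ-nz (*-nz denominator≉0 (pow≉0 (n ℕ.* n) κ≉0)) (begin
      D * K * Ztilde n ξ υ T s
        ≈⟨ trans (*-assoc _ _ _) numerator≈ ⟩
      numerator (δ Λ ⁻¹) Λ points pointsᵛ
        ≈⟨ homogeneous n points pointsᵛ unit (Listₚ.length-tabulate _) points≈1 pointsᵛ≈1 ⟩
      scalar n * fromℕ′ (threes n) * (α * (w + w * w * (Λ * Λ)) + m * γ * Λ)
        ≈⟨ *-congʳ (scalar-threes n) ⟩
      K * tri * (α * (w + w * w * (Λ * Λ)) + m * γ * Λ)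
        -- Multiplying the linear term by ω³ⁿ = 1 gives all terms the common factor ωⁿ, which raises
        -- the exponent n choose 2 to n + 1 choose 2 and leaves ω²ⁿ in front of Λ.
        ≈⟨ *-congˡ (+-congˡ (sym (trans (*-congʳ w³≈1) (*-identityˡ _)))) ⟩
      K * tri * (α * (w + w * w * (Λ * Λ)) + w * w * w * (m * γ * Λ))
        ≈⟨ solve 7 (λ K t α w L m γ → K :* t :* (α :* (w :+ w :* w :* (L :* L)) :+ w :* w :* w :* (m :* γ :* L))
             := K :* (w :* t) :* (α :* (:1 :+ w :* (L :* L)) :+ m :* γ :* (w :* w) :* L)) refl K tri α w Λ m γ ⟩
      K * (w * tri) * (α * (1# + w * (Λ * Λ)) + m * γ * (w * w) * Λ)
        ≈⟨ *-cong (*-congˡ (sym (pow-triangle n))) (+-congˡ (*-congʳ (*-congˡ (sym w²≈)))) ⟩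
      K * P * (α * (1# + w * (Λ * Λ)) + m * γ * pow ω (2 ℕ.* n) * Λ)
        ≈⟨ *-congʳ (sym (trans (solve 4 (λ D K P i → D :* K :* (P :* i) := K :* P :* (D :* i)) refl D K P (D ⁻¹))
             (trans (*-congˡ (⁻¹-inverse denominator≉0)) (*-identityʳ _)))) ⟩
      D * K * (P / D) * (α * (1# + w * (Λ * Λ)) + m * γ * pow ω (2 ℕ.* n) * Λ)
        ≈⟨ *-assoc _ _ _ ⟩
      D * K * (P / D * (α * (1# + w * (Λ * Λ)) + m * γ * pow ω (2 ℕ.* n) * Λ)) ∎)
      where
      D = factor 1 * factor 2
      P = pow ω (suc n C 2)
      w²≈ : pow ω (2 ℕ.* n) ≈ w * w
      w²≈ = trans (reflexive (≡.cong (λ k → pow ω (n ℕ.+ k)) (ℕₚ.+-identityʳ n))) (pow-+ ω n n)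

theorem8p1 : ∀ {c ℓ} (F : Field c ℓ) → let open FieldDefs F in
    (∀ (m : ℕ) → ¬ (fromℕ′ (suc m) ≈ 0#)) →
    (ω s : Carrier) → ω * ω + ω + 1# ≈ 0# → s * s ≈ ω →
    (n : ℕ) →
    (ξ υ : Fin n → Carrier) → (∀ i → ξ i * ξ i ≈ ω) → (∀ j → υ j * υ j ≈ 1#) →
    (T Λ : Carrier) → T * T ≈ Λ → ¬ (Λ ≈ 0#) → (∀ (a : ℕ) → ¬ (Λ * pow ω a ≈ 1#)) →
    Ztilde n ξ υ T s
    ≈ pow ω ((suc n) C 2)
    / ((1# + - (Λ * pow ω (n ℕ.+ 1))) * (1# + - (Λ * pow ω (n ℕ.+ 2))))
    * (Aₙ n * (1# + pow ω n * (Λ * Λ))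
    + pow (- 1#) n * Cₙ n * pow ω (2 ℕ.* n) * Λ)
theorem8p1 F char0 ω s ω-root s*s n ξ υ ξ*ξ υ*υ T Λ T*T Λ≉0 generic =
  Evaluation.evaluation F ω ω-root char0 s*s T*T Λ≉0 generic n ξ υ ξ*ξ υ*υ
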